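{- The Fourier transform $\mathcal F_X$ belongs to $\mathrm{End}_G(L^2(X))$ and $$\mathcal F_X=\sum_{0\le r_1,r_2\le n}\ \sum_{s=0}^{N(r_1,r_2)}k_s^{r_1,r_2}\,\widetilde\Lambda_s^{r_1,r_2},\qquad k_s^{r_1,r_2}=(-2)^s\sqrt{\binom{n-2s}{r_2-s}\Big/\binom{n-2s}{r_1-s}}\;P_{r_1-s}(r_2-s,\,n-2s).$$
   Context: Let $\Omega$ be a finite set with $|\Omega|=n\ge1$, $G=S(\Omega)$, $X=\mathcal P(\Omega)$, $X_r=\{x\in X:|x|=r\}$, $G$ acting on $L^2(X)$ (complex functions on $X$ with standard inner product; $L^2(X_r)$ = functions supported on $X_r$) by $(\rho(g)\psi)(x)=\psi(g^{ -1}x)$; $\mathrm{End}_G(L^2(X))$ is the algebra of linear endomorphisms commuting with all $\rho(g)$. For $0\le s\le\min(r,n-r)$, $L^2(X_r)_s$ is the unique irreducible $G$-subspace of $L^2(X_r)$ isomorphic to the irreducible representation associated with the partition $(n-s,s)$. $N(r_1,r_2)=\min(r_1,n-r_1,r_2,n-r_2)$. For $0\le s\le N(r_1,r_2)$, $\Lambda_s^{r_1,r_2}$ is a $G$-equivariant map $L^2(X)\to L^2(X)$ sending $L^2(X_{r_1})_s$ into $L^2(X_{r_2})_s$ and vanishing on its orthogonal complement, with kernel $\lambda$ defined on integers $\max(0,r_2-r_1)\le k\le\min(n-r_1,r_2)$ by $(\Lambda_s^{r_1,r_2}\psi)(x_2)=\sum_{x_1\in X_{r_1}}\lambda(|x_2\setminus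 x_1|)\psi(x_1)$; the kernel agrees on its domain with a unique polynomial of degree $s$, nonzero at $0$, and $\Lambda_s^{r_1,r_2}$ is normalized so that this polynomial is $1$ at $t=0$. Set $\widetilde\Lambda_s^{r_1,r_2}=\alpha_s^{r_1,r_2}\Lambda_s^{r_1,r_2}$ with $\alpha_s^{r_1,r_2}=\dfrac{[n-r_1]_s[r_2]_s}{\sqrt{\binom{n-2s}{r_1-s}\binom{n-2s}{r_2-s}}\,s!\,[n-s+1]_s}$, where $[\alpha]_k=\alpha(\alpha-1)\cdots(\alpha-k+1)$. The Fourier transform is $\mathcal F_X\in\mathrm{End}(L^2(X))$, $(\mathcal F_X\psi)(x)=\sum_{x'\in X}(-1)^{|x\cap x'|}\psi(x')$. Krawtchouk polynomials: $P_m(k,N)=\sum_{j=0}^m(-1)^j\binom{k}{j}\binom{N-k}{m-j}$. -}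

module Defs where

open import Algebra.Apartness.Bundles using (HeytingField; HeytingCommutativeRing)
open import Algebra.Bundles using (CommutativeRing; AbelianGroup)
import Algebra.Construct.Pointwise as Pointwise
open import Algebra.Module.Bundles using (Module)
open import Algebra.Module.Morphism.Structures using (IsModuleHomomorphism; IsModuleIsomorphism)
open import Algebra.Module.Structures.Biased using (IsModuleFromLeft)
import Algebra.Properties.CommutativeMonoid.Sum as Sum
import Algebra.Properties.Ring as RingProperties
import Algebra.Properties.Semiring.Exp as Exp
import Algebra.Properties.Semiring.Mult as Mult
import Algebra.Solver.Ring.NaturalCoefficients.Default as SemiringSolver
open import Data.Bool.Base using (if_then_else_)
import Data.Bool.Properties as Bool
open import Data.Fin.Base using (Fin; toℕ; fromℕ; inject≤)
open import Data.Fin.Permutation using (Permutation′; _⟨$⟩ʳ_; _⟨$⟩ˡ_; flip)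
import Data.Fin.Permutation as Perm
import Data.Fin.Properties as Fin
open import Data.Fin.Subset using (Subset; inside; outside; ∣_∣; _∩_; _─_)
open import Data.Nat.Base as ℕ using (ℕ; zero; suc; NonZero; _∸_; _⊓_; _!; z≤n; s≤s)
open import Data.Nat.Combinatorics using (_C_; _P_; nCk+nC[k+1]≡[n+1]C[k+1])
open import Data.Nat.Combinatorics.Specification using (nPk≡n!/[n∸k]!)
open import Data.Nat.DivMod using (m≥n⇒m/n>0)
import Data.Nat.Properties as ℕ
open import Data.Product.Base using (∃; _×_; _,_; proj₁; proj₂)
open import Data.Sum.Base using (_⊎_; inj₁; inj₂)
open import Data.Vec.Base using ([]; _∷_; lookup; tabulate)
open import Data.Vec.Functional using (Vector)
open import Data.Vec.Properties using (≡-dec; lookup∘tabulate; tabulate-cong; tabulate∘lookup)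
open import Function.Base using (_∘_)
open import Function.Bundles using (_↔_; Inverse; mk⇔)
open import Function.Construct.Composition using (_↔-∘_)
open import Level using (0ℓ)
open import Relation.Binary.Core using (Rel)
open import Relation.Binary.PropositionalEquality as ≡ using (_≡_; _≢_)
open import Relation.Binary.Structures using (IsStrictPartialOrder)
open import Relation.Nullary.Decidable using (does; does-⇔)
open import Relation.Nullary.Negation using (¬_; contradiction)

-- The real numbers, axiomatised as a Cauchy-complete Archimedean ordered field.
-- Classically this determines ℝ up to isomorphism.  The axioms are also
-- constructively valid: Bishop's regular Cauchy sequences satisfy them.

record RealNumbers : Set₁ where
  infix 4 _<_ _≤_
  field
    heytingField : HeytingField 0ℓ 0ℓ 0ℓ

  open HeytingField heytingField public

  commutativeRing : CommutativeRing 0ℓ 0ℓ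
  commutativeRing = HeytingCommutativeRing.commutativeRing heytingCommutativeRing

  open CommutativeRing commutativeRing public using (semiring; +-commutativeMonoid)
  open Mult semiring using () renaming (_×_ to _·_)

  ι : ℕ → Carrier
  ι m = m · 1#

  field
    _<_                  : Rel Carrier 0ℓ
    isStrictPartialOrder : IsStrictPartialOrder _≈_ _<_
    #⇒<⊎>                : ∀ {x y} → x # y → x < y ⊎ y < x
    <⇒#                  : ∀ {x y} → x < y → x # y
    +-monoˡ-<            : ∀ {x y} z → x < y → x + z < y + z
    *-positive           : ∀ {x y} → 0# < x → 0# < y → 0# < x * y

  _≤_ : Rel Carrier 0ℓ
  x ≤ y = ¬ (y < x)

  IsCauchy : (ℕ → Carrier) → Set
  IsCauchy u = ∀ k → ∃ λ M → ∀ i j → M ℕ.≤ i → M ℕ.≤ j → ι (suc k) * (u i - u j) < 1#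

  _ConvergesTo_ : (ℕ → Carrier) → Carrier → Set
  u ConvergesTo x = ∀ k → ∃ λ M → ∀ i → M ℕ.≤ i →
    ι (suc k) * (u i - x) < 1# × ι (suc k) * (x - u i) < 1#

  -- The square root is determined by its laws on the nonnegative reals, and
  -- its values elsewhere are unspecified.
  field
    archimedean   : ∀ x → ∃ λ m → x < ι m
    complete      : ∀ u → IsCauchy u → ∃ (u ConvergesTo_)
    √             : Carrier → Carrier
    √-nonnegative : ∀ {x} → 0# ≤ x → 0# ≤ √ x
    √-square      : ∀ {x} → 0# ≤ x → √ x * √ x ≈ x

module PositiveReals (ℝ : RealNumbers) where
  open RealNumbers ℝ
  open IsStrictPartialOrder isStrictPartialOrder public
    using (<-respʳ-≈; <-respˡ-≈) renaming (irrefl to <-irrefl; trans to <-trans)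
  open RingProperties (CommutativeRing.ring commutativeRing)
    using (-‿distribˡ-*; -‿involutive; -0#≈0#)

  0<1 : 0# < 1#
  0<1 with #⇒<⊎> (invertible⇒# {1#} {0#} (1# , inverse , inverse′))
    where
    1-0≈1 : 1# - 0# ≈ 1#
    1-0≈1 = trans (+-congˡ -0#≈0#) (+-identityʳ 1#)
    inverse : 1# * (1# - 0#) ≈ 1#
    inverse = trans (*-identityˡ _) 1-0≈1
    inverse′ : (1# - 0#) * 1# ≈ 1#
    inverse′ = trans (*-identityʳ _) 1-0≈1
  ... | inj₂ 0<1 = 0<1
  ... | inj₁ 1<0 = <-respʳ-≈ -1*-1≈1 (*-positive 0<-1 0<-1)
    where
    0<-1 : 0# < - 1#
    0<-1 = <-respʳ-≈ (+-identityˡ _) (<-respˡ-≈ (-‿inverseʳ 1#) (+-monoˡ-< (- 1#) 1<0))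
    -1*-1≈1 : - 1# * - 1# ≈ 1#
    -1*-1≈1 = trans (sym (-‿distribˡ-* 1# (- 1#)))
      (trans (-‿cong (*-identityˡ _)) (-‿involutive 1#))

  <-asym : ∀ {x y} → x < y → ¬ (y < x)
  <-asym x<y y<x = <-irrefl refl (<-trans x<y y<x)

  +-positive : ∀ {x y} → 0# < x → 0# < y → 0# < x + y
  +-positive {x} {y} 0<x 0<y =
    <-trans 0<y (<-respˡ-≈ (+-identityˡ y) (+-monoˡ-< y 0<x))

  ι-positive : ∀ m → .{{NonZero m}} → 0# < ι m
  ι-positive (suc zero)    = <-respʳ-≈ (sym (+-identityʳ 1#)) 0<1
  ι-positive (suc (suc m)) = +-positive 0<1 (ι-positive (suc m))

  x-0≈x : ∀ x → x - 0# ≈ x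
  x-0≈x x = trans (+-congˡ -0#≈0#) (+-identityʳ x)

  √-positive : ∀ {x} → 0# < x → 0# < √ x
  √-positive {x} 0<x with #⇒invertible (#-sym (<⇒# 0<x))
  ... | x⁻¹ , _ , x*x⁻¹≈1 = from-# (invertible⇒# (√x⁻¹ , left , right))
    where
    √x⁻¹ : Carrier
    √x⁻¹ = √ x * x⁻¹
    right : (√ x - 0#) * √x⁻¹ ≈ 1#
    right = trans (*-congʳ (x-0≈x (√ x))) (trans (sym (*-assoc _ _ _))
      (trans (*-congʳ (trans (√-square (<-asym 0<x)) (sym (x-0≈x x)))) x*x⁻¹≈1))
    left : √x⁻¹ * (√ x - 0#) ≈ 1#
    left = trans (*-comm _ _) right
    from-# : √ x # 0# → 0# < √ x
    from-# √x#0 with #⇒<⊎> √x#0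
    ... | inj₁ √x<0 = contradiction √x<0 (√-nonnegative (<-asym 0<x))
    ... | inj₂ 0<√x = 0<√x

  ℝ⁺ : Set
  ℝ⁺ = ∃ λ x → 0# < x

  infixl 7 _*⁺_ _/_

  ι⁺ : (m : ℕ) → .{{NonZero m}} → ℝ⁺
  ι⁺ m = ι m , ι-positive m

  _*⁺_ : ℝ⁺ → ℝ⁺ → ℝ⁺
  (x , 0<x) *⁺ (y , 0<y) = x * y , *-positive 0<x 0<y

  √⁺ : ℝ⁺ → ℝ⁺
  √⁺ (x , 0<x) = √ x , √-positive 0<x

  _/_ : Carrier → ℝ⁺ → Carrier
  x / (y , 0<y) = x * proj₁ (#⇒invertible (#-sym (<⇒# 0<y)))

module ComplexNumbers (ℝ : RealNumbers) where
  private module R = RealNumbers ℝ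
  open R using (_≈_; _#_; _+_; _*_; -_; _-_; 0#; 1#)
  open RingProperties (CommutativeRing.ring R.commutativeRing) using (-0#≈0#; -1*x≈-x)
  open SemiringSolver (CommutativeRing.commutativeSemiring R.commutativeRing)
    using (solve; _:=_; _:+_; _:*_)

  infix  4 _≈ᶜ_ _#ᶜ_
  infixl 6 _+ᶜ_
  infixl 7 _*ᶜ_
  infix  8 -ᶜ_

  record ℂ : Set where
    constructor _+i_
    field
      re im : R.Carrier
  open ℂ public

  record _≈ᶜ_ (z w : ℂ) : Set where
    constructor _,_
    field
      re-≈ : re z ≈ re w
      im-≈ : im z ≈ im w

  _#ᶜ_ : Rel ℂ 0ℓ
  z #ᶜ w = re z # re w ⊎ im z # im w

  ofℝ : R.Carrier → ℂ
  ofℝ x = x +i 0#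

  _+ᶜ_ _*ᶜ_ : ℂ → ℂ → ℂ
  (a +i b) +ᶜ (c +i d) = (a + c) +i (b + d)
  (a +i b) *ᶜ (c +i d) = (a * c - b * d) +i (a * d + b * c)

  -ᶜ_ conj : ℂ → ℂ
  -ᶜ (a +i b) = (- a) +i (- b)
  conj (a +i b) = a +i (- b)

  commutativeRing : CommutativeRing 0ℓ 0ℓ
  commutativeRing = record
    { Carrier = ℂ ; _≈_ = _≈ᶜ_ ; _+_ = _+ᶜ_ ; _*_ = _*ᶜ_ ; -_ = -ᶜ_
    ; 0# = ofℝ 0# ; 1# = ofℝ 1#
    ; isCommutativeRing = record
      { isRing = record
        { +-isAbelianGroup = record
          { isGroup = record
            { isMonoid = record
              { isSemigroup = record
                { isMagma = record
                  { isEquivalence = record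
                    { refl  = R.refl , R.refl
                    ; sym   = λ (p , q) → R.sym p , R.sym q
                    ; trans = λ (p , q) (p′ , q′) → R.trans p p′ , R.trans q q′
                    }
                  ; ∙-cong = λ (p , q) (p′ , q′) → R.+-cong p p′ , R.+-cong q q′
                  }
                ; assoc = λ _ _ _ → R.+-assoc _ _ _ , R.+-assoc _ _ _
                }
              ; identity = (λ _ → R.+-identityˡ _ , R.+-identityˡ _)
                         , (λ _ → R.+-identityʳ _ , R.+-identityʳ _)
              }
            ; inverse = (λ _ → R.-‿inverseˡ _ , R.-‿inverseˡ _)
                      , (λ _ → R.-‿inverseʳ _ , R.-‿inverseʳ _)
            ; ⁻¹-cong = λ (p , q) → R.-‿cong p , R.-‿cong q
            }
          ; comm = λ _ _ → R.+-comm _ _ , R.+-comm _ _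
          }
        ; *-cong = *-cong
        ; *-assoc = *-assoc
        ; *-identity = *-identityˡ , λ z → ≈ᶜ-trans (*-comm z _) (*-identityˡ z)
        ; distrib = distribˡ , λ z w v →
            ≈ᶜ-trans (*-comm _ z) (≈ᶜ-trans (distribˡ z w v)
              (+-cong (*-comm z w) (*-comm z v)))
        }
      ; *-comm = *-comm
      }
    }
    where
    ≈ᶜ-trans : ∀ {z w v} → z ≈ᶜ w → w ≈ᶜ v → z ≈ᶜ v
    ≈ᶜ-trans (p , q) (p′ , q′) = R.trans p p′ , R.trans q q′

    +-cong : ∀ {z z′ w w′} → z ≈ᶜ z′ → w ≈ᶜ w′ → z +ᶜ w ≈ᶜ z′ +ᶜ w′
    +-cong (p , q) (p′ , q′) = R.+-cong p p′ , R.+-cong q q′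

    *-cong : ∀ {z z′ w w′} → z ≈ᶜ z′ → w ≈ᶜ w′ → z *ᶜ w ≈ᶜ z′ *ᶜ w′
    *-cong (p , q) (p′ , q′) =
        R.+-cong (R.*-cong p p′) (R.-‿cong (R.*-cong q q′))
      , R.+-cong (R.*-cong p q′) (R.*-cong q p′)

    -‿as-* : ∀ x → - x ≈ - 1# * x
    -‿as-* x = R.sym (-1*x≈-x x)

    *-assoc : ∀ z w v → (z *ᶜ w) *ᶜ v ≈ᶜ z *ᶜ (w *ᶜ v)
    *-assoc (a +i b) (c +i d) (e +i f) =
        R.trans (R.+-cong (R.*-congʳ (R.+-congˡ (-‿as-* _))) (-‿as-* _))
          (R.trans
            (solve 7 (λ a b c d e f m →
                (a :* c :+ m :* (b :* d)) :* e :+ m :* ((a :* d :+ b :* c) :* f)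
              := a :* (c :* e :+ m :* (d :* f)) :+ m :* (b :* (c :* f :+ d :* e)))
              R.refl a b c d e f (- 1#))
            (R.sym (R.+-cong (R.*-congˡ (R.+-congˡ (-‿as-* _))) (-‿as-* _))))
      , R.trans (R.+-congʳ (R.*-congʳ (R.+-congˡ (-‿as-* _))))
          (R.trans
            (solve 7 (λ a b c d e f m →
                (a :* c :+ m :* (b :* d)) :* f :+ (a :* d :+ b :* c) :* e
              := a :* (c :* f :+ d :* e) :+ b :* (c :* e :+ m :* (d :* f)))
              R.refl a b c d e f (- 1#))
            (R.sym (R.+-congˡ (R.*-congˡ (R.+-congˡ (-‿as-* _))))))

    *-comm : ∀ z w → z *ᶜ w ≈ᶜ w *ᶜ z
    *-comm (a +i b) (c +i d) =
        R.+-cong (R.*-comm a c) (R.-‿cong (R.*-comm b d))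
      , R.trans (R.+-comm _ _) (R.+-cong (R.*-comm b c) (R.*-comm a d))

    *-identityˡ : ∀ z → ofℝ 1# *ᶜ z ≈ᶜ z
    *-identityˡ (a +i b) =
        R.trans (R.+-cong (R.*-identityˡ a) (R.trans (R.-‿cong (R.zeroˡ b)) -0#≈0#))
          (R.+-identityʳ a)
      , R.trans (R.+-cong (R.*-identityˡ b) (R.zeroˡ a)) (R.+-identityʳ b)

    distribˡ : ∀ z w v → z *ᶜ (w +ᶜ v) ≈ᶜ z *ᶜ w +ᶜ z *ᶜ v
    distribˡ (a +i b) (c +i d) (e +i f) =
        R.trans (R.+-congˡ (-‿as-* _))
          (R.trans
            (solve 7 (λ a b c d e f m →
                a :* (c :+ e) :+ m :* (b :* (d :+ f))
              := (a :* c :+ m :* (b :* d)) :+ (a :* e :+ m :* (b :* f)))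
              R.refl a b c d e f (- 1#))
            (R.sym (R.+-cong (R.+-congˡ (-‿as-* _)) (R.+-congˡ (-‿as-* _)))))
      , solve 6 (λ a b c d e f →
            a :* (d :+ f) :+ b :* (c :+ e) := (a :* d :+ b :* c) :+ (a :* f :+ b :* e))
          R.refl a b c d e f

module Binomials where
  open import Data.Nat.Base using (_≤_)

  C-nonZero : ∀ {m k} → k ≤ m → NonZero (m C k)
  C-nonZero {m}     {zero}  z≤n       = _
  C-nonZero {suc m} {suc k} (s≤s k≤m) = ≡.subst NonZero (nCk+nC[k+1]≡[n+1]C[k+1] m k)
    (ℕ.>-nonZero (ℕ.<-≤-trans (ℕ.>-nonZero⁻¹ _ {{C-nonZero k≤m}}) (ℕ.m≤m+n _ _)))

  P-nonZero : ∀ {m k} → k ≤ m → NonZero (m P k)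
  P-nonZero {m} {k} k≤m = ≡.subst NonZero (≡.sym (nPk≡n!/[n∸k]! k≤m))
    (ℕ.>-nonZero (m≥n⇒m/n>0 {{(m ∸ k) ℕ.!≢0}} (!-mono-≤ (ℕ.m∸n≤m m k))))
    where
    !-mono-≤ : ∀ {i j} → i ≤ j → i ! ≤ j !
    !-mono-≤ {zero}  {j}     z≤n       = ℕ.>-nonZero⁻¹ _ {{j ℕ.!≢0}}
    !-mono-≤ {suc i} {suc j} (s≤s i≤j) = ℕ.*-mono-≤ (s≤s i≤j) (!-mono-≤ i≤j)

module Coefficients (ℝ : RealNumbers) (n : ℕ) where
  open RealNumbers ℝ using (Carrier; _*_; -_; 1#; ι; √; semiring; +-commutativeMonoid)
  open PositiveReals ℝ using (ι⁺; √⁺; _*⁺_; _/_)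
  open Binomials
  open Exp semiring using (_^_)
  open Sum +-commutativeMonoid using (sum⁺-syntax)

  N : ℕ → ℕ → ℕ
  N r₁ r₂ = r₁ ⊓ (n ∸ r₁) ⊓ r₂ ⊓ (n ∸ r₂)

  s≤r⊓[n∸r]⇒s≤n∸s : ∀ {r s} → s ℕ.≤ r ⊓ (n ∸ r) → s ℕ.≤ n ∸ s
  s≤r⊓[n∸r]⇒s≤n∸s {r} s≤ = ℕ.≤-trans (ℕ.m≤n⊓o⇒m≤o r (n ∸ r) s≤)
    (ℕ.∸-monoʳ-≤ n (ℕ.m≤n⊓o⇒m≤n r (n ∸ r) s≤))

  -- In P_m(k, M) only integer points 0 ≤ k ≤ M are needed, so M ∸ k is M - k.
  krawtchouk : ℕ → ℕ → ℕ → Carrier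
  krawtchouk m k M =
    ∑[ j ≤ m ] ((- 1#) ^ toℕ j * ι (k C toℕ j) * ι ((M ∸ k) C (m ∸ toℕ j)))

  module _ (r₁ r₂ : Fin (suc n)) (s : Fin (suc (N (toℕ r₁) (toℕ r₂)))) where
    private
      r₁′ r₂′ s′ : ℕ
      r₁′ = toℕ r₁
      r₂′ = toℕ r₂
      s′  = toℕ s

      s≤N : s′ ℕ.≤ N r₁′ r₂′
      s≤N = Fin.toℕ≤pred[n] s

      s≤r₁⊓[n∸r₁]⊓r₂ : s′ ℕ.≤ r₁′ ⊓ (n ∸ r₁′) ⊓ r₂′
      s≤r₁⊓[n∸r₁]⊓r₂ = ℕ.m≤n⊓o⇒m≤n _ (n ∸ r₂′) s≤N

      s≤r₁⊓[n∸r₁] : s′ ℕ.≤ r₁′ ⊓ (n ∸ r₁′)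
      s≤r₁⊓[n∸r₁] = ℕ.m≤n⊓o⇒m≤n _ r₂′ s≤r₁⊓[n∸r₁]⊓r₂

      s≤n∸r₁ : s′ ℕ.≤ n ∸ r₁′
      s≤n∸r₁ = ℕ.m≤n⊓o⇒m≤o r₁′ _ s≤r₁⊓[n∸r₁]

      s≤n∸r₂ : s′ ℕ.≤ n ∸ r₂′
      s≤n∸r₂ = ℕ.m≤n⊓o⇒m≤o _ (n ∸ r₂′) s≤N

      s≤n∸s+1 : s′ ℕ.≤ n ∸ s′ ℕ.+ 1
      s≤n∸s+1 = ℕ.≤-trans (s≤r⊓[n∸r]⇒s≤n∸s s≤r₁⊓[n∸r₁]) (ℕ.m≤m+n _ 1)

      r∸s≤n∸2s : ∀ (r : Fin (suc n)) → s′ ℕ.≤ n ∸ toℕ r → toℕ r ∸ s′ ℕ.≤ n ∸ 2 ℕ.* s′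
      r∸s≤n∸2s r s≤n∸r = ≡.subst (toℕ r ∸ s′ ℕ.≤_)
        (≡.trans (ℕ.∸-+-assoc n s′ s′)
          (≡.cong (λ i → n ∸ (s′ ℕ.+ i)) (≡.sym (ℕ.+-identityʳ s′))))
        (ℕ.∸-monoˡ-≤ s′ r≤n∸s)
        where
        r≤n∸s : toℕ r ℕ.≤ n ∸ s′
        r≤n∸s = ℕ.≤-trans (ℕ.≤-reflexive (≡.sym (ℕ.m∸[m∸n]≡n (Fin.toℕ≤pred[n] r))))
          (ℕ.∸-monoʳ-≤ n s≤n∸r)

      instance
        C₁-nonZero : NonZero ((n ∸ 2 ℕ.* s′) C (r₁′ ∸ s′))
        C₁-nonZero = C-nonZero (r∸s≤n∸2s r₁ s≤n∸r₁)

        C₂-nonZero : NonZero ((n ∸ 2 ℕ.* s′) C (r₂′ ∸ s′))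
        C₂-nonZero = C-nonZero (r∸s≤n∸2s r₂ s≤n∸r₂)

        P-denominator-nonZero : NonZero ((n ∸ s′ ℕ.+ 1) P s′)
        P-denominator-nonZero = P-nonZero s≤n∸s+1

        s!-nonZero : NonZero (s′ !)
        s!-nonZero = s′ ℕ.!≢0

    α : Carrier
    α = ι ((n ∸ r₁′) P s′) * ι (r₂′ P s′)
      / ( √⁺ (ι⁺ ((n ∸ 2 ℕ.* s′) C (r₁′ ∸ s′)) *⁺ ι⁺ ((n ∸ 2 ℕ.* s′) C (r₂′ ∸ s′)))
        *⁺ ι⁺ (s′ !) *⁺ ι⁺ ((n ∸ s′ ℕ.+ 1) P s′))

    k : Carrier
    k = (- ι 2) ^ s′
      * √ (ι ((n ∸ 2 ℕ.* s′) C (r₂′ ∸ s′)) / ι⁺ ((n ∸ 2 ℕ.* s′) C (r₁′ ∸ s′)))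
      * krawtchouk (r₁′ ∸ s′) (r₂′ ∸ s′) (n ∸ 2 ℕ.* s′)

-- Ω is Fin n, so X = 𝒫(Ω) is Subset n and S(Ω) is Permutation′ n.

module PowerSet (ℝ : RealNumbers) (n : ℕ) where
  open Coefficients ℝ n public using (N; s≤r⊓[n∸r]⇒s≤n∸s; α; k)
  open ComplexNumbers ℝ public
  open CommutativeRing commutativeRing hiding (zero)
  open RingProperties ring using (-1*x≈-x)
  open Exp semiring using (_^_)
  open Mult semiring using () renaming (_×_ to _·_)
  open Sum +-commutativeMonoid using (sum⁺-syntax)

  X : Set
  X = Subset n

  G : Set
  G = Permutation′ n

  infixr 8 _∙_
  _∙_ : G → X → X
  g ∙ x = tabulate (λ i → lookup x (g ⟨$⟩ˡ i))

  ∑⊆ : ∀ {m} → (Subset m → ℂ) → ℂ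
  ∑⊆ {zero}  f = f []
  ∑⊆ {suc m} f = ∑⊆ (f ∘ (outside ∷_)) + ∑⊆ (f ∘ (inside ∷_))

  ∑X : ℕ → (X → ℂ) → ℂ
  ∑X r f = ∑⊆ λ x → if does (∣ x ∣ ℕ.≟ r) then f x else 0#

  L² : Set
  L² = X → ℂ

  infix 4 _≋_
  _≋_ : Rel L² 0ℓ
  ψ ≋ φ = ∀ x → ψ x ≈ φ x

  L²-module : Module commutativeRing 0ℓ 0ℓ
  L²-module = record
    { Carrierᴹ = L² ; _≈ᴹ_ = _≋_
    ; isModule = IsModuleFromLeft.isModule {commutativeRing = commutativeRing} (record
      { isLeftModule = record
        { isLeftSemimodule = record
          { +ᴹ-isCommutativeMonoid = AbelianGroup.isCommutativeMonoid pointwise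
          ; isPreleftSemimodule = record
            { *ₗ-cong      = λ c≈d ψ≋φ x → *-cong c≈d (ψ≋φ x)
            ; *ₗ-zeroˡ     = λ ψ x → zeroˡ (ψ x)
            ; *ₗ-distribʳ  = λ ψ c d x → distribʳ (ψ x) c d
            ; *ₗ-identityˡ = λ ψ x → *-identityˡ (ψ x)
            ; *ₗ-assoc     = λ c d ψ x → *-assoc c d (ψ x)
            ; *ₗ-zeroʳ     = λ c x → zeroʳ c
            ; *ₗ-distribˡ  = λ c ψ φ x → distribˡ c (ψ x) (φ x)
            }
          }
        ; -ᴹ‿cong    = AbelianGroup.⁻¹-cong pointwise
        ; -ᴹ‿inverse = AbelianGroup.inverse pointwise
        }
      })
    }
    where
    pointwise : AbelianGroup 0ℓ 0ℓ
    pointwise = Pointwise.abelianGroup X +-abelianGroup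

    infixr 7 _•_
    _•_ : ℂ → L² → L²
    (c • ψ) x = c * ψ x

  open Module L²-module public using (_+ᴹ_; -ᴹ_; 0ᴹ; _*ₗ_; _*ᵣ_; rawModule; +ᴹ-commutativeMonoid)
  private module L²-module = Module L²-module

  ⟨_,_⟩ : L² → L² → ℂ
  ⟨ ψ , φ ⟩ = ∑⊆ λ x → ψ x * conj (φ x)

  ρ : G → L² → L²
  ρ g ψ x = ψ (flip g ∙ x)

  record InEndG (T : L² → L²) : Set where
    field
      isModuleHomomorphism : IsModuleHomomorphism rawModule rawModule T
      equivariant          : ∀ g ψ → T (ρ g ψ) ≋ ρ g (T ψ)

  record GSubspace : Set₁ where
    infix 4 _∈
    field
      _∈     : L² → Set
      ∈-resp : ∀ {ψ φ} → ψ ≋ φ → ψ ∈ → φ ∈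
      0ᴹ∈    : 0ᴹ ∈
      +ᴹ∈    : ∀ {ψ φ} → ψ ∈ → φ ∈ → ψ +ᴹ φ ∈
      *ₗ∈    : ∀ c {ψ} → ψ ∈ → c *ₗ ψ ∈
      ρ∈     : ∀ g {ψ} → ψ ∈ → ρ g ψ ∈

    Carrier∈ : Set
    Carrier∈ = ∃ _∈

    ρ∣ : G → Carrier∈ → Carrier∈
    ρ∣ g (ψ , ψ∈) = ρ g ψ , ρ∈ g ψ∈

    asModule : Module commutativeRing 0ℓ 0ℓ
    asModule = record
      { Carrierᴹ = Carrier∈ ; _≈ᴹ_ = _≋∣_ ; _+ᴹ_ = _+∣_ ; _*ₗ_ = _*∣_ ; 0ᴹ = 0∣ ; -ᴹ_ = -∣_
      ; isModule = IsModuleFromLeft.isModule {commutativeRing = commutativeRing} (record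
        { isLeftModule = record
          { isLeftSemimodule = record
            { +ᴹ-isCommutativeMonoid = record
              { isMonoid = record
                { isSemigroup = record
                  { isMagma = record
                    { isEquivalence = record
                      { refl  = λ {(ψ , _)} → L²-module.≈ᴹ-refl {ψ}
                      ; sym   = λ {(ψ , _)} {(φ , _)} → L²-module.≈ᴹ-sym {ψ} {φ}
                      ; trans = λ {(ψ , _)} {(φ , _)} {(χ , _)} → L²-module.≈ᴹ-trans {ψ} {φ} {χ}
                      }
                    ; ∙-cong = λ ψ≋ψ′ φ≋φ′ x → +-cong (ψ≋ψ′ x) (φ≋φ′ x)
                    }
                  ; assoc = λ (ψ , _) (φ , _) (χ , _) → L²-module.+ᴹ-assoc ψ φ χ
                  }
                ; identity = (λ (ψ , _) → L²-module.+ᴹ-identityˡ ψ)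
                           , (λ (ψ , _) → L²-module.+ᴹ-identityʳ ψ)
                }
              ; comm = λ (ψ , _) (φ , _) → L²-module.+ᴹ-comm ψ φ
              }
            ; isPreleftSemimodule = record
              { *ₗ-cong      = λ c≈d ψ≋φ x → *-cong c≈d (ψ≋φ x)
              ; *ₗ-zeroˡ     = λ (ψ , _) → L²-module.*ₗ-zeroˡ ψ
              ; *ₗ-distribʳ  = λ (ψ , _) → L²-module.*ₗ-distribʳ ψ
              ; *ₗ-identityˡ = λ (ψ , _) → L²-module.*ₗ-identityˡ ψ
              ; *ₗ-assoc     = λ c d (ψ , _) → L²-module.*ₗ-assoc c d ψ
              ; *ₗ-zeroʳ     = L²-module.*ₗ-zeroʳ
              ; *ₗ-distribˡ  = λ c (ψ , _) (φ , _) → L²-module.*ₗ-distribˡ c ψ φ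
              }
            }
          ; -ᴹ‿cong    = λ ψ≋φ x → -‿cong (ψ≋φ x)
          ; -ᴹ‿inverse = (λ (ψ , _) → L²-module.-ᴹ‿inverseˡ ψ) , (λ (ψ , _) → L²-module.-ᴹ‿inverseʳ ψ)
          }
        })
      }
      where
      _≋∣_ : Rel Carrier∈ 0ℓ
      (ψ , _) ≋∣ (φ , _) = ψ ≋ φ

      _+∣_ : Carrier∈ → Carrier∈ → Carrier∈
      (ψ , ψ∈) +∣ (φ , φ∈) = ψ +ᴹ φ , +ᴹ∈ ψ∈ φ∈

      0∣ : Carrier∈
      0∣ = 0ᴹ , 0ᴹ∈

      -∣_ : Carrier∈ → Carrier∈
      -∣ (ψ , ψ∈) = -ᴹ ψ , ∈-resp (λ x → -1*x≈-x (ψ x)) (*ₗ∈ (- 1#) ψ∈)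

      _*∣_ : ℂ → Carrier∈ → Carrier∈
      c *∣ (ψ , ψ∈) = c *ₗ ψ , *ₗ∈ c ψ∈

  open GSubspace using (asModule; ρ∣)

  infix 4 _∈_ _⊆_ _⊆L²X_
  _∈_ : L² → GSubspace → Set
  ψ ∈ V = GSubspace._∈ V ψ

  _⊆_ : GSubspace → GSubspace → Set
  V ⊆ W = ∀ {ψ} → ψ ∈ V → ψ ∈ W

  SupportedOnX : ℕ → L² → Set
  SupportedOnX r ψ = ∀ x → ∣ x ∣ ≢ r → ψ x ≈ 0#

  _⊆L²X_ : GSubspace → ℕ → Set
  V ⊆L²X r = ∀ {ψ} → ψ ∈ V → SupportedOnX r ψ

  record _≅ᴳ_ (V W : GSubspace) : Set where
    private
      module V = Module (asModule V)
      module W = Module (asModule W)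
    field
      to                  : V.Carrierᴹ → W.Carrierᴹ
      isModuleIsomorphism : IsModuleIsomorphism V.rawModule W.rawModule to
      equivariant         : ∀ g v → to (ρ∣ V g v) W.≈ᴹ ρ∣ W g (to v)

  NonZeroᴳ : GSubspace → Set
  NonZeroᴳ V = ∃ λ ψ → ψ ∈ V × ∃ λ x → ψ x #ᶜ 0#

  record IsIrreducible (V : GSubspace) : Set₁ where
    field
      nonZero : NonZeroᴳ V
      minimal : ∀ W → W ⊆ V → NonZeroᴳ W → V ⊆ W

  image : ∀ {m} → (Fin m → Fin n) → X
  image f = tabulate λ i → does (Fin.any? λ j → f j Fin.≟ i)

  δ : X → L²
  δ y x = if does (≡-dec Bool._≟_ y x) then 1# else 0#

  -- A tableau of shape (n ∸ s , s) fills the first row, of length n ∸ s, and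
  -- the second row, of length s.  Its tabloid amounts to the set of entries of
  -- the second row, so the permutation module on tabloids is L²(Xₛ).

  Tableau : ℕ → Set
  Tableau s = (Fin (n ∸ s) ⊎ Fin s) ↔ Fin n

  module _ {s} (s≤n∸s : s ℕ.≤ n ∸ s) where

    -- The second row once the two entries of each column in J are exchanged.
    swappedRow : Tableau s → Subset s → Fin s → Fin n
    swappedRow t J j = Inverse.to t
      (if lookup J j then inj₁ (inject≤ j s≤n∸s) else inj₂ j)

    -- The column stabiliser consists of the exchanges along all J, and the one
    -- along J has sign (-1)^∣J∣.
    polytabloid : Tableau s → L²
    polytabloid t x = ∑⊆ λ J → (- 1#) ^ ∣ J ∣ * δ (image (swappedRow t J)) x

    data InSpecht : L² → Set where
      generator : ∀ t → InSpecht (polytabloid t)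
      null      : InSpecht 0ᴹ
      plus      : ∀ {ψ φ} → InSpecht ψ → InSpecht φ → InSpecht (ψ +ᴹ φ)
      scale     : ∀ c {ψ} → InSpecht ψ → InSpecht (c *ₗ ψ)
      resp      : ∀ {ψ φ} → ψ ≋ φ → InSpecht ψ → InSpecht φ

    private
      ∑⊆-cong : ∀ {m} {f g : Subset m → ℂ} → (∀ J → f J ≈ g J) → ∑⊆ f ≈ ∑⊆ g
      ∑⊆-cong {zero}  f≈g = f≈g []
      ∑⊆-cong {suc m} f≈g = +-cong (∑⊆-cong (f≈g ∘ (outside ∷_))) (∑⊆-cong (f≈g ∘ (inside ∷_)))

      flip-∙ : ∀ g x → flip g ∙ (g ∙ x) ≡ x
      flip-∙ g x = ≡.trans
        (tabulate-cong λ i → ≡.trans (lookup∘tabulate _ (g ⟨$⟩ʳ i))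
          (≡.cong (lookup x) (Perm.inverseˡ g)))
        (tabulate∘lookup x)

      ∙-flip : ∀ g x → g ∙ (flip g ∙ x) ≡ x
      ∙-flip g x = flip-∙ (flip g) x

      image-∙ : ∀ {m} g (f : Fin m → Fin n) → g ∙ image f ≡ image ((g ⟨$⟩ʳ_) ∘ f)
      image-∙ g f = tabulate-cong λ i → ≡.trans (lookup∘tabulate _ (g ⟨$⟩ˡ i))
        (does-⇔ (mk⇔
          (λ (j , fj≡) → j , ≡.trans (≡.cong (g ⟨$⟩ʳ_) fj≡) (Perm.inverseʳ g))
          (λ (j , gfj≡) → j , ≡.trans (≡.sym (Perm.inverseˡ g)) (≡.cong (g ⟨$⟩ˡ_) gfj≡)))
          (Fin.any? λ j → f j Fin.≟ g ⟨$⟩ˡ i) (Fin.any? λ j → g ⟨$⟩ʳ f j Fin.≟ i))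

      δ-∙ : ∀ g y x → δ y (flip g ∙ x) ≡ δ (g ∙ y) x
      δ-∙ g y x = ≡.cong (λ b → if b then 1# else 0#)
        (does-⇔ (mk⇔
          (λ y≡ → ≡.trans (≡.cong (g ∙_) y≡) (∙-flip g x))
          (λ gy≡ → ≡.trans (≡.sym (flip-∙ g y)) (≡.cong (flip g ∙_) gy≡)))
          (≡-dec Bool._≟_ _ _) (≡-dec Bool._≟_ _ _))

      ρ-polytabloid : ∀ g t → polytabloid (g ↔-∘ t) ≋ ρ g (polytabloid t)
      ρ-polytabloid g t x = ∑⊆-cong λ J → *-congˡ (reflexive (≡.sym (≡.trans
        (δ-∙ g (image (swappedRow t J)) x)
        (≡.cong (λ y → δ y x) (image-∙ g (swappedRow t J))))))

      InSpecht-ρ : ∀ g {ψ} → InSpecht ψ → InSpecht (ρ g ψ)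
      InSpecht-ρ g (generator t) = resp (ρ-polytabloid g t) (generator (g ↔-∘ t))
      InSpecht-ρ g null          = null
      InSpecht-ρ g (plus p q)    = plus (InSpecht-ρ g p) (InSpecht-ρ g q)
      InSpecht-ρ g (scale c p)   = scale c (InSpecht-ρ g p)
      InSpecht-ρ g (resp ψ≋φ p)  = resp (λ x → ψ≋φ (flip g ∙ x)) (InSpecht-ρ g p)

    Specht : GSubspace
    Specht = record
      { _∈ = InSpecht ; ∈-resp = resp ; 0ᴹ∈ = null ; +ᴹ∈ = plus ; *ₗ∈ = scale ; ρ∈ = InSpecht-ρ }

  record IsComponent (r s : ℕ) (s≤ : s ℕ.≤ r ⊓ (n ∸ r)) (V : GSubspace) : Set₁ where
    field
      ⊆L²X          : V ⊆L²X r
      isIrreducible : IsIrreducible V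
      ≅Specht       : V ≅ᴳ Specht (s≤r⊓[n∸r]⇒s≤n∸s s≤)

  evaluate : ∀ {d} → Vector ℂ (suc d) → ℂ → ℂ
  evaluate {d} c t = ∑[ i ≤ d ] (c i * t ^ toℕ i)

  -- V₁ and V₂ stand for L²(X_{r₁})ₛ and L²(X_{r₂})ₛ.  The kernel formula gives
  -- the values of Λ ψ on X_{r₂}; elsewhere Λ ψ is zero, since it lies in V₂.

  record IsΛ (r₁ r₂ s : ℕ) (V₁ V₂ : GSubspace) (Λ : L² → L²) : Set where
    field
      inEndG     : InEndG Λ
      maps       : ∀ {ψ} → ψ ∈ V₁ → Λ ψ ∈ V₂
      vanishes   : ∀ ψ → (∀ {φ} → φ ∈ V₁ → ⟨ ψ , φ ⟩ ≈ 0#) → Λ ψ ≋ 0ᴹ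

      kernel     : ℕ → ℂ
      supported  : ∀ ψ → SupportedOnX r₂ (Λ ψ)
      kernel-sum : ∀ ψ x₂ → ∣ x₂ ∣ ≡ r₂ →
                   Λ ψ x₂ ≈ ∑X r₁ (λ x₁ → kernel ∣ x₂ ─ x₁ ∣ * ψ x₁)

      polynomial : Vector ℂ (suc s)
      degree     : polynomial (fromℕ s) #ᶜ 0#
      agrees     : ∀ k → r₂ ∸ r₁ ℕ.≤ k → k ℕ.≤ (n ∸ r₁) ⊓ r₂ →
                   kernel k ≈ evaluate polynomial (k · 1#)
      normalised : evaluate polynomial 0# ≈ 1#

  𝓕 : L² → L²
  𝓕 ψ x = ∑⊆ λ x′ → (- 1#) ^ ∣ x ∩ x′ ∣ * ψ x′

  ∑ᴹ : ∀ m → Vector L² (suc m) → L²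
  ∑ᴹ m = sumᴹ
    where open Sum +ᴹ-commutativeMonoid using () renaming (sum to sumᴹ)

  infixr 5 ∑ᴹ
  syntax ∑ᴹ m (λ i → ψ) = ∑ᴹ[ i ≤ m ] ψ

{-# OPTIONS --safe #-}
module Submission where

-- The kernel of Λₛ on X_{r₁} × X_{r₂} is a polynomial of degree s in
-- k = ∣x₂ ─ x₁∣.  Every Specht generator of V r₁ s is antisymmetric under s
-- disjoint transpositions, hence orthogonal to all functions depending on
-- fewer than s points, and so Λₛ kills these functions.  Exchanging points in
-- and out of x₂ turns this into E j = 0 for j < s, where the functional E j
-- evaluates a kernel on a product of j differences; E j = 0 for j > s by
-- degree.  The same vanishing and the normalisation at 0 determine the s-th
-- difference of the kernel, that is, E s.  Finally the functionals E j with
-- j ≤ N(r₁, r₂) separate functions of k, and E j of (-1)^∣x₁ ∩ x₂∣ is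
-- (-2)^j P_{r₁-j}(r₂-j, n-2j).

open import Defs
open Binomials using (C-nonZero; P-nonZero)
open import Algebra.Bundles using (CommutativeRing)
open import Algebra.Module.Bundles using (Module)
open import Algebra.Module.Morphism.Structures using (IsModuleIsomorphism)
import Algebra.Properties.CommutativeMonoid.Sum as MonoidSum
import Algebra.Properties.Ring as RingProperties
import Algebra.Properties.Semiring.Exp as Exp
import Algebra.Properties.Semiring.Mult as Mult
import Algebra.Properties.Semiring.Sum as Sum
import Algebra.Solver.Ring.NaturalCoefficients.Default as SemiringSolver
open import Data.Bool.Base using (not; _∧_; if_then_else_)
import Data.Bool.Properties as Bool
open import Data.Fin.Base using (Fin; toℕ; zero; suc; fromℕ<; inject≤)
open import Data.Fin.Permutation using (_⟨$⟩ʳ_; _⟨$⟩ˡ_; flip; transpose)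
import Data.Fin.Permutation as Perm
import Data.Fin.Properties as Fin
open import Data.Fin.Subset using (Subset; inside; outside; ∣_∣; _∩_; _─_; ∁)
open import Data.Fin.Subset.Properties using (∣∁p∣≡n∸∣p∣; ∣p∣≤n)
open import Data.Nat.Base as ℕ using (ℕ; zero; suc; _≤_; _∸_; _⊓_; _!; NonZero; z≤n; s≤s)
open import Data.Nat.Combinatorics
  using (_C_; _P_; nPk≡n!/[n∸k]!; nCk≡n!/k![n-k]!; k![n∸k]!∣n!; k>n⇒nCk≡0; nCk+nC[k+1]≡[n+1]C[k+1])
open import Data.Nat.Divisibility using (m≤n⇒m!∣n!)
open import Data.Nat.DivMod using (m/n*n≡m)
import Data.Nat.Properties as ℕ
import Data.Nat.Solver
open import Data.Product.Base using (∃; ∃₂; _×_; _,_; proj₁; proj₂)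
open import Data.Sum.Base using (_⊎_; inj₁; inj₂)
open import Data.Sum.Properties using (inj₁-injective; inj₂-injective)
open import Data.Vec.Base using ([]; _∷_; lookup; _[_]%=_)
open import Data.Vec.Functional using (Vector)
open import Data.Vec.Properties
  using (≡-dec; lookup∘tabulate; tabulate∘lookup; tabulate-cong; lookup-zipWith;
         lookup∘updateAt; lookup∘updateAt′; updateAt-updateAt; updateAt-id-local)
open import Function.Base using (_∘_)
open import Function.Bundles using (Inverse; mk⇔)
open import Level using (0ℓ)
open import Relation.Binary.Definitions using (tri<; tri≈; tri>)
open import Relation.Binary.PropositionalEquality as ≡ using (_≡_; _≢_)
import Relation.Binary.Reasoning.Setoid as SetoidReasoning
open import Relation.Nullary.Decidable using (Dec; yes; no; does; does-⇔; dec-true; dec-false; _⊎-dec_)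
open import Relation.Nullary.Negation using (¬_; contradiction)

-- The functionals `E j` are dual to the kernels: `E j` of the kernel of Λₛ is zero unless `j = s`.
-- The coefficient of Λₛ is therefore `E s` of the Fourier kernel divided by `E s` of the kernel of
-- Λₛ. The numerator supplies (-2)^s and the Krawtchouk value. The denominator is C(n-2s, r₁-s)
-- times the s-th difference, which equals s! [n-s+1]_s / ([n-r₁]_s [r₂]_s). This quotient is the
-- origin of `α`; the square roots in `k` and `α` cancel in their product. The obstacle is to reach
-- the s-th difference from the value at 0, a point that lies outside the range of k when r₁ < r₂.
-- Newton's formula at 0, applied to the vanishing conditions with points outside x₂, turns them
-- into orthogonality to all polynomials of degree < s on s + 1 points. This fixes the suitably
-- weighted differences of orders 0 to s up to one scalar; the first of them carries the value at 0
-- and the last the s-th difference.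

module ℕSolver = Data.Nat.Solver.+-*-Solver

-- Factorial identities

module Factorials where
  open import Data.Nat.Base using (_+_; _*_; _≤_)
  open import Data.Nat.Properties using (_!≢0; _!*_!≢0; *-assoc; *-cancelʳ-≡; m+n∸m≡n; m≤m+n; m∸n≤m)
  open ≡ using (refl; sym; trans; cong; module ≡-Reasoning)

  nPk*[n∸k]!≡n! : ∀ {n k} → k ≤ n → (n P k) * (n ∸ k) ! ≡ n !
  nPk*[n∸k]!≡n! {n} {k} k≤n = trans (cong (_* (n ∸ k) !) (nPk≡n!/[n∸k]! k≤n))
    (m/n*n≡m {{(n ∸ k) !≢0}} (m≤n⇒m!∣n! (m∸n≤m n k)))

  nCk*[k!*[n∸k]!]≡n! : ∀ {n k} → k ≤ n → (n C k) * (k ! * (n ∸ k) !) ≡ n !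
  nCk*[k!*[n∸k]!]≡n! {n} {k} k≤n = trans (cong (_* (k ! * (n ∸ k) !)) (nCk≡n!/k![n-k]! k≤n))
    (m/n*n≡m {{k !* (n ∸ k) !≢0}} (k![n∸k]!∣n! k≤n))

  nCk*k!≡nPk : ∀ {n k} → k ≤ n → (n C k) * k ! ≡ n P k
  nCk*k!≡nPk {n} {k} k≤n = *-cancelʳ-≡ _ _ ((n ∸ k) !) {{(n ∸ k) !≢0}}
    (trans (*-assoc (n C k) (k !) ((n ∸ k) !))
      (trans (nCk*[k!*[n∸k]!]≡n! k≤n) (sym (nPk*[n∸k]!≡n! k≤n))))

  [m+n]Cm*m!*n!≡[m+n]! : ∀ m n → ((m + n) C m) * (m ! * n !) ≡ (m + n) !
  [m+n]Cm*m!*n!≡[m+n]! m n = trans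
    (cong (λ k → ((m + n) C m) * (m ! * k !)) (sym (m+n∸m≡n m n)))
    (nCk*[k!*[n∸k]!]≡n! (m≤m+n m n))

  -- Both C(d + x, d) d! x! and C(a + u, a) a! u! are (a + u)!.
  rescaling : ∀ m u {a d x} c → d + x ≡ a + u →
    d ! * (((d + x) C d) * (c * (((m + u) P m) * x !))) ≡
    (a ! * (m + u) !) * (c * ((a + u) C a))
  rescaling m u {a} {d} {x} c eq = begin
    d ! * (((d + x) C d) * (c * (((m + u) P m) * x !)))
      ≡⟨ solve 5 (λ d b c p x → d :* (b :* (c :* (p :* x))) := (b :* (d :* x)) :* (c :* p)) refl (d !) ((d + x) C d) c ((m + u) P m) (x !) ⟩
    (((d + x) C d) * (d ! * x !)) * (c * ((m + u) P m))
      ≡⟨ cong (_* (c * ((m + u) P m))) (trans ([m+n]Cm*m!*n!≡[m+n]! d x) (trans (cong _! eq) (sym ([m+n]Cm*m!*n!≡[m+n]! a u)))) ⟩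
    (((a + u) C a) * (a ! * u !)) * (c * ((m + u) P m))
      ≡⟨ solve 5 (λ b a u c p → (b :* (a :* u)) :* (c :* p) := (a :* (p :* u)) :* (c :* b)) refl ((a + u) C a) (a !) (u !) c ((m + u) P m) ⟩
    (a ! * (((m + u) P m) * u !)) * (c * ((a + u) C a))
      ≡⟨ cong (λ t → (a ! * t) * (c * ((a + u) C a))) (trans (cong (λ t → ((m + u) P m) * t !) (sym (m+n∸m≡n m u))) (nPk*[n∸k]!≡n! (m≤m+n m u))) ⟩
    (a ! * (m + u) !) * (c * ((a + u) C a)) ∎
    where open ≡-Reasoning
          open ℕSolver

-- Differences of kernels and their sums over subsets

module KernelSums (R : CommutativeRing 0ℓ 0ℓ) where
  open Factorials
  open CommutativeRing R hiding (zero)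
  open RingProperties ring
  open Mult semiring renaming (_×_ to _·_)
  open Exp semiring using (_^_)
  open Sum semiring
  open SemiringSolver commutativeSemiring using (solve; _:=_; _:+_; _:*_)
  open SetoidReasoning setoid

  infix 4 _≗_
  _≗_ : (ℕ → Carrier) → (ℕ → Carrier) → Set
  h ≗ h′ = ∀ k → h k ≈ h′ k

  ∇ : (ℕ → Carrier) → ℕ → Carrier
  ∇ h k = h k - h (suc k)

  ∇^ : ℕ → (ℕ → Carrier) → ℕ → Carrier
  ∇^ zero    h = h
  ∇^ (suc j) h = ∇^ j (∇ h)

  ∇-cong : ∀ {h h′} → h ≗ h′ → ∇ h ≗ ∇ h′
  ∇-cong h≗h′ k = +-cong (h≗h′ k) (-‿cong (h≗h′ (suc k)))

  ∇^-cong : ∀ j {h h′} → h ≗ h′ → ∇^ j h ≗ ∇^ j h′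
  ∇^-cong zero    h≗h′ = h≗h′
  ∇^-cong (suc j) h≗h′ = ∇^-cong j (∇-cong h≗h′)

  h≗h∘suc+∇h : ∀ h → h ≗ λ k → h (suc k) + ∇ h k
  h≗h∘suc+∇h h k = sym (begin
    h (suc k) + (h k - h (suc k))   ≈⟨ +-congˡ (+-comm _ _) ⟩
    h (suc k) + (- h (suc k) + h k) ≈⟨ +-assoc _ _ _ ⟨
    (h (suc k) - h (suc k)) + h k   ≈⟨ +-congʳ (-‿inverseʳ _) ⟩
    0# + h k                        ≈⟨ +-identityˡ _ ⟩
    h k                             ∎)

  ∇-+ : ∀ h h′ → ∇ (λ k → h k + h′ k) ≗ λ k → ∇ h k + ∇ h′ k
  ∇-+ h h′ k = begin
    (h k + h′ k) - (h (suc k) + h′ (suc k))     ≈⟨ +-congˡ (-‿+-comm _ _) ⟨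
    (h k + h′ k) + (- h (suc k) - h′ (suc k))
      ≈⟨ solve 4 (λ a b c d → (a :+ b) :+ (c :+ d) := (a :+ c) :+ (b :+ d)) refl _ _ _ _ ⟩
    ∇ h k + ∇ h′ k                              ∎

  ∇-* : ∀ c h → ∇ (λ k → c * h k) ≗ λ k → c * ∇ h k
  ∇-* c h k = begin
    c * h k - c * h (suc k)      ≈⟨ +-congˡ (-‿distribʳ-* _ _) ⟩
    c * h k + c * - h (suc k)    ≈⟨ distribˡ _ _ _ ⟨
    c * ∇ h k                    ∎

  ∇^-+ : ∀ j h h′ → ∇^ j (λ k → h k + h′ k) ≗ λ k → ∇^ j h k + ∇^ j h′ k
  ∇^-+ zero    h h′ k = refl
  ∇^-+ (suc j) h h′ k = trans (∇^-cong j (∇-+ h h′) k) (∇^-+ j (∇ h) (∇ h′) k)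

  ∇^-* : ∀ j c h → ∇^ j (λ k → c * h k) ≗ λ k → c * ∇^ j h k
  ∇^-* zero    c h k = refl
  ∇^-* (suc j) c h k = trans (∇^-cong j (∇-* c h) k) (∇^-* j c (∇ h) k)

  -- M p q a h is the sum of h ∣ x ─ y ∣ over the a-subsets y of a
  -- (p + q)-set, x being a fixed p-subset.
  M : ℕ → ℕ → ℕ → (ℕ → Carrier) → Carrier
  M zero    q a       h = (q C a) · h 0
  M (suc p) q zero    h = M p q zero (h ∘ suc)
  M (suc p) q (suc a) h = M p q a h + M p q (suc a) (h ∘ suc)

  -- The table entries i, k, l, m are the sizes of x ∩ y, x ─ y, y ─ x and of
  -- the complement of x ∪ y.
  M-cong-on : ∀ p q a {h h′} →
    (∀ i k l m → i ℕ.+ k ≡ p → l ℕ.+ m ≡ q → i ℕ.+ l ≡ a → h k ≈ h′ k) →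
    M p q a h ≈ M p q a h′
  M-cong-on zero q a {h} {h′} h≈h′ with a ℕ.≤? q
  ... | yes a≤q = ×-congʳ (q C a) (h≈h′ 0 0 a (q ∸ a) ≡.refl (ℕ.m+[n∸m]≡n a≤q) ≡.refl)
  ... | no  a≰q rewrite k>n⇒nCk≡0 (ℕ.≰⇒> a≰q) = refl
  M-cong-on (suc p) q zero h≈h′ = M-cong-on p q zero λ
    { zero k l m ≡.refl → h≈h′ 0 (suc k) l m ≡.refl
    ; (suc i) k l m ≡.refl _ () }
  M-cong-on (suc p) q (suc a) h≈h′ = +-cong
    (M-cong-on p q a λ i k l m ik lm il →
      h≈h′ (suc i) k l m (≡.cong suc ik) lm (≡.cong suc il))
    (M-cong-on p q (suc a) λ i k l m ik →
      h≈h′ i (suc k) l m (≡.trans (ℕ.+-suc i k) (≡.cong suc ik)))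

  M-cong : ∀ p q a {h h′} → h ≗ h′ → M p q a h ≈ M p q a h′
  M-cong p q a h≗h′ = M-cong-on p q a λ _ k _ _ _ _ _ → h≗h′ k

  ·-distrib-+ : ∀ m x y → m · (x + y) ≈ m · x + m · y
  ·-distrib-+ zero    x y = sym (+-identityˡ _)
  ·-distrib-+ (suc m) x y = trans (+-congˡ (·-distrib-+ m x y))
    (solve 4 (λ a b c d → (a :+ b) :+ (c :+ d) := (a :+ c) :+ (b :+ d)) refl _ _ _ _)

  M-+ : ∀ p q a h h′ → M p q a (λ k → h k + h′ k) ≈ M p q a h + M p q a h′
  M-+ zero    q a       h h′ = ·-distrib-+ (q C a) _ _
  M-+ (suc p) q zero    h h′ = M-+ p q zero _ _
  M-+ (suc p) q (suc a) h h′ = trans (+-cong (M-+ p q a _ _) (M-+ p q (suc a) _ _))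
    (solve 4 (λ a b c d → (a :+ b) :+ (c :+ d) := (a :+ c) :+ (b :+ d)) refl _ _ _ _)

  M-* : ∀ p q a c h → M p q a (λ k → c * h k) ≈ c * M p q a h
  M-* zero    q a       c h = sym (×-comm-* (q C a) _ _)
  M-* (suc p) q zero    c h = M-* p q zero c _
  M-* (suc p) q (suc a) c h = trans (+-cong (M-* p q a c _) (M-* p q (suc a) c _)) (sym (distribˡ _ _ _))

  M-sucʳ-zero : ∀ p q h → M p (suc q) zero h ≈ M p q zero h
  M-sucʳ-zero zero    q h = refl
  M-sucʳ-zero (suc p) q h = M-sucʳ-zero p q _

  pascal-· : ∀ m k x → (suc m C suc k) · x ≈ (m C k) · x + (m C suc k) · x
  pascal-· m k x = trans (×-congˡ (≡.sym (nCk+nC[k+1]≡[n+1]C[k+1] m k))) (×-homo-+ x (m C k) (m C suc k))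

  -- The defining recursion of `M` strips points of `x`. Here one of the points outside `x` is
  -- stripped, by cases on whether `y` contains it.
  M-sucʳ-suc : ∀ p q a h → M p (suc q) (suc a) h ≈ M p q a h + M p q (suc a) h
  M-sucʳ-suc zero    q a h = pascal-· q a (h 0)
  M-sucʳ-suc (suc p) q zero h = begin
    M p (suc q) zero h + M p (suc q) 1 (h ∘ suc)
      ≈⟨ +-cong (M-sucʳ-zero p q h) (M-sucʳ-suc p q zero _) ⟩
    M p q zero h + (M p q zero (h ∘ suc) + M p q 1 (h ∘ suc))
      ≈⟨ solve 3 (λ a b c → a :+ (b :+ c) := b :+ (a :+ c)) refl _ _ _ ⟩
    M p q zero (h ∘ suc) + (M p q zero h + M p q 1 (h ∘ suc))  ∎
  M-sucʳ-suc (suc p) q (suc a) h = begin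
    M p (suc q) (suc a) h + M p (suc q) (suc (suc a)) (h ∘ suc)
      ≈⟨ +-cong (M-sucʳ-suc p q a h) (M-sucʳ-suc p q (suc a) _) ⟩
    (M p q a h + M p q (suc a) h) + (M p q (suc a) (h ∘ suc) + M p q (suc (suc a)) (h ∘ suc))
      ≈⟨ solve 4 (λ a b c d → (a :+ b) :+ (c :+ d) := (a :+ c) :+ (b :+ d)) refl _ _ _ _ ⟩
    M (suc p) q (suc a) h + M (suc p) q (suc (suc a)) h ∎

  M-∇ : ∀ p q a h → M p q a h ≈ M p q a (h ∘ suc) + M p q a (∇ h)
  M-∇ p q a h = trans (M-cong p q a (h≗h∘suc+∇h h)) (M-+ p q a _ _)

  -- The sets x on the two sides differ in one point, and only the y avoiding
  -- that point distinguish them.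
  M-exchange : ∀ p q a h → M p (suc q) a h ≈ M (suc p) q a h + M p q a (∇ h)
  M-exchange p q zero    h = trans (M-sucʳ-zero p q h) (M-∇ p q zero h)
  M-exchange p q (suc a) h = begin
    M p (suc q) (suc a) h                                           ≈⟨ M-sucʳ-suc p q a h ⟩
    M p q a h + M p q (suc a) h                                     ≈⟨ +-congˡ (M-∇ p q (suc a) h) ⟩
    M p q a h + (M p q (suc a) (h ∘ suc) + M p q (suc a) (∇ h))     ≈⟨ +-assoc _ _ _ ⟨
    M (suc p) q (suc a) h + M p q (suc a) (∇ h)                     ∎

  M-const : ∀ p q a c → M p q a (λ _ → c) ≈ ((p ℕ.+ q) C a) · c
  M-const zero    q a       c = refl
  M-const (suc p) q zero    c = M-const p q zero c
  M-const (suc p) q (suc a) c = trans (+-cong (M-const p q a c) (M-const p q (suc a) c)) (sym (pascal-· (p ℕ.+ q) a c))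

  -- E j applies the kernel h to the product of j differences [b ∈ y] - [a ∈ y]
  -- with disjoint pairs b ∈ x and a ∉ x.
  E : ℕ → ℕ → ℕ → ℕ → (ℕ → Carrier) → Carrier
  E j p q a h = M (p ∸ j) (q ∸ j) (a ∸ j) (∇^ j h)

  -- The kernel h kills the indicators of the y containing i given points of x
  -- and l given points outside x.
  VanishesBelow : ℕ → ℕ → ℕ → ℕ → (ℕ → Carrier) → Set
  VanishesBelow s p q a h = ∀ i l → i ℕ.+ l ℕ.< s → M (p ∸ i) (q ∸ l) (a ∸ (i ℕ.+ l)) h ≈ 0#

  -- A new pair consists of one point inside `x` and one outside. Fixing the inside point or the
  -- outside point gives two instances of the hypothesis, and by `M-exchange` their difference is
  -- the sum for `∇ h`. The pair uses up one level of `s`.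
  VanishesBelow-∇ : ∀ {s p q a h} → s ℕ.≤ p → s ℕ.≤ q →
    VanishesBelow (suc s) (suc p) (suc q) (suc a) h → VanishesBelow s p q a (∇ h)
  VanishesBelow-∇ {s} {p} {q} {a} {h} s≤p s≤q v i l i+l<s = begin
    M p′ q′ b (∇ h)                  ≈⟨ +-identityˡ _ ⟨
    0# + M p′ q′ b (∇ h)             ≈⟨ +-congʳ second ⟨
    M (suc p′) q′ b h + M p′ q′ b (∇ h) ≈⟨ M-exchange p′ q′ b h ⟨
    M p′ (suc q′) b h                ≈⟨ first ⟩
    0#                               ∎
    where
    p′ = p ∸ i
    q′ = q ∸ l
    b = a ∸ (i ℕ.+ l)
    i≤p : i ℕ.≤ p
    i≤p = ℕ.≤-trans (ℕ.m≤m+n i l) (ℕ.≤-trans (ℕ.<⇒≤ i+l<s) s≤p)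
    l≤q : l ℕ.≤ q
    l≤q = ℕ.≤-trans (ℕ.m≤n+m l i) (ℕ.≤-trans (ℕ.<⇒≤ i+l<s) s≤q)
    first : M p′ (suc q′) b h ≈ 0#
    first = ≡.subst (λ t → M p′ t b h ≈ 0#) (ℕ.+-∸-assoc 1 l≤q) (v (suc i) l (s≤s i+l<s))
    second : M (suc p′) q′ b h ≈ 0#
    second = ≡.subst₂ (λ t u → M t q′ (suc a ∸ u) h ≈ 0#) (ℕ.+-∸-assoc 1 i≤p) (ℕ.+-suc i l)
      (v i (suc l) (≡.subst (ℕ._< suc s) (≡.sym (ℕ.+-suc i l)) (s≤s i+l<s)))

  E-below : ∀ {j s p q a h} → j ℕ.< s → s ℕ.≤ p → s ℕ.≤ q → s ℕ.≤ a →
            VanishesBelow s p q a h → E j p q a h ≈ 0#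
  E-below {zero}  j<s s≤p s≤q s≤a v = v 0 0 j<s
  E-below {suc j} (s≤s j<s) (s≤s s≤p) (s≤s s≤q) (s≤s s≤a) v =
    E-below j<s s≤p s≤q s≤a (VanishesBelow-∇ s≤p s≤q v)

  -- The functionals `E j` separate kernels

  -- Characteristic zero in the form of torsion-freeness. The kernel arguments cancel positive
  -- integer factors and never divide, so they can be run over a commutative ring.
  ·-Cancellative : Set
  ·-Cancellative = ∀ m {x} → .{{ℕ.NonZero m}} → m · x ≈ 0# → x ≈ 0#

  module _ (·-cancel : ·-Cancellative) where

    -- By recursion ∇ h vanishes on the smaller tables, so h is constant on the
    -- tables with margins p, q, a, and E 0 is a nonzero multiple of the constant.
    E-determines : ∀ p q a h →
      (∀ j → j ℕ.≤ p → j ℕ.≤ q → j ℕ.≤ a → j ℕ.+ a ℕ.≤ p ℕ.+ q → E j p q a h ≈ 0#) →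
      ∀ i k l m → i ℕ.+ k ≡ p → l ℕ.+ m ≡ q → i ℕ.+ l ≡ a → h k ≈ 0#

    E-determines-∇ : ∀ p q a h →
      (∀ j → j ℕ.≤ p → j ℕ.≤ q → j ℕ.≤ a → j ℕ.+ a ℕ.≤ p ℕ.+ q → E j p q a h ≈ 0#) →
      ∀ i k l m → suc i ℕ.+ k ≡ p → l ℕ.+ suc m ≡ q → suc i ℕ.+ l ≡ a → h k ≈ h (suc k)
    E-determines-∇ (suc p) zero    a       h e i k l m ik lm il = contradiction lm (ℕ.m+1+n≢0 l)
    E-determines-∇ (suc p) (suc q) (suc a) h e i k l m ik lm il = x∙y⁻¹≈ε⇒x≈y _ _
      (E-determines p q a (∇ h)
        -- `E (suc j)` with successor margins unfolds to `E j` of `∇ h`, so the hypotheses pass to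
        -- `∇ h` shifted by one.
        (λ j j≤p j≤q j≤a j+a≤p+q → e (suc j) (s≤s j≤p) (s≤s j≤q) (s≤s j≤a)
          (s≤s (≡.subst₂ ℕ._≤_ (≡.sym (ℕ.+-suc j a)) (≡.sym (ℕ.+-suc p q)) (s≤s j+a≤p+q))))
        i k l m (ℕ.suc-injective ik) (ℕ.suc-injective (≡.trans (≡.sym (ℕ.+-suc l m)) lm))
        (ℕ.suc-injective il))

    E-determines p q a h e i k l m ik lm il =
      ·-cancel ((p ℕ.+ q) C a) {{C-nonZero a≤p+q}} (begin
        ((p ℕ.+ q) C a) · h k   ≈⟨ M-const p q a (h k) ⟨
        M p q a (λ _ → h k)     ≈⟨ M-cong-on p q a constant ⟩
        M p q a h               ≈⟨ e 0 z≤n z≤n z≤n a≤p+q ⟩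
        0#                      ∎)
      where
      a≤p+q : a ℕ.≤ p ℕ.+ q
      a≤p+q = ≡.subst₂ ℕ._≤_ il (≡.cong₂ ℕ._+_ ik lm) (ℕ.+-mono-≤ (ℕ.m≤m+n i k) (ℕ.m≤m+n l m))

      -- A table with given margins is determined by one entry, so these tables form a chain ordered
      -- by `k`. Neighbours in it are compared by `E-determines-∇`.
      chain : ∀ d i k l m → (d ℕ.+ i) ℕ.+ k ≡ p → l ℕ.+ (d ℕ.+ m) ≡ q → (d ℕ.+ i) ℕ.+ l ≡ a → h k ≈ h (d ℕ.+ k)
      chain zero    i k l m ik lm il = refl
      chain (suc d) i k l m ik lm il = trans
        (E-determines-∇ p q a h e (d ℕ.+ i) k l (d ℕ.+ m) ik lm il)
        (trans (chain d i (suc k) (suc l) m (≡.trans (ℕ.+-suc _ k) ik)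
                  (≡.trans (≡.sym (ℕ.+-suc l _)) lm) (≡.trans (ℕ.+-suc _ l) il))
          (reflexive (≡.cong h (ℕ.+-suc d k))))

      compare : ∀ i k l m i′ k′ l′ m′ → k ℕ.≤ k′ →
        i ℕ.+ k ≡ p → l ℕ.+ m ≡ q → i ℕ.+ l ≡ a →
        i′ ℕ.+ k′ ≡ p → l′ ℕ.+ m′ ≡ q → i′ ℕ.+ l′ ≡ a → h k ≈ h k′
      compare i k l m i′ k′ l′ m′ k≤k′ ik lm il ik′ lm′ il′ =
        trans (chain d i′ k l m′
          (≡.trans (≡.cong (ℕ._+ k) (≡.sym i≡)) ik)
          (≡.trans (≡.cong (l ℕ.+_) (≡.sym m≡)) lm)
          (≡.trans (≡.cong (ℕ._+ l) (≡.sym i≡)) il))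
          (reflexive (≡.cong h (≡.sym k′≡)))
        where
        d = k′ ∸ k
        k′≡ : k′ ≡ d ℕ.+ k
        k′≡ = ≡.sym (ℕ.m∸n+n≡m k≤k′)
        i≡ : i ≡ d ℕ.+ i′
        i≡ = ℕ.+-cancelʳ-≡ k i (d ℕ.+ i′) (≡.trans ik (≡.trans (≡.sym ik′)
          (≡.trans (≡.cong (i′ ℕ.+_) k′≡) (≡.trans (≡.sym (ℕ.+-assoc i′ d k)) (≡.cong (ℕ._+ k) (ℕ.+-comm i′ d))))))
        l′≡ : l′ ≡ d ℕ.+ l
        l′≡ = ℕ.+-cancelˡ-≡ i′ l′ (d ℕ.+ l) (≡.trans il′ (≡.trans (≡.sym il)
          (≡.trans (≡.cong (ℕ._+ l) (≡.trans i≡ (ℕ.+-comm d i′))) (ℕ.+-assoc i′ d l))))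
        m≡ : m ≡ d ℕ.+ m′
        m≡ = ℕ.+-cancelˡ-≡ l m (d ℕ.+ m′) (≡.trans lm (≡.trans (≡.sym lm′)
          (≡.trans (≡.cong (ℕ._+ m′) (≡.trans l′≡ (ℕ.+-comm d l))) (ℕ.+-assoc l d m′))))

      constant : ∀ i′ k′ l′ m′ → i′ ℕ.+ k′ ≡ p → l′ ℕ.+ m′ ≡ q → i′ ℕ.+ l′ ≡ a → h k ≈ h k′
      constant i′ k′ l′ m′ ik′ lm′ il′ with ℕ.≤-total k k′
      ... | inj₁ k≤k′ = compare i k l m i′ k′ l′ m′ k≤k′ ik lm il ik′ lm′ il′
      ... | inj₂ k′≤k = sym (compare i′ k′ l′ m′ i k l m k′≤k ik′ lm′ il′ ik lm il)

  -- Newton expansion of kernel sums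

  Degree≤ : ℕ → (ℕ → Carrier) → Set
  Degree≤ s h = ∇^ (suc s) h ≗ λ _ → 0#

  -- Since `∇` is 1 minus the shift, h(k) is the sum of (-1)^m C(k,m) (∇^m h)(0). Summing C(∣x ─ y∣,
  -- m) over the `a`-subsets `y` of a `t`-set counts pairs of an `m`-subset of `x` and a `y`
  -- avoiding it, which gives C(p,m) C(t-m,a).
  newton : ℕ → ℕ → ℕ → (ℕ → Carrier) → ℕ → Carrier
  newton p t a h m = (- 1#) ^ m * (((p C m) ℕ.* ((t ∸ m) C a)) · ∇^ m h 0)

  ·-0# : ∀ m → m · 0# ≈ 0#
  ·-0# zero    = refl
  ·-0# (suc m) = trans (+-identityˡ _) (·-0# m)

  M-0# : ∀ p q a {h} → (h ≗ λ _ → 0#) → M p q a h ≈ 0#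
  M-0# p q a h≗0 = trans (M-cong p q a h≗0) (trans (M-const p q a 0#) (·-0# ((p ℕ.+ q) C a)))

  -- The termwise counterpart of `M-exchange`. By Pascal's rule the coefficients for `p` and `suc p`
  -- differ by C(p,m), and the change of sign from order `m` to `suc m` makes this the term of
  -- `∇ h`.
  newton-suc : ∀ p t a h m → newton p (suc t) a h (suc m) ≈ newton (suc p) (suc t) a h (suc m) + newton p t a (∇ h) m
  newton-suc p t a h m = begin
    s * (((p C suc m) ℕ.* c) · x)              ≈⟨ +-identityʳ _ ⟨
    s * (((p C suc m) ℕ.* c) · x) + 0#
      ≈⟨ +-congˡ (trans (sym (zeroʳ s′)) (trans (*-congˡ (sym (-‿inverseˡ y))) (distribˡ s′ (- y) y))) ⟩
    s * (((p C suc m) ℕ.* c) · x) + (s′ * - y + s′ * y)   ≈⟨ +-assoc _ _ _ ⟨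
    (s * (((p C suc m) ℕ.* c) · x) + s′ * - y) + s′ * y   ≈⟨ +-congʳ (+-congˡ (sym s*y)) ⟩
    (s * (((p C suc m) ℕ.* c) · x) + s * y) + s′ * y   ≈⟨ +-congʳ (distribˡ _ _ _) ⟨
    s * (((p C suc m) ℕ.* c) · x + y) + s′ * y ≈⟨ +-congʳ (*-congˡ pascal) ⟩
    s * (((suc p C suc m) ℕ.* c) · x) + s′ * y  ∎
    where
    s = (- 1#) ^ suc m
    s′ = (- 1#) ^ m
    c = (t ∸ m) C a
    x = ∇^ m (∇ h) 0
    y = ((p C m) ℕ.* c) · x
    s*y : s * y ≈ s′ * - y
    s*y = trans (*-congʳ (trans (-1*x≈-x s′) refl)) (trans (sym (-‿distribˡ-* s′ y)) (-‿distribʳ-* s′ y))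
    pascal : ((p C suc m) ℕ.* c) · x + y ≈ ((suc p C suc m) ℕ.* c) · x
    pascal = trans (sym (×-homo-+ x ((p C suc m) ℕ.* c) ((p C m) ℕ.* c)))
      (×-congˡ (≡.trans (≡.sym (ℕ.*-distribʳ-+ c (p C suc m) (p C m)))
        (≡.cong (ℕ._* c) (≡.trans (ℕ.+-comm (p C suc m) (p C m)) (nCk+nC[k+1]≡[n+1]C[k+1] p m)))))

  -- Induction on `p` with `p + q` fixed: `M-exchange` moves a point out of `x`, at the cost of a
  -- sum for `∇ h`, whose degree is one less. For `p = 0` only order 0 survives.
  M-newton : ∀ s p q a h → Degree≤ s h → M p q a h ≈ ∑[ m ≤ s ] newton p (p ℕ.+ q) a h (toℕ m)
  M-newton s zero q a h deg = sym (begin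
    ∑[ m ≤ s ] newton 0 q a h (toℕ m)
      ≈⟨ +-cong (trans (*-identityˡ _) (×-congˡ {x = h 0} (ℕ.*-identityˡ (q C a)))) (sum-cong-≋ {s} {y = λ _ → 0#} λ m → zeroʳ _) ⟩
    (q C a) · h 0 + ∑[ m < s ] 0#    ≈⟨ +-congˡ (sum-replicate-zero s) ⟩
    (q C a) · h 0 + 0#               ≈⟨ +-identityʳ _ ⟩
    (q C a) · h 0                    ∎)
  M-newton s (suc p) q a h deg = +-cancelʳ (M p q a (∇ h)) _ _ (begin
    M (suc p) q a h + M p q a (∇ h)                           ≈⟨ M-exchange p q a h ⟨
    M p (suc q) a h                                           ≈⟨ M-newton s p (suc q) a h deg ⟩
    ∑[ m ≤ s ] newton p (p ℕ.+ suc q) a h (toℕ m)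
      ≈⟨ reflexive (≡.cong (λ t → ∑[ m ≤ s ] newton p t a h (toℕ m)) (ℕ.+-suc p q)) ⟩
    ∑[ m ≤ s ] newton p (suc p ℕ.+ q) a h (toℕ m)             ≈⟨ split s deg ⟩
    ∑[ m ≤ s ] newton (suc p) (suc p ℕ.+ q) a h (toℕ m) + M p q a (∇ h) ∎)
    where
    -- The terms of order 0 for `p` and `suc p` coincide. Those of positive order differ by the
    -- Newton sum of `∇ h`.
    split : ∀ s → Degree≤ s h → ∑[ m ≤ s ] newton p (suc p ℕ.+ q) a h (toℕ m) ≈ ∑[ m ≤ s ] newton (suc p) (suc p ℕ.+ q) a h (toℕ m) + M p q a (∇ h)
    split zero    deg = sym (trans (+-congˡ (M-0# p q a deg)) (+-identityʳ _))
    split (suc s) deg = trans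
      (+-congˡ (trans (sum-cong-≋ {suc s} λ m → newton-suc p (p ℕ.+ q) a h (toℕ m))
        (∑-distrib-+ {suc s} (λ m → newton (suc p) (suc p ℕ.+ q) a h (suc (toℕ m))) (λ m → newton p (p ℕ.+ q) a (∇ h) (toℕ m)))))
      (trans (sym (+-assoc _ _ _)) (+-congˡ (sym (M-newton s p q a (∇ h) deg))))

  -- Abel summation and sequences orthogonal to polynomials

  prefix : Carrier → (ℕ → Carrier) → ℕ → Carrier
  prefix x b zero    = x
  prefix x b (suc m) = prefix (x + b 0) (b ∘ suc) m

  prefix-suc : ∀ m x b → prefix x b (suc m) ≈ prefix x b m + b m
  prefix-suc zero    x b = refl
  prefix-suc (suc m) x b = prefix-suc m (x + b 0) (b ∘ suc)

  prefix-sum : ∀ m x b → prefix x b m ≈ x + ∑[ i < m ] b (toℕ i)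
  prefix-sum zero    x b = sym (+-identityʳ x)
  prefix-sum (suc m) x b = trans (prefix-sum m (x + b 0) (b ∘ suc)) (+-assoc _ _ _)

  -- Abel summation, with `γ` the decrement of `g`. The start value `x` absorbs the first term of
  -- `b`, so that the induction hypothesis has the same form.
  summation-by-parts : ∀ n (g γ : ℕ → ℕ) x b → (∀ m → m ℕ.< n → g m ≡ γ m ℕ.+ g (suc m)) →
    g 0 · x + ∑[ m ≤ n ] (g (toℕ m) · b (toℕ m)) ≈
    ∑[ m < n ] (γ (toℕ m) · prefix x b (suc (toℕ m))) + g n · prefix x b (suc n)
  summation-by-parts zero g γ x b g≡ = begin
    g 0 · x + (g 0 · b 0 + 0#)   ≈⟨ +-congˡ (+-identityʳ _) ⟩
    g 0 · x + g 0 · b 0          ≈⟨ ·-distrib-+ (g 0) x (b 0) ⟨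
    g 0 · (x + b 0)              ≈⟨ +-identityˡ _ ⟨
    0# + g 0 · (x + b 0)         ∎
  summation-by-parts (suc n) g γ x b g≡ = begin
    g 0 · x + (g 0 · b 0 + S)            ≈⟨ +-assoc _ _ _ ⟨
    (g 0 · x + g 0 · b 0) + S            ≈⟨ +-congʳ (·-distrib-+ (g 0) x (b 0)) ⟨
    g 0 · x′ + S
      ≈⟨ +-congʳ (trans (×-congˡ (g≡ 0 (s≤s z≤n))) (×-homo-+ x′ (γ 0) (g 1))) ⟩
    (γ 0 · x′ + g 1 · x′) + S            ≈⟨ +-assoc _ _ _ ⟩
    γ 0 · x′ + (g 1 · x′ + S)
      ≈⟨ +-congˡ (summation-by-parts n (g ∘ suc) (γ ∘ suc) x′ (b ∘ suc) (λ m m<n → g≡ (suc m) (s≤s m<n))) ⟩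
    γ 0 · x′ + (∑[ m < n ] (γ (suc (toℕ m)) · prefix x′ (b ∘ suc) (suc (toℕ m))) + g (suc n) · prefix x′ (b ∘ suc) (suc n))
      ≈⟨ +-assoc _ _ _ ⟨
    _ ∎
    where
    x′ = x + b 0
    S = ∑[ m ≤ n ] (g (suc (toℕ m)) · b (suc (toℕ m)))

  -- The hypothesis says that b is orthogonal to all polynomials of degree < s
  -- on {0,…,s}, so b m is proportional to (-1)^m C(s,m).
  orthogonal⇒alternating : ∀ s e b → s ℕ.≤ e →
    (∀ d → d ℕ.< s → ∑[ m ≤ s ] (((d ℕ.+ (e ∸ toℕ m)) C d) · b (toℕ m)) ≈ 0#) →
    b 0 ≈ (- 1#) ^ s * b s
  orthogonal⇒alternating zero    e b s≤e orth = sym (*-identityˡ _)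
  orthogonal⇒alternating (suc s) e b s<e orth = begin
    b 0                                   ≈⟨ +-identityˡ _ ⟨
    b′ 0                                  ≈⟨ orthogonal⇒alternating s e b′ (ℕ.<⇒≤ s<e) orth′ ⟩
    (- 1#) ^ s * b′ s                     ≈⟨ *-congˡ b′s ⟩
    (- 1#) ^ s * - b (suc s)              ≈⟨ -‿distribʳ-* _ _ ⟨
    - ((- 1#) ^ s * b (suc s))            ≈⟨ -1*x≈-x _ ⟨
    (- 1#) * ((- 1#) ^ s * b (suc s))     ≈⟨ *-assoc _ _ _ ⟨
    (- 1#) ^ suc s * b (suc s)            ∎
    where
    -- Abel summation turns orthogonality of `b` in degree `suc d` into orthogonality of the partial
    -- sums `b′` in degree `d`. Degree 0 says that the total of `b` vanishes, so the last partial
    -- sum is minus the last term, which produces the sign.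
    b′ : ℕ → Carrier
    b′ m = prefix 0# b (suc m)
    total : prefix 0# b (suc (suc s)) ≈ 0#
    total = begin
      prefix 0# b (suc (suc s))          ≈⟨ prefix-sum (suc (suc s)) 0# b ⟩
      0# + ∑[ m ≤ suc s ] b (toℕ m)      ≈⟨ +-identityˡ _ ⟩
      ∑[ m ≤ suc s ] b (toℕ m)           ≈⟨ sum-cong-≋ {suc (suc s)} (λ m → sym (×-homo-1 (b (toℕ m)))) ⟩
      ∑[ m ≤ suc s ] (1 · b (toℕ m))     ≈⟨ orth 0 (s≤s z≤n) ⟩
      0#                                 ∎
    b′s : b′ s ≈ - b (suc s)
    b′s = +-cancelʳ (b (suc s)) _ _ (trans (sym (prefix-suc (suc s) 0# b)) (trans total (sym (-‿inverseˡ _))))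
    pascal : ∀ d m → m ℕ.< e → (suc d ℕ.+ (e ∸ m)) C suc d ≡ ((d ℕ.+ (e ∸ m)) C d) ℕ.+ ((suc d ℕ.+ (e ∸ suc m)) C suc d)
    pascal d m m<e rewrite ℕ.+-∸-assoc 1 m<e | ℕ.+-suc d (e ∸ suc m) =
      ≡.sym (nCk+nC[k+1]≡[n+1]C[k+1] (suc (d ℕ.+ (e ∸ suc m))) d)
    orth′ : ∀ d → d ℕ.< s → ∑[ m ≤ s ] (((d ℕ.+ (e ∸ toℕ m)) C d) · b′ (toℕ m)) ≈ 0#
    orth′ d d<s = begin
      ∑[ m ≤ s ] (γ (toℕ m) · b′ (toℕ m))                                   ≈⟨ +-identityʳ _ ⟨
      ∑[ m ≤ s ] (γ (toℕ m) · b′ (toℕ m)) + 0#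
        ≈⟨ +-congˡ (trans (×-congʳ (g (suc s)) total) (·-0# (g (suc s)))) ⟨
      ∑[ m ≤ s ] (γ (toℕ m) · b′ (toℕ m)) + g (suc s) · prefix 0# b (suc (suc s))
        ≈⟨ summation-by-parts (suc s) g γ 0# b (λ m m<s → pascal d m (ℕ.≤-trans m<s s<e)) ⟨
      g 0 · 0# + ∑[ m ≤ suc s ] (g (toℕ m) · b (toℕ m))
        ≈⟨ +-cong (·-0# (g 0)) (orth (suc d) (s≤s d<s)) ⟩
      0# + 0#                                                               ≈⟨ +-identityˡ _ ⟩
      0# ∎
      where
      g γ : ℕ → ℕ
      g m = (suc d ℕ.+ (e ∸ m)) C suc d
      γ m = (d ℕ.+ (e ∸ m)) C d

  ·-cancel⇒·-injective : ·-Cancellative → ∀ m {x y} → .{{ℕ.NonZero m}} → m · x ≈ m · y → x ≈ y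
  ·-cancel⇒·-injective ·-cancel m {x} {y} eq = x∙y⁻¹≈ε⇒x≈y x y (·-cancel m (begin
    m · (x - y)           ≈⟨ ·-distrib-+ m x (- y) ⟩
    m · x + m · (- y)     ≈⟨ +-congʳ eq ⟩
    m · y + m · (- y)     ≈⟨ ·-distrib-+ m y (- y) ⟨
    m · (y - y)           ≈⟨ ×-congʳ m (-‿inverseʳ y) ⟩
    m · 0#                ≈⟨ ·-0# m ⟩
    0#                    ∎))

  -- The leading difference of a kernel from its value at 0

  module _ (·-cancel : ·-Cancellative) where

    module Leading (s p q a u : ℕ) (h : ℕ → Carrier) (a+u : a ℕ.+ u ≡ p ℕ.+ q)
      (s≤p : s ℕ.≤ p) (s≤q : s ℕ.≤ q) (s≤a : s ℕ.≤ a) (s≤u : s ℕ.≤ u)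
      (deg : Degree≤ s h) (vanishes : VanishesBelow s p q a h) where

      -- This is n - s + 1 for n = p + q, the top of the falling factorial in `α`. The `+ 1` comes
      -- from pairing degree `d` with `l = s - 1 - d`, for which n - l - m equals d + (e - m).
      e : ℕ
      e = p ℕ.+ q ∸ s ℕ.+ 1

      -- The part of the Newton terms common to all `l`. With l = s - 1 - d, the binomial C(n-l-m,
      -- a-l) is C(d+e-m, d) [u]_m (e-m)! times d! / ((a-l)! u!), and this last factor is
      -- independent of `m`.
      b : ℕ → Carrier
      b m = (- 1#) ^ m * (((p C m) ℕ.* ((u P m) ℕ.* (e ∸ m) !)) · ∇^ m h 0)

      2s≤ : s ℕ.+ s ℕ.≤ p ℕ.+ q
      2s≤ = ℕ.+-mono-≤ s≤p s≤q

      s≤n∸s : s ℕ.≤ p ℕ.+ q ∸ s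
      s≤n∸s = ≡.subst (ℕ._≤ p ℕ.+ q ∸ s) (ℕ.m+n∸n≡m s s) (ℕ.∸-monoˡ-≤ s 2s≤)

      s≤e : s ℕ.≤ e
      s≤e = ℕ.≤-trans s≤n∸s (ℕ.m≤m+n _ 1)

      -- Both sides are p + q - l - m.
      index : ∀ l d m a′ u′ → l ℕ.+ suc d ≡ s → l ℕ.+ a′ ≡ a → m ℕ.+ u′ ≡ u → m ℕ.≤ s →
              d ℕ.+ (e ∸ m) ≡ a′ ℕ.+ u′
      index l d m a′ u′ l+d a≡ u≡ m≤s = ℕ.+-cancelʳ-≡ (m ℕ.+ l) _ _ (≡.trans lhs (≡.sym rhs))
        where
        open ℕSolver using () renaming (solve to solveℕ; _:+_ to _⊕_; _:=_ to _⊜_; con to conℕ)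
        lhs : d ℕ.+ (e ∸ m) ℕ.+ (m ℕ.+ l) ≡ p ℕ.+ q
        lhs = ≡.trans (solveℕ 4 (λ d x m l → d ⊕ x ⊕ (m ⊕ l) ⊜ (x ⊕ m) ⊕ (l ⊕ d)) ≡.refl d (e ∸ m) m l)
          (≡.trans (≡.cong (ℕ._+ (l ℕ.+ d)) (ℕ.m∸n+n≡m (ℕ.≤-trans m≤s s≤e)))
          (≡.trans (solveℕ 3 (λ x l d → x ⊕ conℕ 1 ⊕ (l ⊕ d) ⊜ x ⊕ (l ⊕ (conℕ 1 ⊕ d))) ≡.refl (p ℕ.+ q ∸ s) l d)
          (≡.trans (≡.cong (p ℕ.+ q ∸ s ℕ.+_) l+d)
            (ℕ.m∸n+n≡m (ℕ.≤-trans (ℕ.m≤m+n s s) 2s≤)))))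
        rhs : a′ ℕ.+ u′ ℕ.+ (m ℕ.+ l) ≡ p ℕ.+ q
        rhs = ≡.trans (solveℕ 4 (λ a u m l → a ⊕ u ⊕ (m ⊕ l) ⊜ (l ⊕ a) ⊕ (m ⊕ u)) ≡.refl a′ u′ m l)
          (≡.trans (≡.cong₂ ℕ._+_ a≡ u≡) a+u)

      -- The vanishing condition with `l = s - 1 - d` points outside `x` and none inside, in Newton
      -- form. Both sides are multiplied by integers to clear the factor relating `newton` to `b`.
      orthogonal : ∀ d → d ℕ.< s → ∑[ m ≤ s ] (((d ℕ.+ (e ∸ toℕ m)) C d) · b (toℕ m)) ≈ 0#
      orthogonal d d<s = ·-cancel (d !) {{d ℕ.!≢0}} (begin
        (d !) · ∑[ m ≤ s ] f (toℕ m)                             ≈⟨ ·-sum (d !) (suc s) f ⟩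
        ∑[ m ≤ s ] ((d !) · f (toℕ m))
          ≈⟨ sum-cong-≋ {suc s} (λ m → term (toℕ m) (Fin.toℕ≤pred[n] m)) ⟩
        ∑[ m ≤ s ] ((a′ ! ℕ.* u !) · g (toℕ m))                  ≈⟨ ·-sum (a′ ! ℕ.* u !) (suc s) g ⟨
        (a′ ! ℕ.* u !) · ∑[ m ≤ s ] g (toℕ m)
          ≈⟨ ×-congʳ (a′ ! ℕ.* u !) (trans (sym (M-newton s p (q ∸ l) a′ h deg)) (vanishes 0 l l<s)) ⟩
        (a′ ! ℕ.* u !) · 0#                                      ≈⟨ ·-0# (a′ ! ℕ.* u !) ⟩
        0#                                                       ∎)
        where
        l a′ : ℕ
        l = s ∸ suc d
        a′ = a ∸ l
        l+d : l ℕ.+ suc d ≡ s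
        l+d = ℕ.m∸n+n≡m d<s
        l≤s : l ℕ.≤ s
        l≤s = ℕ.m∸n≤m s (suc d)
        l<s : l ℕ.< s
        l<s = ≡.subst (suc l ℕ.≤_) l+d (≡.subst (ℕ._≤ l ℕ.+ suc d) (ℕ.+-comm l 1) (ℕ.+-monoʳ-≤ l (s≤s z≤n)))
        f g : ℕ → Carrier
        f m = ((d ℕ.+ (e ∸ m)) C d) · b m
        g = newton p (p ℕ.+ (q ∸ l)) a′ h
        ·-sum : ∀ c n (f : ℕ → Carrier) → c · ∑[ m < n ] f (toℕ m) ≈ ∑[ m < n ] (c · f (toℕ m))
        ·-sum c zero    f = ·-0# c
        ·-sum c (suc n) f = trans (·-distrib-+ c _ _) (+-congˡ (·-sum c n (f ∘ suc)))
        term : ∀ m → m ℕ.≤ s → (d !) · f m ≈ (a′ ! ℕ.* u !) · g m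
        term m m≤s = begin
          (d !) · (((d ℕ.+ (e ∸ m)) C d) · (± * (((p C m) ℕ.* ((u P m) ℕ.* (e ∸ m) !)) · x)))
            ≈⟨ merge (d !) ((d ℕ.+ (e ∸ m)) C d) _ ⟩
          ± * ((d ! ℕ.* (((d ℕ.+ (e ∸ m)) C d) ℕ.* ((p C m) ℕ.* ((u P m) ℕ.* (e ∸ m) !)))) · x)
            ≈⟨ *-congˡ (×-congˡ (≡.trans coefficient (≡.cong (λ t → (a′ ! ℕ.* u !) ℕ.* ((p C m) ℕ.* (t C a′))) a′+u′))) ⟩
          ± * (((a′ ! ℕ.* u !) ℕ.* ((p C m) ℕ.* ((p ℕ.+ (q ∸ l) ∸ m) C a′))) · x)
            ≈⟨ *-congˡ (×-assocˡ x (a′ ! ℕ.* u !) _) ⟨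
          ± * ((a′ ! ℕ.* u !) · (((p C m) ℕ.* ((p ℕ.+ (q ∸ l) ∸ m) C a′)) · x))
            ≈⟨ ×-comm-* (a′ ! ℕ.* u !) _ _ ⟩
          (a′ ! ℕ.* u !) · g m ∎
          where
          ± = (- 1#) ^ m
          x = ∇^ m h 0
          u′ = u ∸ m
          u≡ : m ℕ.+ u′ ≡ u
          u≡ = ℕ.m+[n∸m]≡n (ℕ.≤-trans m≤s s≤u)
          a≡ : l ℕ.+ a′ ≡ a
          a≡ = ℕ.m+[n∸m]≡n (ℕ.≤-trans l≤s s≤a)
          merge : ∀ i j k → i · (j · (± * (k · x))) ≈ ± * ((i ℕ.* (j ℕ.* k)) · x)
          merge i j k = begin
            i · (j · (± * (k · x)))        ≈⟨ ×-assocˡ _ i j ⟩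
            (i ℕ.* j) · (± * (k · x))      ≈⟨ ×-comm-* (i ℕ.* j) _ _ ⟨
            ± * ((i ℕ.* j) · (k · x))      ≈⟨ *-congˡ (×-assocˡ x (i ℕ.* j) k) ⟩
            ± * ((i ℕ.* j ℕ.* k) · x)      ≈⟨ *-congˡ (×-congˡ (ℕ.*-assoc i j k)) ⟩
            ± * ((i ℕ.* (j ℕ.* k)) · x)    ∎
          coefficient : d ! ℕ.* (((d ℕ.+ (e ∸ m)) C d) ℕ.* ((p C m) ℕ.* ((u P m) ℕ.* (e ∸ m) !))) ≡
                        (a′ ! ℕ.* u !) ℕ.* ((p C m) ℕ.* ((a′ ℕ.+ u′) C a′))
          coefficient = ≡.subst (λ t → d ! ℕ.* (((d ℕ.+ (e ∸ m)) C d) ℕ.* ((p C m) ℕ.* ((t P m) ℕ.* (e ∸ m) !))) ≡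
              (a′ ! ℕ.* t !) ℕ.* ((p C m) ℕ.* ((a′ ℕ.+ u′) C a′))) u≡
            (rescaling m u′ {d = d} {x = e ∸ m} (p C m) (index l d m a′ u′ l+d a≡ u≡ m≤s))
          a′+u′ : a′ ℕ.+ u′ ≡ p ℕ.+ (q ∸ l) ∸ m
          a′+u′ = ≡.sym (≡.trans
            (≡.cong (_∸ m) (≡.trans (≡.sym (ℕ.+-∸-assoc p (ℕ.≤-trans l≤s s≤q)))
              (≡.trans (≡.cong (_∸ l) (≡.sym a+u)) (ℕ.+-∸-comm u (ℕ.≤-trans l≤s s≤a)))))
            (ℕ.+-∸-assoc a′ (ℕ.≤-trans m≤s s≤u)))

      -- Compares the two ends of the alternating sequence: `b 0` is e! h(0), and `b s` is C(p,s)
      -- [u]_s (e-s)! times the s-th difference, up to a sign that cancels. Multiplying by s! and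
      -- cancelling (e-s)! leaves falling factorials.
      ∇^-at-0 : ((e P s) ℕ.* s !) · h 0 ≈ ((u P s) ℕ.* (p P s)) · ∇^ s h 0
      ∇^-at-0 = ·-cancel⇒·-injective ·-cancel ((e ∸ s) !) {{(e ∸ s) ℕ.!≢0}} (begin
        ((e ∸ s) !) · (((e P s) ℕ.* s !) · h 0)       ≈⟨ ×-assocˡ _ ((e ∸ s) !) ((e P s) ℕ.* s !) ⟩
        ((e ∸ s) ! ℕ.* ((e P s) ℕ.* s !)) · h 0     ≈⟨ ×-congˡ lhs ⟩
        (s ! ℕ.* (1 ℕ.* (1 ℕ.* e !))) · h 0         ≈⟨ ×-assocˡ _ (s !) (1 ℕ.* (1 ℕ.* e !)) ⟨
        (s !) · ((1 ℕ.* (1 ℕ.* e !)) · h 0)           ≈⟨ ×-congʳ (s !) (*-identityˡ _) ⟨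
        (s !) · b 0
          ≈⟨ ×-congʳ (s !) (orthogonal⇒alternating s e b s≤e orthogonal) ⟩
        (s !) · ((- 1#) ^ s * b s)                    ≈⟨ ×-congʳ (s !) (-1^-involutive s _) ⟩
        (s !) · (((p C s) ℕ.* ((u P s) ℕ.* (e ∸ s) !)) · ∇^ s h 0)
          ≈⟨ ×-assocˡ _ (s !) ((p C s) ℕ.* ((u P s) ℕ.* (e ∸ s) !)) ⟩
        (s ! ℕ.* ((p C s) ℕ.* ((u P s) ℕ.* (e ∸ s) !))) · ∇^ s h 0 ≈⟨ ×-congˡ rhs ⟩
        ((e ∸ s) ! ℕ.* ((u P s) ℕ.* (p P s))) · ∇^ s h 0
          ≈⟨ ×-assocˡ _ ((e ∸ s) !) ((u P s) ℕ.* (p P s)) ⟨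
        ((e ∸ s) !) · (((u P s) ℕ.* (p P s)) · ∇^ s h 0)     ∎)
        where
        open ℕSolver using () renaming (solve to solveℕ; _:*_ to _⊗_; _:=_ to _⊜_; con to conℕ)
        lhs : (e ∸ s) ! ℕ.* ((e P s) ℕ.* s !) ≡ s ! ℕ.* (1 ℕ.* (1 ℕ.* e !))
        lhs = ≡.trans (solveℕ 3 (λ x y z → x ⊗ (y ⊗ z) ⊜ z ⊗ (conℕ 1 ⊗ (conℕ 1 ⊗ (y ⊗ x)))) ≡.refl ((e ∸ s) !) (e P s) (s !))
          (≡.cong (λ t → s ! ℕ.* (1 ℕ.* (1 ℕ.* t))) (nPk*[n∸k]!≡n! s≤e))
        rhs : s ! ℕ.* ((p C s) ℕ.* ((u P s) ℕ.* (e ∸ s) !)) ≡ (e ∸ s) ! ℕ.* ((u P s) ℕ.* (p P s))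
        rhs = ≡.trans (solveℕ 4 (λ x y z w → x ⊗ (y ⊗ (z ⊗ w)) ⊜ w ⊗ (z ⊗ (y ⊗ x))) ≡.refl (s !) (p C s) (u P s) ((e ∸ s) !))
          (≡.cong (λ t → (e ∸ s) ! ℕ.* ((u P s) ℕ.* t)) (nCk*k!≡nPk s≤p))
        -1^-involutive : ∀ s x → (- 1#) ^ s * ((- 1#) ^ s * x) ≈ x
        -1^-involutive zero    x = trans (*-identityˡ _) (*-identityˡ _)
        -1^-involutive (suc s) x = begin
          (- 1# * ε) * ((- 1# * ε) * x)  ≈⟨ *-cong (-1*x≈-x ε) (*-congʳ (-1*x≈-x ε)) ⟩
          - ε * (- ε * x)                ≈⟨ *-congˡ (sym (-‿distribˡ-* ε x)) ⟩
          - ε * - (ε * x)                ≈⟨ -‿distribˡ-* ε (- (ε * x)) ⟨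
          - (ε * - (ε * x))              ≈⟨ -‿cong (-‿distribʳ-* ε (ε * x)) ⟨
          - - (ε * (ε * x))              ≈⟨ -‿involutive _ ⟩
          ε * (ε * x)                    ≈⟨ -1^-involutive s x ⟩
          x                              ∎
          where ε = (- 1#) ^ s

    open Leading public using (∇^-at-0)

  -- The functionals `E j` on kernels of bounded degree

  E-degree : ∀ s p q a h → Degree≤ s h →
             E s p q a h ≈ (((p ∸ s) ℕ.+ (q ∸ s)) C (a ∸ s)) · ∇^ s h 0
  E-degree s p q a h deg = trans
    (M-cong (p ∸ s) (q ∸ s) (a ∸ s) constant)
    (M-const (p ∸ s) (q ∸ s) (a ∸ s) (∇^ s h 0))
    where
    ∇^-suc : ∀ j h → ∇^ (suc j) h ≗ ∇ (∇^ j h)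
    ∇^-suc zero    h k = refl
    ∇^-suc (suc j) h k = ∇^-suc j (∇ h) k
    constant : ∇^ s h ≗ λ _ → ∇^ s h 0
    constant zero    = refl
    constant (suc k) = trans (sym (x∙y⁻¹≈ε⇒x≈y _ _ (trans (sym (∇^-suc s h k)) (deg k)))) (constant k)

  Degree≤-suc : ∀ s h → Degree≤ s h → Degree≤ (suc s) h
  Degree≤-suc zero    h deg k = trans (+-cong (deg k) (-‿cong (deg (suc k)))) (-‿inverseʳ 0#)
  Degree≤-suc (suc s) h deg k = Degree≤-suc s (∇ h) deg k

  E-above : ∀ {j s} p q a h → s ℕ.< j → Degree≤ s h → E j p q a h ≈ 0#
  E-above {j} {s} p q a h s<j deg = M-0# (p ∸ j) (q ∸ j) (a ∸ j) (vanish s<j h deg)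
    where
    vanish : ∀ {j s} → s ℕ.< j → ∀ h → Degree≤ s h → ∇^ j h ≗ λ _ → 0#
    vanish {suc j} (s≤s z≤n)       h deg = weaken j h deg
      where
      weaken : ∀ j h → Degree≤ 0 h → Degree≤ j h
      weaken zero    h deg = deg
      weaken (suc j) h deg = Degree≤-suc j h (weaken j h deg)
    vanish (s≤s s<j@(s≤s _)) h deg = vanish s<j (∇ h) deg

  E-+ : ∀ j p q a h h′ → E j p q a (λ k → h k + h′ k) ≈ E j p q a h + E j p q a h′
  E-+ j p q a h h′ = trans (M-cong (p ∸ j) (q ∸ j) (a ∸ j) (∇^-+ j h h′)) (M-+ (p ∸ j) (q ∸ j) (a ∸ j) _ _)

  E-* : ∀ j p q a c h → E j p q a (λ k → c * h k) ≈ c * E j p q a h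
  E-* j p q a c h = trans (M-cong (p ∸ j) (q ∸ j) (a ∸ j) (∇^-* j c h)) (M-* (p ∸ j) (q ∸ j) (a ∸ j) c _)

  E-sum : ∀ j p q a n (f : Fin n → ℕ → Carrier) →
          E j p q a (λ k → ∑[ i < n ] f i k) ≈ ∑[ i < n ] E j p q a (f i)
  E-sum j p q a zero    f = M-0# (p ∸ j) (q ∸ j) (a ∸ j) (∇^-0# j)
    where
    ∇^-0# : ∀ j → ∇^ j (λ _ → 0#) ≗ λ _ → 0#
    ∇^-0# zero    k = refl
    ∇^-0# (suc j) k = trans (∇^-cong j (λ _ → -‿inverseʳ 0#) k) (∇^-0# j k)
  E-sum j p q a (suc n) f = trans (E-+ j p q a (f zero) _) (+-congˡ (E-sum j p q a n (f ∘ suc)))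

  ∇-*-index : ∀ h → ∇ (λ k → (k · 1#) * h k) ≗ λ k → (k · 1#) * ∇ h k - h (suc k)
  ∇-*-index h k = begin
    κ * h k - (1# + κ) * h (suc k)
      ≈⟨ +-congˡ (-‿cong (trans (distribʳ _ _ _) (+-congʳ (*-identityˡ _)))) ⟩
    κ * h k - (h (suc k) + κ * h (suc k))
      ≈⟨ +-congˡ (trans (sym (-‿+-comm _ _)) (+-comm _ _)) ⟩
    κ * h k + (- (κ * h (suc k)) - h (suc k))         ≈⟨ +-assoc _ _ _ ⟨
    (κ * h k - κ * h (suc k)) - h (suc k)             ≈⟨ +-congʳ (∇-* κ h k) ⟩
    κ * ∇ h k - h (suc k)                             ∎
    where κ = k · 1#

  ∇^-∘suc : ∀ j h → ∇^ j (h ∘ suc) ≗ ∇^ j h ∘ suc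
  ∇^-∘suc zero    h k = refl
  ∇^-∘suc (suc j) h k = ∇^-∘suc j (∇ h) k

  -- Multiplication by the index raises the degree by at most one. The product rule `∇-*-index`
  -- leaves the same claim for `∇ h` and a shift of `h`, which is already annihilated.
  ∇^-vanishes-*-index : ∀ j h → (∇^ j h ≗ λ _ → 0#) → ∇^ (suc j) (λ k → (k · 1#) * h k) ≗ λ _ → 0#
  ∇^-vanishes-*-index zero    h h≗0 k = trans (+-cong (0ʳ (h≗0 k)) (trans (-‿cong (0ʳ (h≗0 (suc k)))) -0#≈0#)) (+-identityˡ _)
    where
    0ʳ : ∀ {x y} → y ≈ 0# → x * y ≈ 0#
    0ʳ y≈0 = trans (*-congˡ y≈0) (zeroʳ _)
  ∇^-vanishes-*-index (suc j) h h≗0 k = begin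
    ∇^ (suc j) (∇ (λ i → (i · 1#) * h i)) k
      ≈⟨ ∇^-cong (suc j) (∇-*-index h) k ⟩
    ∇^ (suc j) (λ i → (i · 1#) * ∇ h i - h (suc i)) k
      ≈⟨ ∇^-cong (suc j) (λ i → +-congˡ {(i · 1#) * ∇ h i} (sym (-1*x≈-x (h (suc i))))) k ⟩
    ∇^ (suc j) (λ i → (i · 1#) * ∇ h i + - 1# * h (suc i)) k
      ≈⟨ ∇^-+ (suc j) (λ i → (i · 1#) * ∇ h i) _ k ⟩
    ∇^ (suc j) (λ i → (i · 1#) * ∇ h i) k + ∇^ (suc j) (λ i → - 1# * h (suc i)) k
      ≈⟨ +-cong (∇^-vanishes-*-index j (∇ h) h≗0 k) (trans (∇^-* (suc j) (- 1#) (h ∘ suc) k) (*-congˡ (trans (∇^-∘suc (suc j) h k) (h≗0 (suc k))))) ⟩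
    0# + - 1# * 0#
      ≈⟨ trans (+-identityˡ _) (zeroʳ _) ⟩
    0#                                                                   ∎

  Degree≤-polynomial : ∀ d (c : Vector Carrier (suc d)) →
    Degree≤ d (λ k → ∑[ i ≤ d ] (c i * (k · 1#) ^ toℕ i))
  Degree≤-polynomial zero    c k = -‿inverseʳ _
  Degree≤-polynomial (suc d) c k = begin
    ∇^ (suc (suc d)) (λ t → ∑[ i ≤ suc d ] (c i * (t · 1#) ^ toℕ i)) k
      ≈⟨ ∇^-cong (suc (suc d)) horner k ⟩
    ∇^ (suc (suc d)) (λ t → c zero + (t · 1#) * p t) k
      ≈⟨ ∇^-+ (suc (suc d)) (λ _ → c zero) (λ t → (t · 1#) * p t) k ⟩
    ∇^ (suc (suc d)) (λ _ → c zero) k + ∇^ (suc (suc d)) (λ t → (t · 1#) * p t) k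
      ≈⟨ +-cong (constant (suc d) k) (∇^-vanishes-*-index (suc d) p (Degree≤-polynomial d (c ∘ suc)) k) ⟩
    0# + 0#                                                              ≈⟨ +-identityˡ _ ⟩
    0#                                                                   ∎
    where
    p : ℕ → Carrier
    p t = ∑[ i ≤ d ] (c (suc i) * (t · 1#) ^ toℕ i)
    constant : ∀ j → Degree≤ j (λ _ → c zero)
    constant zero    k = -‿inverseʳ _
    constant (suc j) k = Degree≤-suc j (λ _ → c zero) (constant j) k
    horner : (λ t → ∑[ i ≤ suc d ] (c i * (t · 1#) ^ toℕ i)) ≗ λ t → c zero + (t · 1#) * p t
    horner t = +-cong (*-identityʳ _) (trans
      (sum-cong-≋ {suc d} λ i → solve 3 (λ a b c → a :* (b :* c) := b :* (a :* c)) refl (c (suc i)) (t · 1#) ((t · 1#) ^ toℕ i))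
      (sym (*-distribˡ-sum {suc d} (t · 1#) (λ i → c (suc i) * (t · 1#) ^ toℕ i))))

  -- Krawtchouk polynomials

  sign : ℕ → Carrier
  sign k = (- 1#) ^ k

  -- P_a(p, p + q), parametrised like `M` by the sizes of `x` and of its complement.
  krawtchouk′ : ℕ → ℕ → ℕ → Carrier
  krawtchouk′ a p q = ∑[ j ≤ a ] (sign (toℕ j) * ((p C toℕ j) · 1#) * ((q C (a ∸ toℕ j)) · 1#))

  -- The generating function in `a` is (1 - z)^p (1 + z)^q, and raising `p` by one multiplies it by
  -- 1 - z.
  krawtchouk′-suc : ∀ a p q → krawtchouk′ (suc a) p q ≈ krawtchouk′ (suc a) (suc p) q + krawtchouk′ a p q
  krawtchouk′-suc a p q = trans
    (+-congˡ (trans (sum-cong-≋ {suc a} λ j → term (toℕ j)) (∑-distrib-+ {suc a} (λ j → A (toℕ j)) (λ j → B (toℕ j)))))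
    (sym (+-assoc _ _ _))
    where
    A B : ℕ → Carrier
    A j = sign (suc j) * ((suc p C suc j) · 1#) * ((q C (a ∸ j)) · 1#)
    B j = sign j * ((p C j) · 1#) * ((q C (a ∸ j)) · 1#)
    term : ∀ j → sign (suc j) * ((p C suc j) · 1#) * ((q C (a ∸ j)) · 1#) ≈ A j + B j
    term j = sym (begin
      A j + B j                                 ≈⟨ distribʳ _ _ _ ⟨
      (sign (suc j) * ((suc p C suc j) · 1#) + σ * c) * ((q C (a ∸ j)) · 1#)   ≈⟨ *-congʳ (begin
        sign (suc j) * ((suc p C suc j) · 1#) + σ * c
          ≈⟨ +-congʳ (*-congˡ (trans (pascal-· p j 1#) (+-comm _ _))) ⟩
        sign (suc j) * (c′ + c) + σ * c                 ≈⟨ +-congʳ (distribˡ _ _ _) ⟩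
        (sign (suc j) * c′ + sign (suc j) * c) + σ * c  ≈⟨ +-assoc _ _ _ ⟩
        sign (suc j) * c′ + (sign (suc j) * c + σ * c)
          ≈⟨ +-congˡ (trans (sym (distribʳ c _ _)) (trans (*-congʳ (trans (+-congʳ (-1*x≈-x σ)) (-‿inverseˡ σ))) (zeroˡ c))) ⟩
        sign (suc j) * c′ + 0#                          ≈⟨ +-identityʳ _ ⟩
        sign (suc j) * c′                               ∎) ⟩
      sign (suc j) * c′ * ((q C (a ∸ j)) · 1#)  ∎)
      where
      σ = sign j
      c = (p C j) · 1#
      c′ = (p C suc j) · 1#

  sign-suc : ∀ k x → sign (suc k) * x ≈ - (sign k * x)
  sign-suc k x = trans (*-congʳ (-1*x≈-x (sign k))) (sym (-‿distribˡ-* _ _))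

  -- Grouping the `y` by j = ∣x ∩ y∣ shows that the Krawtchouk sum is the sum of (-1)^∣x ∩ y∣. The
  -- factor `sign p` replaces ∣x ∩ y∣ by ∣x ─ y∣.
  M-sign : ∀ p q a → M p q a sign ≈ sign p * krawtchouk′ a p q
  M-sign zero q a = sym (trans (*-identityˡ _) (begin
    (1# * (1# + 0#)) * ((q C a) · 1#) + ∑[ j < a ] (sign (suc (toℕ j)) * 0# * ((q C (a ∸ suc (toℕ j))) · 1#))
      ≈⟨ +-cong (trans (*-congʳ (trans (*-identityˡ _) (+-identityʳ _))) (*-identityˡ _))
           (trans (sum-cong-≋ {a} {y = λ _ → 0#} λ j → trans (*-congʳ (zeroʳ _)) (zeroˡ _)) (sum-replicate-zero a)) ⟩
    (q C a) · 1# + 0#     ≈⟨ +-identityʳ _ ⟩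
    (q C a) · 1#          ∎))
  M-sign (suc p) q zero = begin
    M p q zero (sign ∘ suc)                ≈⟨ M-* p q zero (- 1#) sign ⟩
    - 1# * M p q zero sign                 ≈⟨ *-congˡ (M-sign p q zero) ⟩
    - 1# * (sign p * krawtchouk′ 0 p q)    ≈⟨ *-assoc _ _ _ ⟨
    sign (suc p) * krawtchouk′ 0 p q       ∎
  M-sign (suc p) q (suc a) = begin
    M p q a sign + M p q (suc a) (sign ∘ suc)
      ≈⟨ +-cong (M-sign p q a) (trans (M-* p q (suc a) (- 1#) sign) (trans (*-congˡ (M-sign p q (suc a))) (sym (*-assoc _ _ _)))) ⟩
    sign p * K + sign (suc p) * krawtchouk′ (suc a) p q
      ≈⟨ +-congˡ (trans (*-congˡ (krawtchouk′-suc a p q)) (distribˡ _ _ _)) ⟩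
    sign p * K + (sign (suc p) * K′ + sign (suc p) * K)
      ≈⟨ solve 3 (λ x y z → x :+ (y :+ z) := y :+ (z :+ x)) refl _ _ _ ⟩
    sign (suc p) * K′ + (sign (suc p) * K + sign p * K)
      ≈⟨ +-congˡ (trans (+-congʳ (sign-suc p K)) (-‿inverseˡ _)) ⟩
    sign (suc p) * K′ + 0#                              ≈⟨ +-identityʳ _ ⟩
    sign (suc p) * K′                                   ∎
    where
    K = krawtchouk′ a p q
    K′ = krawtchouk′ (suc a) (suc p) q

  ∇^-sign : ∀ j → ∇^ j sign ≗ λ k → (1# + 1#) ^ j * sign k
  ∇^-sign zero    k = sym (*-identityˡ _)
  ∇^-sign (suc j) k = begin
    ∇^ j (∇ sign) k                     ≈⟨ ∇^-cong j (λ i → begin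
      sign i - - 1# * sign i                ≈⟨ +-congˡ (trans (-‿cong (-1*x≈-x _)) (-‿involutive _)) ⟩
      sign i + sign i                       ≈⟨ +-cong (*-identityˡ _) (*-identityˡ _) ⟨
      1# * sign i + 1# * sign i             ≈⟨ distribʳ _ _ _ ⟨
      (1# + 1#) * sign i                    ∎) k ⟩
    ∇^ j (λ i → (1# + 1#) * sign i) k   ≈⟨ ∇^-* j (1# + 1#) sign k ⟩
    (1# + 1#) * ∇^ j sign k             ≈⟨ *-congˡ (∇^-sign j k) ⟩
    (1# + 1#) * ((1# + 1#) ^ j * sign k) ≈⟨ *-assoc _ _ _ ⟨
    (1# + 1#) ^ suc j * sign k          ∎

  sign-+-cancel : ∀ i k → sign (i ℕ.+ k) * sign k ≈ sign i
  sign-+-cancel zero    zero    = *-identityˡ _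
  sign-+-cancel zero    (suc k) = trans (trans (*-cong (-1*x≈-x (sign k)) (-1*x≈-x (sign k)))
    (trans (sym (-‿distribˡ-* _ _)) (trans (-‿cong (sym (-‿distribʳ-* _ _))) (-‿involutive _)))) (sign-+-cancel zero k)
  sign-+-cancel (suc i) k       = trans (*-assoc _ _ _) (*-congˡ (sign-+-cancel i k))

  -- `sign` is an eigenfunction of `∇` with eigenvalue 2, whence 2^j. The factor `sign (p ∸ j)` from
  -- `M-sign` combines with `sign p` to (-1)^j.
  E-sign : ∀ j p q a → j ℕ.≤ p →
    E j p q a (λ k → sign p * sign k) ≈ (- (1# + 1#)) ^ j * krawtchouk′ (a ∸ j) (p ∸ j) (q ∸ j)
  E-sign j p q a j≤p = begin
    E j p q a (λ k → sign p * sign k)       ≈⟨ E-* j p q a (sign p) sign ⟩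
    sign p * E j p q a sign
      ≈⟨ *-congˡ (trans (M-cong p′ (q ∸ j) (a ∸ j) (∇^-sign j)) (trans (M-* p′ (q ∸ j) (a ∸ j) _ sign) (*-congˡ (M-sign p′ (q ∸ j) (a ∸ j))))) ⟩
    sign p * ((1# + 1#) ^ j * (sign p′ * K))
      ≈⟨ solve 4 (λ a b c d → a :* (b :* (c :* d)) := b :* (a :* c) :* d) refl _ _ _ _ ⟩
    (1# + 1#) ^ j * (sign p * sign p′) * K
      ≈⟨ *-congʳ (*-congˡ (trans (*-congʳ (reflexive (≡.cong sign (≡.sym (ℕ.m+[n∸m]≡n j≤p))))) (sign-+-cancel j p′))) ⟩
    (1# + 1#) ^ j * sign j * K              ≈⟨ *-congʳ (power j) ⟩
    (- (1# + 1#)) ^ j * K                   ∎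
    where
    p′ = p ∸ j
    K = krawtchouk′ (a ∸ j) p′ (q ∸ j)
    power : ∀ j → (1# + 1#) ^ j * sign j ≈ (- (1# + 1#)) ^ j
    power zero    = *-identityˡ _
    power (suc j) = begin
      (1# + 1#) * (1# + 1#) ^ j * (- 1# * sign j)
        ≈⟨ solve 4 (λ a b c d → a :* b :* (c :* d) := c :* a :* (b :* d)) refl _ _ _ _ ⟩
      - 1# * (1# + 1#) * ((1# + 1#) ^ j * sign j)       ≈⟨ *-cong (-1*x≈-x _) (power j) ⟩
      (- (1# + 1#)) ^ suc j                             ∎

  sum-single : ∀ n (f : Fin n → Carrier) i → (∀ j → j ≢ i → f j ≈ 0#) → ∑[ j < n ] f j ≈ f i
  sum-single (suc n) f zero    others = trans
    (+-congˡ (trans (sum-cong-≋ {n} {y = λ _ → 0#} λ j → others (suc j) λ ()) (sum-replicate-zero n))) (+-identityʳ _)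
  sum-single (suc n) f (suc i) others = trans
    (+-cong (others zero λ ()) (sum-single n (f ∘ suc) i λ j j≢i → others (suc j) (j≢i ∘ Fin.suc-injective))) (+-identityˡ _)

-- Inverses and square roots of positive reals

module RealLemmas (ℝ : RealNumbers) where
  open RealNumbers ℝ
  open PositiveReals ℝ
  open RingProperties (CommutativeRing.ring commutativeRing)
  open SemiringSolver (CommutativeRing.commutativeSemiring commutativeRing) using (solve; _:=_; _:*_)
  open SetoidReasoning setoid
  open Mult semiring using () renaming (_×_ to _·_)

  infix 9 _⁻¹
  _⁻¹ : ℝ⁺ → Carrier
  x ⁻¹ = 1# / x

  /-as-* : ∀ x y → x / y ≈ x * y ⁻¹
  /-as-* x y = *-congˡ (sym (*-identityˡ _))

  ⁻¹-inverse : ∀ x → proj₁ x * x ⁻¹ ≈ 1#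
  ⁻¹-inverse (x , 0<x) = trans (*-cong (sym (x-0≈x x)) (*-identityˡ _)) (proj₂ (proj₂ (#⇒invertible (#-sym (<⇒# 0<x)))))

  *-cancelʳ-positive : ∀ {x y} (z : ℝ⁺) → x * proj₁ z ≈ y * proj₁ z → x ≈ y
  *-cancelʳ-positive {x} {y} z xz≈yz = begin
    x                       ≈⟨ *-identityʳ x ⟨
    x * 1#                  ≈⟨ *-congˡ (⁻¹-inverse z) ⟨
    x * (proj₁ z * z ⁻¹)    ≈⟨ *-assoc _ _ _ ⟨
    x * proj₁ z * z ⁻¹      ≈⟨ *-congʳ xz≈yz ⟩
    y * proj₁ z * z ⁻¹      ≈⟨ *-assoc _ _ _ ⟩
    y * (proj₁ z * z ⁻¹)    ≈⟨ *-congˡ (⁻¹-inverse z) ⟩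
    y * 1#                  ≈⟨ *-identityʳ y ⟩
    y                       ∎

  ⁻¹-positive : ∀ x → 0# < x ⁻¹
  ⁻¹-positive x@(x′ , 0<x) with #⇒<⊎> (invertible⇒# {x ⁻¹} {0#} (x′ , left , trans (*-comm _ _) left))
    where
    left : x′ * (x ⁻¹ - 0#) ≈ 1#
    left = trans (*-congˡ (x-0≈x _)) (⁻¹-inverse x)
  ... | inj₂ 0<x⁻¹ = 0<x⁻¹
  -- A negative inverse would make -1 = x (-x⁻¹) positive.
  ... | inj₁ x⁻¹<0 = contradiction (<-trans 0<1 1<0) (<-irrefl refl)
    where
    0<-x⁻¹ : 0# < - x ⁻¹
    0<-x⁻¹ = <-respʳ-≈ (+-identityˡ _) (<-respˡ-≈ (-‿inverseʳ _) (+-monoˡ-< (- x ⁻¹) x⁻¹<0))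
    0<-1 : 0# < - 1#
    0<-1 = <-respʳ-≈ (trans (sym (-‿distribʳ-* x′ (x ⁻¹))) (-‿cong (⁻¹-inverse x))) (*-positive 0<x 0<-x⁻¹)
    1<0 : 1# < 0#
    1<0 = <-respˡ-≈ (+-identityˡ _) (<-respʳ-≈ (-‿inverseˡ _) (+-monoˡ-< 1# 0<-1))

  -- Adding the product x y to both squares makes them multiples of the positive number x + y, which
  -- cancels; `x` and `y` need not be compared.
  square-injective : ∀ {x y} → 0# < x → 0# < y → x * x ≈ y * y → x ≈ y
  square-injective {x} {y} 0<x 0<y x²≈y² = *-cancelʳ-positive (x + y , +-positive 0<x 0<y) (begin
    x * (x + y)      ≈⟨ distribˡ _ _ _ ⟩
    x * x + x * y    ≈⟨ +-cong x²≈y² (*-comm _ _) ⟩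
    y * y + y * x    ≈⟨ +-comm _ _ ⟩
    y * x + y * y    ≈⟨ distribˡ _ _ _ ⟨
    y * (x + y)      ∎)

  √[y/x]*x≈√[x*y] : ∀ x y → √ (proj₁ y / x) * proj₁ x ≈ √ (proj₁ x * proj₁ y)
  √[y/x]*x≈√[x*y] x@(x′ , 0<x) y@(y′ , 0<y) = square-injective
    (*-positive (√-positive 0<y/x) 0<x) (√-positive 0<xy) (begin
    (√ (y′ / x) * x′) * (√ (y′ / x) * x′)
      ≈⟨ solve 2 (λ a b → (a :* b) :* (a :* b) := a :* a :* (b :* b)) refl _ _ ⟩
    √ (y′ / x) * √ (y′ / x) * (x′ * x′)     ≈⟨ *-congʳ (trans (√-square (<-asym 0<y/x)) (/-as-* y′ x)) ⟩
    y′ * x ⁻¹ * (x′ * x′)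
      ≈⟨ solve 3 (λ a b c → a :* b :* (c :* c) := (c :* b) :* (c :* a)) refl _ _ _ ⟩
    x′ * x ⁻¹ * (x′ * y′)                   ≈⟨ trans (*-congʳ (⁻¹-inverse x)) (*-identityˡ _) ⟩
    x′ * y′                                 ≈⟨ √-square (<-asym 0<xy) ⟨
    √ (x′ * y′) * √ (x′ * y′)               ∎)
    where
    0<xy = *-positive 0<x 0<y
    0<y/x : 0# < y′ / x
    0<y/x = <-respʳ-≈ (sym (/-as-* y′ x)) (*-positive 0<y (⁻¹-positive x))

  ·-cancel-ℝ : ∀ m {x} → .{{NonZero m}} → m · x ≈ 0# → x ≈ 0#
  ·-cancel-ℝ m {x} mx≈0 = *-cancelʳ-positive (ι⁺ m) (begin
    x * ι m        ≈⟨ Mult.×-comm-* semiring m x 1# ⟩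
    m · (x * 1#)   ≈⟨ Mult.×-congʳ semiring m (*-identityʳ x) ⟩
    m · x          ≈⟨ mx≈0 ⟩
    0#             ≈⟨ zeroˡ _ ⟨
    0# * ι m       ∎)

  -- The root in `k` times `c₁` is the root in the denominator of `α`, because √(c₂/c₁) c₁ = √(c₁
  -- c₂).
  cancel-roots : ∀ σ κ b (c₁ c₂ w z : ℝ⁺) →
    (σ * √ (proj₁ c₂ / c₁) * κ) * (b / (√⁺ (c₁ *⁺ c₂) *⁺ w *⁺ z)) * (proj₁ c₁ * (proj₁ z * proj₁ w)) ≈ σ * κ * b
  cancel-roots σ κ b c₁ c₂ w z = begin
    (σ * √ q * κ) * (b / d) * (proj₁ c₁ * (proj₁ z * proj₁ w))       ≈⟨ *-congʳ (*-congˡ (/-as-* b d)) ⟩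
    (σ * √ q * κ) * (b * d ⁻¹) * (proj₁ c₁ * (proj₁ z * proj₁ w))
      ≈⟨ solve 8 (λ σ r κ b e c w z → (σ :* r :* κ) :* (b :* e) :* (c :* (z :* w)) := σ :* κ :* b :* (r :* c :* w :* z :* e)) refl _ _ _ _ _ _ _ _ ⟩
    σ * κ * b * (√ q * proj₁ c₁ * proj₁ w * proj₁ z * d ⁻¹)
      ≈⟨ *-congˡ (*-congʳ (*-congʳ (*-congʳ (√[y/x]*x≈√[x*y] c₁ c₂)))) ⟩
    σ * κ * b * (proj₁ d * d ⁻¹)                                     ≈⟨ *-congˡ (⁻¹-inverse d) ⟩
    σ * κ * b * 1#                                                   ≈⟨ *-identityʳ _ ⟩
    σ * κ * b                                                        ∎
    where
    q = proj₁ c₂ / c₁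
    d = √⁺ (c₁ *⁺ c₂) *⁺ w *⁺ z

  module _ (n : ℕ) where
    open Coefficients ℝ n
    open Exp semiring using (_^_)

    k*α-identity : ∀ (r₁ r₂ : Fin (suc n)) (s : Fin (suc (N (toℕ r₁) (toℕ r₂)))) →
      let r₁′ = toℕ r₁ ; r₂′ = toℕ r₂ ; s′ = toℕ s in
      k r₁ r₂ s * α r₁ r₂ s * (ι ((n ∸ 2 ℕ.* s′) C (r₁′ ∸ s′)) * (ι ((n ∸ s′ ℕ.+ 1) P s′) * ι (s′ !))) ≈
      (- ι 2) ^ s′ * krawtchouk (r₁′ ∸ s′) (r₂′ ∸ s′) (n ∸ 2 ℕ.* s′) * (ι ((n ∸ r₁′) P s′) * ι (r₂′ P s′))
    k*α-identity r₁ r₂ s = cancel-roots _ _ _ _ _ _ _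

-- The embedding of ℝ in ℂ

module ComplexLemmas (ℝ : RealNumbers) where
  open ComplexNumbers ℝ
  private
    module R = RealNumbers ℝ
    module ℝ-Properties = RingProperties (CommutativeRing.ring R.commutativeRing)
    module ℝ-Exp = Exp R.semiring
    module ℝ-Mult = Mult R.semiring
    module ℝ-Sum = Sum R.semiring
  open CommutativeRing commutativeRing hiding (zero)
  open Exp semiring using (_^_)
  open Mult semiring using () renaming (_×_ to _·_)
  open Sum semiring using (sum)
  open KernelSums commutativeRing using (·-Cancellative)

  ofℝ-cong : ∀ {x y} → x R.≈ y → ofℝ x ≈ ofℝ y
  ofℝ-cong x≈y = x≈y , R.refl

  ofℝ-+ : ∀ x y → ofℝ (x R.+ y) ≈ ofℝ x + ofℝ y
  ofℝ-+ x y = R.refl , R.sym (R.+-identityˡ _)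

  ofℝ-* : ∀ x y → ofℝ (x R.* y) ≈ ofℝ x * ofℝ y
  ofℝ-* x y =
      R.sym (R.trans (R.+-congˡ (R.trans (R.-‿cong (R.zeroˡ _)) ℝ-Properties.-0#≈0#)) (R.+-identityʳ _))
    , R.sym (R.trans (R.+-cong (R.zeroʳ _) (R.zeroˡ _)) (R.+-identityˡ _))

  ofℝ-neg : ∀ x → ofℝ (R.- x) ≈ - ofℝ x
  ofℝ-neg x = R.refl , R.sym ℝ-Properties.-0#≈0#

  ofℝ-ι : ∀ m → ofℝ (R.ι m) ≈ m · 1#
  ofℝ-ι zero    = refl
  ofℝ-ι (suc m) = trans (ofℝ-+ R.1# (R.ι m)) (+-congˡ (ofℝ-ι m))

  ofℝ-^ : ∀ x m → ofℝ (x ℝ-Exp.^ m) ≈ ofℝ x ^ m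
  ofℝ-^ x zero    = refl
  ofℝ-^ x (suc m) = trans (ofℝ-* x (x ℝ-Exp.^ m)) (*-congˡ (ofℝ-^ x m))

  ofℝ-sum : ∀ m (f : Fin m → R.Carrier) → ofℝ (ℝ-Sum.sum f) ≈ sum (ofℝ ∘ f)
  ofℝ-sum zero    f = refl
  ofℝ-sum (suc m) f = trans (ofℝ-+ (f zero) (ℝ-Sum.sum (f ∘ suc))) (+-congˡ (ofℝ-sum m (f ∘ suc)))

  ·-cancel-ℂ : ·-Cancellative
  ·-cancel-ℂ m {z} mz≈0 =
      RealLemmas.·-cancel-ℝ ℝ m (R.trans (R.sym (re-· m)) (_≈ᶜ_.re-≈ mz≈0))
    , RealLemmas.·-cancel-ℝ ℝ m (R.trans (R.sym (im-· m)) (_≈ᶜ_.im-≈ mz≈0))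
    where
    re-· : ∀ m → re (m · z) R.≈ m ℝ-Mult.× re z
    re-· zero    = R.refl
    re-· (suc m) = R.+-congˡ (re-· m)
    im-· : ∀ m → im (m · z) R.≈ m ℝ-Mult.× im z
    im-· zero    = R.refl
    im-· (suc m) = R.+-congˡ (im-· m)

-- Sums over subsets and the action of the symmetric group

module SubsetSums (ℝ : RealNumbers) (n : ℕ) where
  open PowerSet ℝ n
  open CommutativeRing commutativeRing hiding (zero)
  open RingProperties ring
  open Exp semiring using (_^_; ^-congˡ)
  open Mult semiring renaming (_×_ to _·_)
  open Sum semiring
  open SemiringSolver commutativeSemiring using (solve; _:=_; _:+_; _:*_)
  open SetoidReasoning setoid
  open KernelSums commutativeRing
  open RealLemmas ℝ using (k*α-identity)
  open ComplexLemmas ℝ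
  private
    module R = RealNumbers ℝ
    module ℝ-Exp = Exp R.semiring
    module ℝ-Properties = RingProperties (CommutativeRing.ring R.commutativeRing)
    module ℕSum = MonoidSum ℕ.+-0-commutativeMonoid

  ∑⊆-cong : ∀ {m} {f g : Subset m → ℂ} → (∀ x → f x ≈ g x) → ∑⊆ f ≈ ∑⊆ g
  ∑⊆-cong {zero}  f≈g = f≈g []
  ∑⊆-cong {suc m} f≈g = +-cong (∑⊆-cong (f≈g ∘ (outside ∷_))) (∑⊆-cong (f≈g ∘ (inside ∷_)))

  ∑⊆-0# : ∀ m → ∑⊆ {m} (λ _ → 0#) ≈ 0#
  ∑⊆-0# zero    = refl
  ∑⊆-0# (suc m) = trans (+-cong (∑⊆-0# m) (∑⊆-0# m)) (+-identityˡ _)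

  ∑⊆-+ : ∀ {m} (f g : Subset m → ℂ) → ∑⊆ (λ x → f x + g x) ≈ ∑⊆ f + ∑⊆ g
  ∑⊆-+ {zero}  f g = refl
  ∑⊆-+ {suc m} f g = trans
    (+-cong (∑⊆-+ (f ∘ (outside ∷_)) (g ∘ (outside ∷_))) (∑⊆-+ (f ∘ (inside ∷_)) (g ∘ (inside ∷_))))
    (solve 4 (λ a b c d → (a :+ b) :+ (c :+ d) := (a :+ c) :+ (b :+ d)) refl _ _ _ _)

  ∑⊆-* : ∀ {m} c (f : Subset m → ℂ) → ∑⊆ (λ x → c * f x) ≈ c * ∑⊆ f
  ∑⊆-* {zero}  c f = refl
  ∑⊆-* {suc m} c f = trans (+-cong (∑⊆-* c (f ∘ (outside ∷_))) (∑⊆-* c (f ∘ (inside ∷_)))) (sym (distribˡ _ _ _))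

  ∑⊆-neg : ∀ {m} (f : Subset m → ℂ) → ∑⊆ (λ x → - f x) ≈ - ∑⊆ f
  ∑⊆-neg f = trans (∑⊆-cong λ x → sym (-1*x≈-x (f x))) (trans (∑⊆-* (- 1#) f) (-1*x≈-x _))

  ∑⊆-sum : ∀ {m} k (f : Fin k → Subset m → ℂ) → ∑⊆ (λ x → ∑[ i < k ] f i x) ≈ ∑[ i < k ] ∑⊆ (f i)
  ∑⊆-sum {m} zero f = ∑⊆-0# m
  ∑⊆-sum (suc k) f = trans (∑⊆-+ (f zero) _) (+-congˡ (∑⊆-sum k (f ∘ suc)))

  ∑⊆-comm : ∀ {m k} (f : Subset m → Subset k → ℂ) → ∑⊆ (λ x → ∑⊆ (f x)) ≈ ∑⊆ λ y → ∑⊆ λ x → f x y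
  ∑⊆-comm {zero}  f = refl
  ∑⊆-comm {suc m} f = trans
    (+-cong (∑⊆-comm (f ∘ (outside ∷_))) (∑⊆-comm (f ∘ (inside ∷_))))
    (sym (∑⊆-+ (λ y → ∑⊆ λ x → f (outside ∷ x) y) (λ y → ∑⊆ λ x → f (inside ∷ x) y)))

  infix 4 _≟_
  _≟_ : ∀ {m} (x y : Subset m) → Dec (x ≡ y)
  _≟_ = ≡-dec Bool._≟_

  ∑⊆-point : ∀ {m} y (f : Subset m → ℂ) → ∑⊆ (λ x → if does (y ≟ x) then f x else 0#) ≈ f y
  ∑⊆-point []            f = refl
  ∑⊆-point {suc m} (outside ∷ y) f = trans (+-cong (∑⊆-point y (f ∘ (outside ∷_))) (∑⊆-0# m)) (+-identityʳ _)
  ∑⊆-point {suc m} (inside  ∷ y) f = trans (+-cong (∑⊆-0# m) (∑⊆-point y (f ∘ (inside ∷_)))) (+-identityˡ _)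

  -- `∑⊆` recurses on membership bits, which a bijection of subsets need not respect. The value f(g
  -- x) is therefore written as a sum over all `y` concentrated at `y = g x`, and the two sums are
  -- interchanged.
  ∑⊆-reindex : ∀ {m} (f : Subset m → ℂ) (g g⁻¹ : Subset m → Subset m) →
    (∀ x → g⁻¹ (g x) ≡ x) → (∀ y → g (g⁻¹ y) ≡ y) → ∑⊆ (f ∘ g) ≈ ∑⊆ f
  ∑⊆-reindex f g g⁻¹ left right = begin
    ∑⊆ (f ∘ g)
      ≈⟨ ∑⊆-cong (λ x → ∑⊆-point (g x) f) ⟨
    (∑⊆ λ x → ∑⊆ λ y → if does (g x ≟ y) then f y else 0#)
      ≈⟨ ∑⊆-comm (λ x y → if does (g x ≟ y) then f y else 0#) ⟩
    (∑⊆ λ y → ∑⊆ λ x → if does (g x ≟ y) then f y else 0#)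
      ≈⟨ (∑⊆-cong λ y → ∑⊆-cong λ x → reflexive
      (≡.cong (λ b → if b then f y else 0#) (does-⇔ (mk⇔
        (λ gx≡y → ≡.trans (≡.cong g⁻¹ (≡.sym gx≡y)) (left x))
        (λ g⁻¹y≡x → ≡.trans (≡.cong g (≡.sym g⁻¹y≡x)) (right y))) (g x ≟ y) (g⁻¹ y ≟ x)))) ⟩
    (∑⊆ λ y → ∑⊆ λ x → if does (g⁻¹ y ≟ x) then f y else 0#)
      ≈⟨ (∑⊆-cong λ y → ∑⊆-point (g⁻¹ y) (λ _ → f y)) ⟩
    ∑⊆ f                                                              ∎

  flip-∙ : ∀ g x → flip g ∙ (g ∙ x) ≡ x
  flip-∙ g x = ≡.trans
    (tabulate-cong λ i → ≡.trans (lookup∘tabulate _ (g ⟨$⟩ʳ i)) (≡.cong (lookup x) (Perm.inverseˡ g)))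
    (tabulate∘lookup x)

  ∙-flip : ∀ g x → g ∙ (flip g ∙ x) ≡ x
  ∙-flip g x = flip-∙ (flip g) x

  ∑⊆-∙ : ∀ g (f : X → ℂ) → ∑⊆ (f ∘ (g ∙_)) ≈ ∑⊆ f
  ∑⊆-∙ g f = ∑⊆-reindex f (g ∙_) (flip g ∙_) (flip-∙ g) (∙-flip g)

  image-∙ : ∀ {m} g (f : Fin m → Fin n) → g ∙ image f ≡ image ((g ⟨$⟩ʳ_) ∘ f)
  image-∙ g f = tabulate-cong λ i → ≡.trans (lookup∘tabulate _ (g ⟨$⟩ˡ i))
    (does-⇔ (mk⇔
      (λ (j , fj≡) → j , ≡.trans (≡.cong (g ⟨$⟩ʳ_) fj≡) (Perm.inverseʳ g))
      (λ (j , gfj≡) → j , ≡.trans (≡.sym (Perm.inverseˡ g)) (≡.cong (g ⟨$⟩ˡ_) gfj≡)))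
      (Fin.any? λ j → f j Fin.≟ g ⟨$⟩ˡ i) (Fin.any? λ j → g ⟨$⟩ʳ f j Fin.≟ i))

  image-cong : ∀ {m} {f f′ : Fin m → Fin n} → (∀ j → f j ≡ f′ j) → image f ≡ image f′
  image-cong {f = f} {f′} f≗f′ = tabulate-cong λ i → does-⇔ (mk⇔
    (λ (j , fj≡) → j , ≡.trans (≡.sym (f≗f′ j)) fj≡)
    (λ (j , fj≡) → j , ≡.trans (f≗f′ j) fj≡))
    (Fin.any? λ j → f j Fin.≟ i) (Fin.any? λ j → f′ j Fin.≟ i)

  δ-∙ : ∀ g y x → δ y (flip g ∙ x) ≡ δ (g ∙ y) x
  δ-∙ g y x = ≡.cong (λ b → if b then 1# else 0#) (does-⇔ (mk⇔
    (λ y≡ → ≡.trans (≡.cong (g ∙_) y≡) (∙-flip g x))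
    (λ gy≡ → ≡.trans (≡.sym (flip-∙ g y)) (≡.cong (flip g ∙_) gy≡)))
    (y ≟ flip g ∙ x) (g ∙ y ≟ x))

  -- Antisymmetry of polytabloids

  toggle : ∀ {m} → Fin m → Subset m → Subset m
  toggle j J = J [ j ]%= not

  toggle-involutive : ∀ {m} (j : Fin m) J → toggle j (toggle j J) ≡ J
  toggle-involutive j J = ≡.trans (updateAt-updateAt j J) (updateAt-id-local j J (Bool.not-involutive _))

  sign-toggle : ∀ {m} (j : Fin m) J → sign ∣ J ∣ ≈ - sign ∣ toggle j J ∣
  sign-toggle zero    (outside ∷ J) = trans (sym (-‿involutive _)) (-‿cong (sym (-1*x≈-x _)))
  sign-toggle zero    (inside  ∷ J) = -1*x≈-x _
  sign-toggle (suc j) (outside ∷ J) = sign-toggle j J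
  sign-toggle (suc j) (inside  ∷ J) = trans (*-congˡ (sign-toggle j J)) (sym (-‿distribʳ-* _ _))

  transpose-first : ∀ (a b : Fin n) → transpose a b ⟨$⟩ʳ a ≡ b
  transpose-first a b rewrite dec-true (a Fin.≟ a) ≡.refl = ≡.refl

  transpose-second : ∀ (a b : Fin n) → transpose a b ⟨$⟩ʳ b ≡ a
  transpose-second a b with b Fin.≟ a
  ... | yes b≡a = b≡a
  ... | no  _ rewrite dec-true (b Fin.≟ b) ≡.refl = ≡.refl

  transpose-other : ∀ {a b k : Fin n} → k ≢ a → k ≢ b → transpose a b ⟨$⟩ʳ k ≡ k
  transpose-other {a} {b} {k} k≢a k≢b
    rewrite dec-false (k Fin.≟ a) k≢a | dec-false (k Fin.≟ b) k≢b = ≡.refl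

  module _ {s} (s≤n∸s : s ℕ.≤ n ∸ s) (t : Tableau s) where

    upper lower : Fin s → Fin n
    upper j = Inverse.to t (inj₁ (inject≤ j s≤n∸s))
    lower j = Inverse.to t (inj₂ j)

    exchange : Fin s → G
    exchange j = transpose (upper j) (lower j)

    private
      t-injective : ∀ {x y} → Inverse.to t x ≡ Inverse.to t y → x ≡ y
      t-injective {x} {y} tx≡ty = ≡.trans (≡.sym (Inverse.strictlyInverseʳ t x))
        (≡.trans (≡.cong (Inverse.from t) tx≡ty) (Inverse.strictlyInverseʳ t y))

    upper-injective : ∀ {i j} → upper i ≡ upper j → i ≡ j
    upper-injective = Fin.inject≤-injective s≤n∸s s≤n∸s _ _ ∘ inj₁-injective ∘ t-injective

    lower-injective : ∀ {i j} → lower i ≡ lower j → i ≡ j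
    lower-injective = inj₂-injective ∘ t-injective

    upper≢lower : ∀ {i j} → upper i ≢ lower j
    upper≢lower eq with () ← t-injective eq

    swappedRow-toggle : ∀ j J i → exchange j ⟨$⟩ʳ swappedRow s≤n∸s t J i ≡ swappedRow s≤n∸s t (toggle j J) i
    swappedRow-toggle j J i with i Fin.≟ j
    ... | yes ≡.refl rewrite lookup∘updateAt i {not} J with lookup J i
    ...   | inside  = transpose-first (upper i) (lower i)
    ...   | outside = transpose-second (upper i) (lower i)
    swappedRow-toggle j J i | no i≢j rewrite lookup∘updateAt′ i j {not} i≢j J with lookup J i
    ...   | inside  = transpose-other (i≢j ∘ upper-injective) upper≢lower
    ...   | outside = transpose-other (upper≢lower ∘ ≡.sym) (i≢j ∘ lower-injective)

    -- The exchange permutes the terms by `toggle j`, which reverses their signs. In the form of a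
    -- vanishing sum the property involves only addition and the action, so it can be carried
    -- through an isomorphism of representations.
    polytabloid-antisymmetric : ∀ j → polytabloid s≤n∸s t +ᴹ ρ (exchange j) (polytabloid s≤n∸s t) ≋ 0ᴹ
    polytabloid-antisymmetric j x = begin
      ∑⊆ F + ∑⊆ (λ J → sign ∣ J ∣ * δ (image (row J)) (flip g ∙ x))   ≈⟨ +-congˡ (∑⊆-cong λ J → begin
          sign ∣ J ∣ * δ (image (row J)) (flip g ∙ x)
            ≈⟨ *-cong (sign-toggle j J) (reflexive (≡.trans (δ-∙ g (image (row J)) x)
                                                                         (≡.cong (λ y → δ y x) (≡.trans (image-∙ g (row J)) (image-cong (swappedRow-toggle j J)))))) ⟩
          - sign ∣ toggle j J ∣ * δ (image (row (toggle j J))) x      ≈⟨ -‿distribˡ-* _ _ ⟨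
          - F (toggle j J)                                            ∎) ⟩
      ∑⊆ F + ∑⊆ (λ J → - F (toggle j J))
        ≈⟨ +-congˡ (∑⊆-neg (F ∘ toggle j)) ⟩
      ∑⊆ F - ∑⊆ (F ∘ toggle j)
        ≈⟨ +-congˡ (-‿cong (∑⊆-reindex F (toggle j) (toggle j) (toggle-involutive j) (toggle-involutive j))) ⟩
      ∑⊆ F - ∑⊆ F                                                     ≈⟨ -‿inverseʳ _ ⟩
      0#                                                              ∎
      where
      g = exchange j
      row = swappedRow s≤n∸s t
      F : Subset s → ℂ
      F J = sign ∣ J ∣ * δ (image (row J)) x

    -- Pigeonhole: the columns are disjoint, so the first `d` points of Ω meet at most `d` of the
    -- `s` columns.
    column-beyond : ∀ {d} → d ℕ.< s → ∃ λ j → d ℕ.≤ toℕ (upper j) × d ℕ.≤ toℕ (lower j)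
    column-beyond {d} d<s =
      let j , ¬meets = Fin.¬∀⟶∃¬ s Meets meets? ¬all
      in j , ℕ.≮⇒≥ (¬meets ∘ inj₁) , ℕ.≮⇒≥ (¬meets ∘ inj₂)
      where
      Meets : Fin s → Set
      Meets j = toℕ (upper j) ℕ.< d ⊎ toℕ (lower j) ℕ.< d
      meets? : ∀ j → Dec (Meets j)
      meets? j = (toℕ (upper j) ℕ.<? d) ⊎-dec (toℕ (lower j) ℕ.<? d)
      entry : ∀ {j} → Meets j → Fin d
      entry (inj₁ u<d) = fromℕ< u<d
      entry (inj₂ l<d) = fromℕ< l<d
      toℕ-fromℕ<-injective : ∀ {k l : Fin n} (k<d : toℕ k ℕ.< d) (l<d : toℕ l ℕ.< d) → fromℕ< k<d ≡ fromℕ< l<d → k ≡ l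
      toℕ-fromℕ<-injective k<d l<d eq = Fin.toℕ-injective (Fin.fromℕ<-injective _ _ k<d l<d eq)
      entry-injective : ∀ {i j} (p : Meets i) (q : Meets j) → entry p ≡ entry q → i ≡ j
      entry-injective (inj₁ p) (inj₁ q) eq = upper-injective (toℕ-fromℕ<-injective p q eq)
      entry-injective (inj₁ p) (inj₂ q) eq = contradiction (toℕ-fromℕ<-injective p q eq) upper≢lower
      entry-injective (inj₂ p) (inj₁ q) eq = contradiction (≡.sym (toℕ-fromℕ<-injective p q eq)) upper≢lower
      entry-injective (inj₂ p) (inj₂ q) eq = lower-injective (toℕ-fromℕ<-injective p q eq)
      ¬all : ¬ (∀ j → Meets j)
      ¬all all = let i , j , i<j , eq = Fin.pigeonhole d<s (entry ∘ all)
                 in Fin.<⇒≢ i<j (entry-injective (all i) (all j) eq)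

  -- Orthogonality of components to functions of few points

  -- The given points in `VanishesBelow` are taken to be the first `d` of Ω, and the set `x` is
  -- adapted to them later. The value at `[]` for `suc d` is a default, reached only for `d > m`.
  containsInitial : ∀ {m} → ℕ → Subset m → ℂ
  containsInitial zero    x       = 1#
  containsInitial (suc d) []      = 1#
  containsInitial (suc d) (b ∷ x) = if b then containsInitial d x else 0#

  containsInitial-cong : ∀ {m} d (x y : Subset m) →
    (∀ i → toℕ i ℕ.< d → lookup x i ≡ lookup y i) → containsInitial d x ≡ containsInitial d y
  containsInitial-cong zero    x       y       x≗y = ≡.refl
  containsInitial-cong (suc d) []      []      x≗y = ≡.refl
  containsInitial-cong (suc d) (b ∷ x) (c ∷ y) x≗y = ≡.cong₂ (λ b z → if b then z else 0#)
    (x≗y zero (s≤s z≤n)) (containsInitial-cong d x y λ i i<d → x≗y (suc i) (s≤s i<d))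

  conj-cong : ∀ {z w} → z ≈ w → conj z ≈ conj w
  conj-cong (p , q) = p , R.-‿cong q

  conj-+ : ∀ z w → conj (z + w) ≈ conj z + conj w
  conj-+ (a +i b) (c +i d) = R.refl , R.sym (ℝ-Properties.-‿+-comm b d)

  conj-* : ∀ z w → conj (z * w) ≈ conj z * conj w
  conj-* (a +i b) (c +i d) =
      R.+-congˡ (R.-‿cong (R.sym (R.trans (R.sym (ℝ-Properties.-‿distribˡ-* b (R.- d)))
        (R.trans (R.-‿cong (R.sym (ℝ-Properties.-‿distribʳ-* b d))) (ℝ-Properties.-‿involutive _)))))
    , R.trans (R.sym (ℝ-Properties.-‿+-comm _ _)) (R.+-cong (ℝ-Properties.-‿distribʳ-* a d) (ℝ-Properties.-‿distribˡ-* b c))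

  2·x≈0⇒x≈0 : ·-Cancellative → ∀ {x} → x + x ≈ 0# → x ≈ 0#
  2·x≈0⇒x≈0 ·-cancel x+x≈0 = ·-cancel 2 (trans (+-congˡ (+-identityʳ _)) x+x≈0)

  module _ (·-cancel : ·-Cancellative) where

    -- The transposition moves none of the first `d` points, so it fixes the indicator, and `v` and
    -- its transform have the same inner product with it. These sum to zero, and 2 is cancelled.
    ⟨containsInitial,antisymmetric⟩ : ∀ {d} {a b : Fin n} → d ℕ.≤ toℕ a → d ℕ.≤ toℕ b →
      ∀ v → v +ᴹ ρ (transpose a b) v ≋ 0ᴹ → ⟨ containsInitial d , v ⟩ ≈ 0#
    ⟨containsInitial,antisymmetric⟩ {d} {a} {b} d≤a d≤b v v+gv≋0 = 2·x≈0⇒x≈0 ·-cancel (begin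
      ⟨ f , v ⟩ + ⟨ f , v ⟩                                ≈⟨ +-congˡ invariant ⟨
      ⟨ f , v ⟩ + ⟨ f , ρ g v ⟩
        ≈⟨ ∑⊆-+ (λ x → f x * conj (v x)) (λ x → f x * conj (ρ g v x)) ⟨
      ∑⊆ (λ x → f x * conj (v x) + f x * conj (ρ g v x))   ≈⟨ ∑⊆-cong {n} (λ x → begin
        f x * conj (v x) + f x * conj (ρ g v x)              ≈⟨ distribˡ _ _ _ ⟨
        f x * (conj (v x) + conj (ρ g v x))
          ≈⟨ *-congˡ (trans (sym (conj-+ (v x) (ρ g v x))) (conj-cong (v+gv≋0 x))) ⟩
        f x * conj 0#                                        ≈⟨ *-congˡ (R.refl , ℝ-Properties.-0#≈0#) ⟩
        f x * 0#                                             ≈⟨ zeroʳ _ ⟩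
        0#                                                   ∎) ⟩
      ∑⊆ {n} (λ _ → 0#)                                    ≈⟨ ∑⊆-0# n ⟩
      0#                                                   ∎)
      where
      g = transpose a b
      f = containsInitial {n} d
      fixed : ∀ {c} → d ℕ.≤ toℕ c → ∀ {i : Fin n} → toℕ i ℕ.< d → i ≢ c
      fixed d≤c i<d ≡.refl = ℕ.<⇒≱ i<d d≤c
      invariant : ⟨ f , ρ g v ⟩ ≈ ⟨ f , v ⟩
      invariant = trans
        (∑⊆-cong λ x → *-congʳ (reflexive (containsInitial-cong d x (flip g ∙ x) λ i i<d →
          ≡.sym (≡.trans (lookup∘tabulate _ i) (≡.cong (lookup x) (transpose-other (fixed d≤a i<d) (fixed d≤b i<d)))))))
        (∑⊆-∙ (flip g) (λ x → f x * conj (v x)))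

    -- `V` is known only up to isomorphism, and its elements need not be polytabloids. The induction
    -- therefore follows the membership of the image in the Specht module, with preimages from
    -- surjectivity, and injectivity brings antisymmetry and linear relations back to `V`.
    ⟨containsInitial,component⟩ : ∀ {r s s≤ V d} → IsComponent r s s≤ V → d ℕ.< s →
      ∀ {v} → v ∈ V → ⟨ containsInitial d , v ⟩ ≈ 0#
    ⟨containsInitial,component⟩ {r} {s} {s≤} {V} {d} isComponent d<s {v} v∈V =
      onSpecht (proj₂ (to (v , v∈V))) (v , v∈V) (λ _ → refl)
      where
      open IsComponent isComponent using (≅Specht)
      open _≅ᴳ_ ≅Specht
      open IsModuleIsomorphism isModuleIsomorphism using (surjective; injective; +ᴹ-homo; 0ᴹ-homo; *ₗ-homo)
      s≤n∸s = s≤r⊓[n∸r]⇒s≤n∸s s≤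
      module V = GSubspace V
      module Vᴹ = Module V.asModule
      f = containsInitial {n} d

      ⟨f,_⟩-cong : ∀ {v w} → v ≋ w → ⟨ f , w ⟩ ≈ 0# → ⟨ f , v ⟩ ≈ 0#
      ⟨f,_⟩-cong v≋w eq = trans (∑⊆-cong λ x → *-congˡ (conj-cong (v≋w x))) eq

      onSpecht : ∀ {ψ} → InSpecht s≤n∸s ψ → ∀ v → proj₁ (to v) ≋ ψ → ⟨ f , proj₁ v ⟩ ≈ 0#
      onSpecht (generator t) v tov≋ψ =
        let j , d≤upper , d≤lower = column-beyond s≤n∸s t d<s
            g = exchange s≤n∸s t j
        in ⟨containsInitial,antisymmetric⟩ d≤upper d≤lower (proj₁ v) (injective {v Vᴹ.+ᴹ V.ρ∣ g v} {Vᴹ.0ᴹ} λ x → begin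
          proj₁ (to (v Vᴹ.+ᴹ V.ρ∣ g v)) x                          ≈⟨ +ᴹ-homo v (V.ρ∣ g v) x ⟩
          proj₁ (to v) x + proj₁ (to (V.ρ∣ g v)) x
            ≈⟨ +-cong (tov≋ψ x) (trans (equivariant g v x) (tov≋ψ (flip g ∙ x))) ⟩
          (polytabloid s≤n∸s t +ᴹ ρ g (polytabloid s≤n∸s t)) x
            ≈⟨ polytabloid-antisymmetric s≤n∸s t j x ⟩
          0#                                                       ≈⟨ 0ᴹ-homo x ⟨
          proj₁ (to Vᴹ.0ᴹ) x                                       ∎)
      onSpecht null v tov≋0 = ⟨f,_⟩-cong {proj₁ v} {0ᴹ}
        (injective {v} {Vᴹ.0ᴹ} λ x → trans (tov≋0 x) (sym (0ᴹ-homo x)))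
        (trans (∑⊆-cong λ x → trans (*-congˡ {f x} (R.refl , ℝ-Properties.-0#≈0#)) (zeroʳ _)) (∑⊆-0# n))
      onSpecht (plus {ψ} {φ} ψ∈ φ∈) v tov≋ =
        let v₁ , to≋₁ = surjective (ψ , ψ∈)
            v₂ , to≋₂ = surjective (φ , φ∈)
        in ⟨f,_⟩-cong {proj₁ v} {proj₁ v₁ +ᴹ proj₁ v₂}
          (injective {v} {v₁ Vᴹ.+ᴹ v₂} λ x → trans (tov≋ x)
            (sym (trans (+ᴹ-homo v₁ v₂ x) (+-cong (to≋₁ {v₁} (λ _ → refl) x) (to≋₂ {v₂} (λ _ → refl) x)))))
          (begin
            ⟨ f , proj₁ v₁ +ᴹ proj₁ v₂ ⟩
              ≈⟨ ∑⊆-cong (λ x → trans (*-congˡ (conj-+ (proj₁ v₁ x) (proj₁ v₂ x))) (distribˡ _ _ _)) ⟩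
            ∑⊆ (λ x → f x * conj (proj₁ v₁ x) + f x * conj (proj₁ v₂ x))
              ≈⟨ ∑⊆-+ (λ x → f x * conj (proj₁ v₁ x)) (λ x → f x * conj (proj₁ v₂ x)) ⟩
            ⟨ f , proj₁ v₁ ⟩ + ⟨ f , proj₁ v₂ ⟩
              ≈⟨ +-cong (onSpecht ψ∈ v₁ (to≋₁ {v₁} (λ _ → refl))) (onSpecht φ∈ v₂ (to≋₂ {v₂} (λ _ → refl))) ⟩
            0# + 0#                                 ≈⟨ +-identityˡ _ ⟩
            0#                                      ∎)
      onSpecht (scale c {ψ} ψ∈) v tov≋ =
        let v₁ , to≋₁ = surjective (ψ , ψ∈)
        in ⟨f,_⟩-cong {proj₁ v} {c *ₗ proj₁ v₁}
          (injective {v} {c Vᴹ.*ₗ v₁} λ x → trans (tov≋ x)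
            (sym (trans (*ₗ-homo c v₁ x) (*-congˡ (to≋₁ {v₁} (λ _ → refl) x)))))
          (begin
            ⟨ f , c *ₗ proj₁ v₁ ⟩
              ≈⟨ ∑⊆-cong (λ x → trans (*-congˡ (conj-* c (proj₁ v₁ x)))
                                                                    (solve 3 (λ x y z → x :* (y :* z) := y :* (x :* z)) refl (f x) (conj c) (conj (proj₁ v₁ x)))) ⟩
            ∑⊆ (λ x → conj c * (f x * conj (proj₁ v₁ x)))
              ≈⟨ ∑⊆-* (conj c) (λ x → f x * conj (proj₁ v₁ x)) ⟩
            conj c * ⟨ f , proj₁ v₁ ⟩
              ≈⟨ *-congˡ (onSpecht ψ∈ v₁ (to≋₁ {v₁} (λ _ → refl))) ⟩
            conj c * 0#                                        ≈⟨ zeroʳ _ ⟩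
            0#                                                 ∎)
      onSpecht (resp ψ≋φ ψ∈) v tov≋φ = onSpecht ψ∈ v λ x → trans (tov≋φ x) (sym (ψ≋φ x))

  -- Equivariance of the Fourier transform

  ∣x∣≡sum : ∀ {m} (x : Subset m) → ∣ x ∣ ≡ ℕSum.sum (λ i → if lookup x i then 1 else 0)
  ∣x∣≡sum []            = ≡.refl
  ∣x∣≡sum (outside ∷ x) = ∣x∣≡sum x
  ∣x∣≡sum (inside  ∷ x) = ≡.cong suc (∣x∣≡sum x)

  ∣∙∣ : ∀ g x → ∣ g ∙ x ∣ ≡ ∣ x ∣
  ∣∙∣ g x = ≡.trans (∣x∣≡sum (g ∙ x)) (≡.trans
    (ℕSum.sum-cong-≗ {n} λ i → ≡.cong (λ b → if b then 1 else 0) (lookup∘tabulate (λ i → lookup x (g ⟨$⟩ˡ i)) i))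
    (≡.trans (≡.sym (ℕSum.sum-permute (λ i → if lookup x i then 1 else 0) (flip g))) (≡.sym (∣x∣≡sum x))))

  ∙-∩ : ∀ g x y → g ∙ (x ∩ y) ≡ (g ∙ x) ∩ (g ∙ y)
  ∙-∩ g x y = lookup-injective _ _ λ i → ≡.trans (lookup∘tabulate _ i) (≡.trans (lookup-zipWith _ _ x y)
    (≡.sym (≡.trans (lookup-zipWith _ i (g ∙ x) (g ∙ y)) (≡.cong₂ _∧_ (lookup∘tabulate _ i) (lookup∘tabulate _ i)))))
    where
    lookup-injective : ∀ {m} (x y : Subset m) → (∀ i → lookup x i ≡ lookup y i) → x ≡ y
    lookup-injective x y x≗y = ≡.trans (≡.sym (tabulate∘lookup x)) (≡.trans (tabulate-cong x≗y) (tabulate∘lookup y))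

  𝓕-InEndG : InEndG 𝓕
  𝓕-InEndG = record
    { isModuleHomomorphism = record { isBimoduleHomomorphism = record
      { +ᴹ-isGroupHomomorphism = record
        { isMonoidHomomorphism = record
          { isMagmaHomomorphism = record
            { isRelHomomorphism = record { cong = λ ψ≋φ x → ∑⊆-cong λ x′ → *-congˡ (ψ≋φ x′) }
            ; homo = λ ψ φ x → trans (∑⊆-cong λ x′ → distribˡ _ (ψ x′) (φ x′)) (∑⊆-+ (λ x′ → sign ∣ x ∩ x′ ∣ * ψ x′) (λ x′ → sign ∣ x ∩ x′ ∣ * φ x′))
            }
          ; ε-homo = λ x → trans (∑⊆-cong {n} λ x′ → zeroʳ (sign ∣ x ∩ x′ ∣)) (∑⊆-0# n)
          }
        ; ⁻¹-homo = λ ψ x → trans (∑⊆-cong λ x′ → sym (-‿distribʳ-* (sign ∣ x ∩ x′ ∣) (ψ x′))) (∑⊆-neg λ x′ → sign ∣ x ∩ x′ ∣ * ψ x′)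
        }
      ; *ₗ-homo = *-homo
      ; *ᵣ-homo = *-homo
      } }
    ; equivariant = λ g ψ x → begin
        ∑⊆ (λ x′ → sign ∣ x ∩ x′ ∣ * ψ (flip g ∙ x′))
          ≈⟨ ∑⊆-∙ g (λ x′ → sign ∣ x ∩ x′ ∣ * ψ (flip g ∙ x′)) ⟨
        ∑⊆ (λ x′ → sign ∣ x ∩ (g ∙ x′) ∣ * ψ (flip g ∙ (g ∙ x′)))
          ≈⟨ ∑⊆-cong (λ x′ → reflexive (≡.cong₂ (λ k y → sign k * ψ y)
          (≡.trans (≡.sym (∣∙∣ (flip g) (x ∩ (g ∙ x′)))) (≡.cong ∣_∣ (≡.trans (∙-∩ (flip g) x (g ∙ x′)) (≡.cong (flip g ∙ x ∩_) (flip-∙ g x′)))))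
          (flip-∙ g x′))) ⟩
        ∑⊆ (λ x′ → sign ∣ (flip g ∙ x) ∩ x′ ∣ * ψ x′)                      ∎
    }
    where
    *-homo : ∀ c ψ → 𝓕 (c *ₗ ψ) ≋ c *ₗ 𝓕 ψ
    *-homo c ψ x = trans
      (∑⊆-cong λ x′ → solve 3 (λ x y z → x :* (y :* z) := y :* (x :* z)) refl (sign ∣ x ∩ x′ ∣) c (ψ x′))
      (∑⊆-* c (λ x′ → sign ∣ x ∩ x′ ∣ * ψ x′))

  -- Kernel sums over subsets as values of `M`

  if-cong : ∀ {P : Set} (P? : Dec P) {z w} → (P → z ≈ w) →
            (if does P? then z else 0#) ≈ (if does P? then w else 0#)
  if-cong (yes p) z≈w = z≈w p
  if-cong (no _)  z≈w = refl

  ∑⊆-vanishing : ∀ {m} {P : Subset m → Set} (P? : ∀ x → Dec (P x)) {f : Subset m → ℂ} →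
    ∑⊆ (λ x → if does (P? x) then f x * 0# else 0#) ≈ 0#
  ∑⊆-vanishing {m} P? {f} = trans (∑⊆-cong λ x → vanish (P? x) (f x)) (∑⊆-0# m)
    where
    vanish : ∀ {P : Set} (P? : Dec P) z → (if does P? then z * 0# else 0#) ≈ 0#
    vanish (yes _) z = zeroʳ z
    vanish (no _)  z = refl

  -- Induction on the points of Ω: a point of `x` matches a defining clause of `M`, and a point
  -- outside `x` matches `M-sucʳ-zero` or `M-sucʳ-suc`.
  ∑⊆-∣─∣ : ∀ {m} (x : Subset m) a h →
    ∑⊆ (λ y → if does (∣ y ∣ ℕ.≟ a) then h ∣ x ─ y ∣ else 0#) ≈ M ∣ x ∣ ∣ ∁ x ∣ a h
  ∑⊆-∣─∣ []            zero    h = sym (+-identityʳ _)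
  ∑⊆-∣─∣ []            (suc a) h = refl
  ∑⊆-∣─∣ {suc m} (inside  ∷ x) zero    h = trans (+-cong (∑⊆-∣─∣ x zero (h ∘ suc)) (∑⊆-0# m)) (+-identityʳ _)
  ∑⊆-∣─∣ (inside  ∷ x) (suc a) h = trans (+-comm _ _) (+-cong (∑⊆-∣─∣ x a h) (∑⊆-∣─∣ x (suc a) (h ∘ suc)))
  ∑⊆-∣─∣ {suc m} (outside ∷ x) zero    h = trans (+-cong (∑⊆-∣─∣ x zero h) (∑⊆-0# m))
    (trans (+-identityʳ _) (sym (M-sucʳ-zero ∣ x ∣ ∣ ∁ x ∣ h)))
  ∑⊆-∣─∣ (outside ∷ x) (suc a) h = trans (+-comm _ _)
    (trans (+-cong (∑⊆-∣─∣ x a h) (∑⊆-∣─∣ x (suc a) h)) (sym (M-sucʳ-suc ∣ x ∣ ∣ ∁ x ∣ a h)))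

  -- The set `x` contains the first `i` points and misses the next `l`. Each contributing `y`
  -- contains all of them, so they add nothing to ∣x ─ y∣ and `i + l` to ∣y∣. The size of Ω is
  -- bracketed so that both recursions strip its first point.
  ∑⊆-containsInitial : ∀ i l p q → ∃ λ (x : Subset (i ℕ.+ (l ℕ.+ (p ℕ.+ q)))) → ∣ x ∣ ≡ i ℕ.+ p × (∀ a h →
    ∑⊆ (λ y → if does (∣ y ∣ ℕ.≟ i ℕ.+ l ℕ.+ a) then h ∣ x ─ y ∣ * containsInitial (i ℕ.+ l) y else 0#) ≈ M p q a h)
  ∑⊆-containsInitial zero zero p q =
    let x , ∣x∣ , ∣∁x∣ = split p q
    in x , ∣x∣ , λ a h → trans
      (∑⊆-cong {p ℕ.+ q} λ y → if-cong (∣ y ∣ ℕ.≟ a) λ _ → *-identityʳ (h ∣ x ─ y ∣))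
      (trans (∑⊆-∣─∣ x a h) (reflexive (≡.cong₂ (λ p q → M p q a h) ∣x∣ ∣∁x∣)))
    where
    split : ∀ p q → ∃ λ (x : Subset (p ℕ.+ q)) → ∣ x ∣ ≡ p × ∣ ∁ x ∣ ≡ q
    split zero    zero    = [] , ≡.refl , ≡.refl
    split zero    (suc q) = let x , ∣x∣ , ∣∁x∣ = split zero q in outside ∷ x , ∣x∣ , ≡.cong suc ∣∁x∣
    split (suc p) q       = let x , ∣x∣ , ∣∁x∣ = split p q in inside ∷ x , ≡.cong suc ∣x∣ , ∣∁x∣
  ∑⊆-containsInitial zero (suc l) p q =
    let x , ∣x∣ , sum≈ = ∑⊆-containsInitial zero l p q
    in outside ∷ x , ∣x∣ , λ a h → trans (+-cong (∑⊆-vanishing (λ y → ∣ y ∣ ℕ.≟ suc l ℕ.+ a) {λ y → h ∣ x ─ y ∣}) (sum≈ a h)) (+-identityˡ _)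
  ∑⊆-containsInitial (suc i) l p q =
    let x , ∣x∣ , sum≈ = ∑⊆-containsInitial i l p q
    in inside ∷ x , ≡.cong suc ∣x∣ , λ a h → trans (+-cong (∑⊆-vanishing (λ y → ∣ y ∣ ℕ.≟ suc i ℕ.+ l ℕ.+ a) {λ y → h (suc ∣ x ─ y ∣)}) (sum≈ a h)) (+-identityˡ _)

  table : ∀ {m} (x y : Subset m) → ∃₂ λ l o →
    ∣ x ∩ y ∣ ℕ.+ ∣ x ─ y ∣ ≡ ∣ x ∣ × l ℕ.+ o ≡ ∣ ∁ x ∣ × ∣ x ∩ y ∣ ℕ.+ l ≡ ∣ y ∣
  table []            []            = 0 , 0 , ≡.refl , ≡.refl , ≡.refl
  table (inside ∷ x)  (inside ∷ y)  = let l , o , ik , lo , il = table x y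
    in l , o , ≡.cong suc ik , lo , ≡.cong suc il
  table (inside ∷ x)  (outside ∷ y) = let l , o , ik , lo , il = table x y
    in l , o , ≡.trans (ℕ.+-suc _ _) (≡.cong suc ik) , lo , il
  table (outside ∷ x) (inside ∷ y)  = let l , o , ik , lo , il = table x y
    in suc l , o , ik , ≡.cong suc lo , ≡.trans (ℕ.+-suc _ _) (≡.cong suc il)
  table (outside ∷ x) (outside ∷ y) = let l , o , ik , lo , il = table x y
    in l , suc o , ik , ≡.trans (ℕ.+-suc _ _) (≡.cong suc lo) , il

  ∣─∣-bounds : ∀ {r₁ r₂} (x₁ x₂ : X) → ∣ x₁ ∣ ≡ r₁ → ∣ x₂ ∣ ≡ r₂ →
    r₂ ∸ r₁ ℕ.≤ ∣ x₂ ─ x₁ ∣ × ∣ x₂ ─ x₁ ∣ ℕ.≤ (n ∸ r₁) ⊓ r₂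
  ∣─∣-bounds x₁ x₂ ≡.refl ≡.refl =
    let l , o , ik , lo , il = table x₂ x₁
        i = ∣ x₂ ∩ x₁ ∣
        k = ∣ x₂ ─ x₁ ∣
    in ℕ.≤-trans (ℕ.∸-monoʳ-≤ ∣ x₂ ∣ (≡.subst (i ℕ.≤_) il (ℕ.m≤m+n i l)))
         (ℕ.≤-reflexive (≡.trans (≡.cong (_∸ i) (≡.sym ik)) (ℕ.m+n∸m≡n i k)))
     , ℕ.⊓-glb
         (≡.subst (ℕ._≤ n ∸ ∣ x₁ ∣) (ℕ.m+n∸m≡n ∣ x₁ ∣ k) (ℕ.∸-monoˡ-≤ ∣ x₁ ∣
           (≡.subst₂ ℕ._≤_
             (≡.trans (≡.cong (ℕ._+ l) (≡.sym ik)) (≡.trans (ℕ.+-assoc i k l) (≡.trans (≡.cong (i ℕ.+_) (ℕ.+-comm k l)) (≡.trans (≡.sym (ℕ.+-assoc i l k)) (≡.cong (ℕ._+ k) il)))))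
             (≡.trans (≡.cong (∣ x₂ ∣ ℕ.+_) (∣∁p∣≡n∸∣p∣ x₂)) (ℕ.m+[n∸m]≡n (∣p∣≤n x₂)))
             (ℕ.+-monoʳ-≤ ∣ x₂ ∣ (≡.subst (l ℕ.≤_) lo (ℕ.m≤m+n l o))))))
         (≡.subst (k ℕ.≤_) ik (ℕ.m≤n+m k i))

  -- The kernel of Λₛ

  module Kernel (·-cancel : ·-Cancellative) {r₁ r₂ s} (r₂≤n : r₂ ℕ.≤ n)
    (s≤r₁ : s ℕ.≤ r₁) (s≤n∸r₁ : s ℕ.≤ n ∸ r₁) (s≤r₂ : s ℕ.≤ r₂) (s≤n∸r₂ : s ℕ.≤ n ∸ r₂)
    {V₁ V₂ Λ s≤} (isComponent : IsComponent r₁ s s≤ V₁) (isΛ : IsΛ r₁ r₂ s V₁ V₂ Λ) where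
    open IsΛ isΛ

    -- Degree and normalisation belong to the polynomial, not to `kernel`, which is constrained only
    -- at attainable ∣x₂ ─ x₁∣; for r₁ < r₂ these exclude 0.
    extension : ℕ → ℂ
    extension k = evaluate polynomial (k · 1#)

    kernel≈extension : ∀ x₁ x₂ → ∣ x₁ ∣ ≡ r₁ → ∣ x₂ ∣ ≡ r₂ → kernel ∣ x₂ ─ x₁ ∣ ≈ extension ∣ x₂ ─ x₁ ∣
    kernel≈extension x₁ x₂ ∣x₁∣ ∣x₂∣ =
      let lower , upper = ∣─∣-bounds x₁ x₂ ∣x₁∣ ∣x₂∣ in agrees ∣ x₂ ─ x₁ ∣ lower upper

    r₂+[n∸r₂]≡n : r₂ ℕ.+ (n ∸ r₂) ≡ n
    r₂+[n∸r₂]≡n = ℕ.m+[n∸m]≡n r₂≤n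

    -- Λ kills the indicator of the first `i + l` points, which is orthogonal to `V₁`. The value of
    -- this zero function at an `x` placed as in `∑⊆-containsInitial` is the required `M`.
    extension-vanishesBelow : VanishesBelow s r₂ (n ∸ r₂) r₁ extension
    extension-vanishesBelow i l i+l<s =
      let x , ∣x∣ , sum≈ = indicator-sum
      in begin
        M p q a extension       ≈⟨ sum≈ extension ⟨
        ∑X r₁ (λ y → extension ∣ x ─ y ∣ * f y)
          ≈⟨ (∑⊆-cong λ y → if-cong (∣ y ∣ ℕ.≟ r₁) λ ∣y∣ → *-congʳ (kernel≈extension y x ∣y∣ ∣x∣)) ⟨
        ∑X r₁ (λ y → kernel ∣ x ─ y ∣ * f y)      ≈⟨ kernel-sum f x ∣x∣ ⟨
        Λ f x
          ≈⟨ vanishes f (⟨containsInitial,component⟩ ·-cancel isComponent i+l<s) x ⟩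
        0#                                        ∎
      where
      p = r₂ ∸ i
      q = n ∸ r₂ ∸ l
      a = r₁ ∸ (i ℕ.+ l)
      f = containsInitial {n} (i ℕ.+ l)
      i+l≤s = ℕ.<⇒≤ i+l<s
      i+p≡r₂ : i ℕ.+ p ≡ r₂
      i+p≡r₂ = ℕ.m+[n∸m]≡n (ℕ.≤-trans (ℕ.m≤m+n i l) (ℕ.≤-trans i+l≤s s≤r₂))
      l+q≡n∸r₂ : l ℕ.+ q ≡ n ∸ r₂
      l+q≡n∸r₂ = ℕ.m+[n∸m]≡n (ℕ.≤-trans (ℕ.m≤n+m l i) (ℕ.≤-trans i+l≤s s≤n∸r₂))
      total : i ℕ.+ (l ℕ.+ (p ℕ.+ q)) ≡ n
      total = ≡.trans (solveℕ 4 (λ i l p q → i ⊕ (l ⊕ (p ⊕ q)) ⊜ (i ⊕ p) ⊕ (l ⊕ q)) ≡.refl i l p q)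
        (≡.trans (≡.cong₂ ℕ._+_ i+p≡r₂ l+q≡n∸r₂) r₂+[n∸r₂]≡n)
        where open ℕSolver using () renaming (solve to solveℕ; _:+_ to _⊕_; _:=_ to _⊜_)
      indicator-sum : ∃ λ (x : X) → ∣ x ∣ ≡ r₂ × (∀ h → ∑X r₁ (λ y → h ∣ x ─ y ∣ * f y) ≈ M p q a h)
      indicator-sum =
        let x , ∣x∣ , sum≈ = ≡.subst (λ m → ∃ λ (x : Subset m) → ∣ x ∣ ≡ i ℕ.+ p × (∀ a h →
              ∑⊆ (λ y → if does (∣ y ∣ ℕ.≟ i ℕ.+ l ℕ.+ a) then h ∣ x ─ y ∣ * containsInitial (i ℕ.+ l) y else 0#) ≈ M p q a h))
              total (∑⊆-containsInitial i l p q)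
        in x , ≡.trans ∣x∣ i+p≡r₂ , λ h → ≡.subst
          (λ r → ∑⊆ (λ y → if does (∣ y ∣ ℕ.≟ r) then h ∣ x ─ y ∣ * f y else 0#) ≈ M p q a h)
          (ℕ.m+[n∸m]≡n (ℕ.≤-trans i+l≤s s≤r₁)) (sum≈ a h)

    extension-degree : Degree≤ s extension
    extension-degree = Degree≤-polynomial s polynomial

    extension-∇^ : r₁ ℕ.≤ n →
      ((((n ∸ s ℕ.+ 1) P s) ℕ.* s !) · 1#) ≈ (((n ∸ r₁) P s) ℕ.* (r₂ P s)) · ∇^ s extension 0
    extension-∇^ r₁≤n = trans
      (sym (trans (×-congˡ {extension 0} (≡.cong (λ m → ((m ∸ s ℕ.+ 1) P s) ℕ.* s !) r₂+[n∸r₂]≡n)) (×-congʳ (((n ∸ s ℕ.+ 1) P s) ℕ.* s !) normalised)))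
      (∇^-at-0 ·-cancel s r₂ (n ∸ r₂) r₁ (n ∸ r₁) extension
        (≡.trans (ℕ.m+[n∸m]≡n r₁≤n) (≡.sym r₂+[n∸r₂]≡n)) s≤r₂ s≤n∸r₂ s≤r₁ s≤n∸r₁ extension-degree extension-vanishesBelow)

  -- The coefficients in ℂ

  ofℝ-krawtchouk : ∀ a p t → ofℝ (Coefficients.krawtchouk ℝ n a p t) ≈ krawtchouk′ a p (t ∸ p)
  ofℝ-krawtchouk a p t = trans (ofℝ-sum (suc a) (λ j → (R.- R.1#) ℝ-Exp.^ toℕ j R.* R.ι (p C toℕ j) R.* R.ι ((t ∸ p) C (a ∸ toℕ j)))) (sum-cong-≋ {suc a} λ j →
    trans (ofℝ-* _ _) (*-cong
      (trans (ofℝ-* _ _) (*-cong (trans (ofℝ-^ (R.- R.1#) (toℕ j)) (^-congˡ (toℕ j) (ofℝ-neg R.1#))) (ofℝ-ι (p C toℕ j))))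
      (ofℝ-ι ((t ∸ p) C (a ∸ toℕ j)))))

  coefficient : (r₁ r₂ : Fin (suc n)) → Fin (suc (N (toℕ r₁) (toℕ r₂))) → ℂ
  coefficient r₁ r₂ s = ofℝ (k r₁ r₂ s) * ofℝ (α r₁ r₂ s)

  module _ (r₁ r₂ : Fin (suc n)) (s : Fin (suc (N (toℕ r₁) (toℕ r₂)))) where
    private
      σ a p : ℕ
      σ = toℕ s
      a = toℕ r₁
      p = toℕ r₂
      q u : ℕ
      q = n ∸ p
      u = n ∸ a

    s≤N⇒s≤r₁⊓[n∸r₁] : toℕ s ℕ.≤ toℕ r₁ ⊓ (n ∸ toℕ r₁)
    s≤N⇒s≤r₁⊓[n∸r₁] = ℕ.m≤n⊓o⇒m≤n _ p (ℕ.m≤n⊓o⇒m≤n _ q (Fin.toℕ≤pred[n] s))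

    s≤N⇒s≤r₁ : toℕ s ℕ.≤ toℕ r₁
    s≤N⇒s≤r₁ = ℕ.m≤n⊓o⇒m≤n a u s≤N⇒s≤r₁⊓[n∸r₁]

    s≤N⇒s≤n∸r₁ : toℕ s ℕ.≤ n ∸ toℕ r₁
    s≤N⇒s≤n∸r₁ = ℕ.m≤n⊓o⇒m≤o a u s≤N⇒s≤r₁⊓[n∸r₁]

    s≤N⇒s≤r₂ : toℕ s ℕ.≤ toℕ r₂
    s≤N⇒s≤r₂ = ℕ.m≤n⊓o⇒m≤o _ p (ℕ.m≤n⊓o⇒m≤n _ q (Fin.toℕ≤pred[n] s))

    s≤N⇒s≤n∸r₂ : toℕ s ℕ.≤ n ∸ toℕ r₂
    s≤N⇒s≤n∸r₂ = ℕ.m≤n⊓o⇒m≤o _ q (Fin.toℕ≤pred[n] s)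

    private
      [p∸σ]+[q∸σ] : (p ∸ σ) ℕ.+ (q ∸ σ) ≡ n ∸ 2 ℕ.* σ
      [p∸σ]+[q∸σ] = ≡.sym (≡.trans (≡.cong (n ∸_) (≡.cong (σ ℕ.+_) (ℕ.+-identityʳ σ)))
        (≡.trans (≡.sym (ℕ.∸-+-assoc n σ σ))
        (≡.trans (≡.cong (λ m → m ∸ σ ∸ σ) (≡.sym (ℕ.m+[n∸m]≡n (Fin.toℕ≤pred[n] r₂))))
        (≡.trans (≡.cong (_∸ σ) (ℕ.+-∸-assoc p s≤N⇒s≤n∸r₂)) (ℕ.+-∸-comm (q ∸ σ) s≤N⇒s≤r₂)))))

    coefficient-identity :
      coefficient r₁ r₂ s * (((((p ∸ σ) ℕ.+ (q ∸ σ)) C (a ∸ σ)) ℕ.* (((n ∸ σ ℕ.+ 1) P σ) ℕ.* σ !)) · 1#) ≈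
      (- (1# + 1#)) ^ σ * krawtchouk′ (a ∸ σ) (p ∸ σ) (q ∸ σ) * (((u P σ) ℕ.* (p P σ)) · 1#)
    coefficient-identity = begin
      ofℝ (k r₁ r₂ s) * ofℝ (α r₁ r₂ s) * ((c ℕ.* (e ℕ.* f)) · 1#)
        ≈⟨ *-cong (ofℝ-* _ _) (trans (ofℝ-* _ _) (trans (*-cong (trans (ofℝ-ι ((n ∸ 2 ℕ.* σ) C (a ∸ σ))) (reflexive (≡.cong (λ t → (t C (a ∸ σ)) · 1#) (≡.sym [p∸σ]+[q∸σ]))))
             (trans (ofℝ-* _ _) (trans (*-cong (ofℝ-ι e) (ofℝ-ι f)) (sym (×1-homo-* e f))))) (sym (×1-homo-* c (e ℕ.* f))))) ⟨
      ofℝ (k r₁ r₂ s R.* α r₁ r₂ s) * ofℝ (R.ι ((n ∸ 2 ℕ.* σ) C (a ∸ σ)) R.* (R.ι e R.* R.ι f))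
        ≈⟨ ofℝ-* _ _ ⟨
      ofℝ (k r₁ r₂ s R.* α r₁ r₂ s R.* (R.ι ((n ∸ 2 ℕ.* σ) C (a ∸ σ)) R.* (R.ι e R.* R.ι f)))
        ≈⟨ ofℝ-cong (k*α-identity n r₁ r₂ s) ⟩
      ofℝ ((R.- R.ι 2) ℝ-Exp.^ σ R.* Coefficients.krawtchouk ℝ n (a ∸ σ) (p ∸ σ) (n ∸ 2 ℕ.* σ) R.* (R.ι (u P σ) R.* R.ι (p P σ)))
        ≈⟨ trans (ofℝ-* _ _) (*-cong (trans (ofℝ-* _ _) (*-cong
             (trans (ofℝ-^ (R.- R.ι 2) σ) (^-congˡ σ (trans (ofℝ-neg (R.ι 2)) (-‿cong (trans (ofℝ-ι 2) (+-congˡ (+-identityʳ 1#)))))))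
             (trans (ofℝ-krawtchouk (a ∸ σ) (p ∸ σ) (n ∸ 2 ℕ.* σ)) (reflexive (≡.cong (krawtchouk′ (a ∸ σ) (p ∸ σ))
               (≡.trans (≡.cong (_∸ (p ∸ σ)) (≡.sym [p∸σ]+[q∸σ])) (ℕ.m+n∸m≡n (p ∸ σ) (q ∸ σ))))))))
             (trans (ofℝ-* _ _) (trans (*-cong (ofℝ-ι (u P σ)) (ofℝ-ι (p P σ))) (sym (×1-homo-* (u P σ) (p P σ)))))) ⟩
      (- (1# + 1#)) ^ σ * krawtchouk′ (a ∸ σ) (p ∸ σ) (q ∸ σ) * (((u P σ) ℕ.* (p P σ)) · 1#) ∎
      where
      c e f : ℕ
      c = ((p ∸ σ) ℕ.+ (q ∸ σ)) C (a ∸ σ)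
      e = (n ∸ σ ℕ.+ 1) P σ
      f = σ !

  -- Decomposition of the Fourier transform

  module Decomposition
    (V : ℕ → ℕ → GSubspace)
    (isComponent : ∀ r s → r ℕ.≤ n → (s≤ : s ℕ.≤ r ⊓ (n ∸ r)) → IsComponent r s s≤ (V r s))
    (Λ : (r₁ r₂ : Fin (suc n)) → Fin (suc (N (toℕ r₁) (toℕ r₂))) → L² → L²)
    (isΛ : ∀ r₁ r₂ s → IsΛ (toℕ r₁) (toℕ r₂) (toℕ s) (V (toℕ r₁) (toℕ s)) (V (toℕ r₂) (toℕ s)) (Λ r₁ r₂ s))
    where

    module Λ (r₁ r₂ : Fin (suc n)) (s : Fin (suc (N (toℕ r₁) (toℕ r₂)))) where
      open IsΛ (isΛ r₁ r₂ s) public using (kernel; kernel-sum; supported)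
      open Kernel ·-cancel-ℂ (Fin.toℕ≤pred[n] r₂) (s≤N⇒s≤r₁ r₁ r₂ s) (s≤N⇒s≤n∸r₁ r₁ r₂ s) (s≤N⇒s≤r₂ r₁ r₂ s) (s≤N⇒s≤n∸r₂ r₁ r₂ s)
        (isComponent (toℕ r₁) (toℕ s) (Fin.toℕ≤pred[n] r₁) (s≤N⇒s≤r₁⊓[n∸r₁] r₁ r₂ s)) (isΛ r₁ r₂ s) public

    module _ (r₁ r₂ : Fin (suc n)) where
      private
        a p q u : ℕ
        a = toℕ r₁
        p = toℕ r₂
        q = n ∸ p
        u = n ∸ a
        S : Set
        S = Fin (suc (N a p))
        L : S → ℕ → ℂ
        L = Λ.extension r₁ r₂
        K : S → ℂ
        K = coefficient r₁ r₂

      -- By `E-degree` and `extension-∇^` the value `E s` of the kernel is an explicit quotient of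
      -- integers, and `k` times `α` is made to cancel it. What remains is the value from `E-sign`.
      coefficient*E : ∀ s → K s * E (toℕ s) p q a (L s) ≈
        (- (1# + 1#)) ^ toℕ s * krawtchouk′ (a ∸ toℕ s) (p ∸ toℕ s) (q ∸ toℕ s)
      coefficient*E s = ·-cancelˡ D {{D≢0}} (begin
        D · (K s * E σ p q a (L s))
          ≈⟨ ×-congʳ D (*-congˡ (E-degree σ p q a (L s) (Λ.extension-degree r₁ r₂ s))) ⟩
        D · (K s * (c · x))               ≈⟨ ×-comm-* D (K s) (c · x) ⟨
        K s * (D · (c · x))
          ≈⟨ *-congˡ (trans (×-assocˡ x D c) (trans (×-congˡ (ℕ.*-comm D c)) (sym (×-assocˡ x c D)))) ⟩
        K s * (c · (D · x))
          ≈⟨ *-congˡ (×-congʳ c (Λ.extension-∇^ r₁ r₂ s (Fin.toℕ≤pred[n] r₁))) ⟨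
        K s * (c · (e · 1#))              ≈⟨ *-congˡ (×-assocˡ 1# c e) ⟩
        K s * ((c ℕ.* e) · 1#)            ≈⟨ coefficient-identity r₁ r₂ s ⟩
        w * (D · 1#)                      ≈⟨ ×-comm-* D w 1# ⟩
        D · (w * 1#)                      ≈⟨ ×-congʳ D (*-identityʳ w) ⟩
        D · w                             ∎)
        where
        σ = toℕ s
        x = ∇^ σ (L s) 0
        c e D : ℕ
        c = ((p ∸ σ) ℕ.+ (q ∸ σ)) C (a ∸ σ)
        e = ((n ∸ σ ℕ.+ 1) P σ) ℕ.* σ !
        D = (u P σ) ℕ.* (p P σ)
        w = (- (1# + 1#)) ^ σ * krawtchouk′ (a ∸ σ) (p ∸ σ) (q ∸ σ)
        D≢0 : ℕ.NonZero D
        D≢0 = ℕ.m*n≢0 (u P σ) (p P σ) {{P-nonZero (s≤N⇒s≤n∸r₁ r₁ r₂ s)}} {{P-nonZero (s≤N⇒s≤r₂ r₁ r₂ s)}}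
        ·-cancelˡ : ∀ m {x y} → .{{ℕ.NonZero m}} → m · x ≈ m · y → x ≈ y
        ·-cancelˡ m eq = ·-cancel⇒·-injective ·-cancel-ℂ m eq

      -- Every `E j` in range kills the difference of the two sides: the terms with `s ≠ j` vanish
      -- by `E-below` or `E-above`, and the term `s = j` balances by `coefficient*E`. Then
      -- `E-determines` applies.
      sign≈∑extension : ∀ i k l m → i ℕ.+ k ≡ p → l ℕ.+ m ≡ q → i ℕ.+ l ≡ a →
                        sign p * sign k ≈ ∑[ s ≤ N a p ] (K s * L s k)
      sign≈∑extension i k l m ik lm il = x∙y⁻¹≈ε⇒x≈y _ _ (trans (+-congˡ (sym (∑-neg k)))
        (E-determines ·-cancel-ℂ p q a g E-vanishes i k l m ik lm il))
        where
        f : S → ℕ → ℂ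
        f s k = - K s * L s k
        g : ℕ → ℂ
        g k = sign p * sign k + ∑[ s ≤ N a p ] f s k
        ∑-neg : ∀ k → ∑[ s ≤ N a p ] f s k ≈ - ∑[ s ≤ N a p ] (K s * L s k)
        ∑-neg k = trans (sum-cong-≋ {suc (N a p)} λ s → trans (sym (-‿distribˡ-* (K s) (L s k))) (sym (-1*x≈-x _)))
          (trans (sym (*-distribˡ-sum {suc (N a p)} (- 1#) (λ s → K s * L s k))) (-1*x≈-x _))
        other : ∀ s s′ → s′ ≢ s → E (toℕ s) p q a (f s′) ≈ 0#
        other s s′ s′≢s = trans (E-* (toℕ s) p q a (- K s′) (L s′)) (trans (*-congˡ vanish) (zeroʳ _))
          where
          vanish : E (toℕ s) p q a (L s′) ≈ 0#
          vanish with ℕ.<-cmp (toℕ s) (toℕ s′)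
          ... | tri< s<s′ _ _ = E-below s<s′ (s≤N⇒s≤r₂ r₁ r₂ s′) (s≤N⇒s≤n∸r₂ r₁ r₂ s′) (s≤N⇒s≤r₁ r₁ r₂ s′) (Λ.extension-vanishesBelow r₁ r₂ s′)
          ... | tri≈ _ s≡s′ _ = contradiction (Fin.toℕ-injective (≡.sym s≡s′)) s′≢s
          ... | tri> _ _ s>s′ = E-above p q a (L s′) s>s′ (Λ.extension-degree r₁ r₂ s′)
        E-g : ∀ s → E (toℕ s) p q a g ≈ 0#
        E-g s = begin
          E (toℕ s) p q a g     ≈⟨ E-+ (toℕ s) p q a (λ k → sign p * sign k) _ ⟩
          E (toℕ s) p q a (λ k → sign p * sign k) + E (toℕ s) p q a (λ k → ∑[ s ≤ N a p ] f s k)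
            ≈⟨ +-cong (E-sign (toℕ s) p q a (s≤N⇒s≤r₂ r₁ r₂ s)) (trans (E-sum (toℕ s) p q a (suc (N a p)) f) (sum-single (suc (N a p)) _ s (other s))) ⟩
          w + E (toℕ s) p q a (f s)
            ≈⟨ +-congˡ (trans (E-* (toℕ s) p q a (- K s) (L s)) (trans (sym (-‿distribˡ-* _ _)) (-‿cong (coefficient*E s)))) ⟩
          w - w                              ≈⟨ -‿inverseʳ w ⟩
          0#                                 ∎
          where w = (- (1# + 1#)) ^ toℕ s * krawtchouk′ (a ∸ toℕ s) (p ∸ toℕ s) (q ∸ toℕ s)
        E-vanishes : ∀ j → j ℕ.≤ p → j ℕ.≤ q → j ℕ.≤ a → j ℕ.+ a ℕ.≤ p ℕ.+ q → E j p q a g ≈ 0#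
        E-vanishes j j≤p j≤q j≤a j+a≤p+q = ≡.subst (λ j → E j p q a g ≈ 0#) (Fin.toℕ-fromℕ< (s≤s j≤N)) (E-g (fromℕ< (s≤s j≤N)))
          where
          -- As p + q = n, the condition `j + a ≤ p + q` of `E-determines` is the bound
          -- `j ≤ n ∸ r₁`. The four conditions together say exactly `j ≤ N a p`.
          j≤u : j ℕ.≤ u
          j≤u = ≡.subst (ℕ._≤ u) (ℕ.m+n∸n≡m j a) (ℕ.∸-monoˡ-≤ a (≡.subst (j ℕ.+ a ℕ.≤_) (ℕ.m+[n∸m]≡n (Fin.toℕ≤pred[n] r₂)) j+a≤p+q))
          j≤N : j ℕ.≤ N a p
          j≤N = ℕ.⊓-glb (ℕ.⊓-glb (ℕ.⊓-glb j≤a j≤u) j≤p) j≤q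

      sign≈∑kernel : ∀ x₁ x₂ → ∣ x₁ ∣ ≡ a → ∣ x₂ ∣ ≡ p →
        sign ∣ x₂ ∩ x₁ ∣ ≈ ∑[ s ≤ N a p ] (K s * Λ.kernel r₁ r₂ s ∣ x₂ ─ x₁ ∣)
      sign≈∑kernel x₁ x₂ ∣x₁∣ ∣x₂∣ =
        let l , m , ik , lm , il = table x₂ x₁
            κ = ∣ x₂ ─ x₁ ∣
        in begin
          sign ∣ x₂ ∩ x₁ ∣                       ≈⟨ sign-+-cancel ∣ x₂ ∩ x₁ ∣ κ ⟨
          sign (∣ x₂ ∩ x₁ ∣ ℕ.+ κ) * sign κ      ≈⟨ *-congʳ (reflexive (≡.cong sign (≡.trans ik ∣x₂∣))) ⟩
          sign p * sign κ                        ≈⟨ sign≈∑extension ∣ x₂ ∩ x₁ ∣ κ l m (≡.trans ik ∣x₂∣)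
                                                      (≡.trans lm (≡.trans (∣∁p∣≡n∸∣p∣ x₂) (≡.cong (n ∸_) ∣x₂∣))) (≡.trans il ∣x₁∣) ⟩
          ∑[ s ≤ N a p ] (K s * L s κ)
            ≈⟨ sum-cong-≋ {suc (N a p)} (λ s → *-congˡ {K s} (Λ.kernel≈extension r₁ r₂ s x₁ x₂ ∣x₁∣ ∣x₂∣)) ⟨
          ∑[ s ≤ N a p ] (K s * Λ.kernel r₁ r₂ s κ) ∎

      ∑X-sign : ∀ ψ x → ∣ x ∣ ≡ p →
        ∑X a (λ y → sign ∣ x ∩ y ∣ * ψ y) ≈ ∑[ s ≤ N a p ] (ofℝ (k r₁ r₂ s) * (ofℝ (α r₁ r₂ s) * Λ r₁ r₂ s ψ x))
      ∑X-sign ψ x ∣x∣ = begin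
        ∑X a (λ y → sign ∣ x ∩ y ∣ * ψ y)
          ≈⟨ (∑⊆-cong λ y → expand y (∣ y ∣ ℕ.≟ a)) ⟩
        ∑⊆ (λ y → ∑[ s ≤ N a p ] (K s * term s y))
          ≈⟨ ∑⊆-sum (suc (N a p)) (λ s y → K s * term s y) ⟩
        ∑[ s ≤ N a p ] ∑⊆ (λ y → K s * term s y)
          ≈⟨ sum-cong-≋ {suc (N a p)} (λ s → trans (∑⊆-* (K s) (term s)) (trans (*-congˡ (sym (Λ.kernel-sum r₁ r₂ s ψ x ∣x∣))) (*-assoc _ _ _))) ⟩
        ∑[ s ≤ N a p ] (ofℝ (k r₁ r₂ s) * (ofℝ (α r₁ r₂ s) * Λ r₁ r₂ s ψ x)) ∎
        where
        term : S → X → ℂ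
        term s y = if does (∣ y ∣ ℕ.≟ a) then Λ.kernel r₁ r₂ s ∣ x ─ y ∣ * ψ y else 0#
        expand : ∀ y (d : Dec (∣ y ∣ ≡ a)) → (if does d then sign ∣ x ∩ y ∣ * ψ y else 0#) ≈
          ∑[ s ≤ N a p ] (K s * (if does d then Λ.kernel r₁ r₂ s ∣ x ─ y ∣ * ψ y else 0#))
        expand y (yes ∣y∣) = trans (*-congʳ (sign≈∑kernel y x ∣y∣ ∣x∣)) (trans
          (*-distribʳ-sum {suc (N a p)} (ψ y) (λ s → K s * Λ.kernel r₁ r₂ s ∣ x ─ y ∣))
          (sum-cong-≋ {suc (N a p)} λ s → *-assoc (K s) (Λ.kernel r₁ r₂ s ∣ x ─ y ∣) (ψ y)))
        expand y (no _)    = sym (trans (sum-cong-≋ {suc (N a p)} {y = λ _ → 0#} λ s → zeroʳ (K s)) (sum-replicate-zero (suc (N a p))))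

    -- The subsets summed over are sorted by size, which gives the sum over `r₁`. In the sum over
    -- `r₂` only r₂ = ∣x∣ survives at `x`, by the support of Λ ψ.
    𝓕≋∑ : ∀ ψ → 𝓕 ψ ≋ ∑ᴹ[ r₁ ≤ n ] ∑ᴹ[ r₂ ≤ n ] ∑ᴹ[ s ≤ N (toℕ r₁) (toℕ r₂) ]
                        ofℝ (k r₁ r₂ s) *ₗ ofℝ (α r₁ r₂ s) *ₗ Λ r₁ r₂ s ψ
    𝓕≋∑ ψ x = begin
      ∑⊆ F                                                  ≈⟨ (∑⊆-cong λ y → by-size y) ⟩
      ∑⊆ (λ y → ∑[ r₁ ≤ n ] (if does (∣ y ∣ ℕ.≟ toℕ r₁) then F y else 0#))
        ≈⟨ ∑⊆-sum (suc n) (λ r₁ y → if does (∣ y ∣ ℕ.≟ toℕ r₁) then F y else 0#) ⟩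
      ∑[ r₁ ≤ n ] ∑X (toℕ r₁) F
        ≈⟨ sum-cong-≋ {suc n} (λ r₁ → ∑X-sign r₁ ρ₂ ψ x ∣x∣) ⟩
      ∑[ r₁ ≤ n ] ∑[ s ≤ N (toℕ r₁) (toℕ ρ₂) ] T r₁ ρ₂ s
        ≈⟨ sum-cong-≋ {suc n} (λ r₁ → sum-single (suc n) (λ r₂ → ∑[ s ≤ N (toℕ r₁) (toℕ r₂) ] T r₁ r₂ s) ρ₂ (other r₁)) ⟨
      ∑[ r₁ ≤ n ] ∑[ r₂ ≤ n ] ∑[ s ≤ N (toℕ r₁) (toℕ r₂) ] T r₁ r₂ s
        ≈⟨ sum-cong-≋ {suc n} (λ r₁ → trans (∑ᴹ-at (λ r₂ → ∑ᴹ[ s ≤ N (toℕ r₁) (toℕ r₂) ] (λ x → Tᴹ r₁ r₂ s x)) x) (sum-cong-≋ {suc n} λ r₂ → ∑ᴹ-at (Tᴹ r₁ r₂) x)) ⟨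
      ∑[ r₁ ≤ n ] (∑ᴹ[ r₂ ≤ n ] ∑ᴹ[ s ≤ N (toℕ r₁) (toℕ r₂) ] Tᴹ r₁ r₂ s) x
        ≈⟨ ∑ᴹ-at (λ r₁ → ∑ᴹ[ r₂ ≤ n ] ∑ᴹ[ s ≤ N (toℕ r₁) (toℕ r₂) ] Tᴹ r₁ r₂ s) x ⟨
      (∑ᴹ[ r₁ ≤ n ] ∑ᴹ[ r₂ ≤ n ] ∑ᴹ[ s ≤ N (toℕ r₁) (toℕ r₂) ] Tᴹ r₁ r₂ s) x ∎
      where
      F : X → ℂ
      F y = sign ∣ x ∩ y ∣ * ψ y
      Tᴹ : ∀ r₁ r₂ → Fin (suc (N (toℕ r₁) (toℕ r₂))) → L²
      Tᴹ r₁ r₂ s = ofℝ (k r₁ r₂ s) *ₗ ofℝ (α r₁ r₂ s) *ₗ Λ r₁ r₂ s ψ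
      T : ∀ r₁ r₂ → Fin (suc (N (toℕ r₁) (toℕ r₂))) → ℂ
      T r₁ r₂ s = Tᴹ r₁ r₂ s x
      size : X → Fin (suc n)
      size y = fromℕ< (s≤s (∣p∣≤n y))
      toℕ-size : ∀ y → ∣ y ∣ ≡ toℕ (size y)
      toℕ-size y = ≡.sym (Fin.toℕ-fromℕ< (s≤s (∣p∣≤n y)))
      ρ₂ = size x
      ∣x∣ : ∣ x ∣ ≡ toℕ ρ₂
      ∣x∣ = toℕ-size x
      by-size : ∀ y → F y ≈ ∑[ r₁ ≤ n ] (if does (∣ y ∣ ℕ.≟ toℕ r₁) then F y else 0#)
      by-size y = sym (trans (sum-single (suc n) (λ r₁ → if does (∣ y ∣ ℕ.≟ toℕ r₁) then F y else 0#) (size y) (λ r₁ r₁≢ →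
          reflexive (≡.cong (λ b → if b then F y else 0#) (dec-false (∣ y ∣ ℕ.≟ toℕ r₁) λ ∣y∣≡ → r₁≢ (Fin.toℕ-injective (≡.trans (≡.sym ∣y∣≡) (toℕ-size y)))))))
        (reflexive (≡.cong (λ b → if b then F y else 0#) (dec-true (∣ y ∣ ℕ.≟ toℕ (size y)) (toℕ-size y)))))
      other : ∀ r₁ r₂ → r₂ ≢ ρ₂ → ∑[ s ≤ N (toℕ r₁) (toℕ r₂) ] T r₁ r₂ s ≈ 0#
      other r₁ r₂ r₂≢ρ₂ = trans
        (sum-cong-≋ {suc (N (toℕ r₁) (toℕ r₂))} {y = λ _ → 0#} λ s → trans (*-congˡ {ofℝ (k r₁ r₂ s)} (trans (*-congˡ {ofℝ (α r₁ r₂ s)} (Λ.supported r₁ r₂ s ψ x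
          (λ ∣x∣≡ → r₂≢ρ₂ (Fin.toℕ-injective (≡.trans (≡.sym ∣x∣≡) ∣x∣))))) (zeroʳ _))) (zeroʳ _))
        (sum-replicate-zero (suc (N (toℕ r₁) (toℕ r₂))))
      ∑ᴹ-at : ∀ {m} (φ : Fin (suc m) → L²) x → ∑ᴹ m φ x ≈ ∑[ i ≤ m ] φ i x
      ∑ᴹ-at {zero}  φ x = refl
      ∑ᴹ-at {suc m} φ x = +-congˡ (∑ᴹ-at (φ ∘ suc) x)

theorem4 : (ℝ : RealNumbers) (n : ℕ) → 1 ≤ n →
    let open PowerSet ℝ n in
    InEndG 𝓕 ×
    ((V : ℕ → ℕ → GSubspace) →
    (∀ r s → r ≤ n → (s≤ : s ≤ r ⊓ (n ∸ r)) → IsComponent r s s≤ (V r s)) →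
    (Λ : (r₁ r₂ : Fin (suc n)) → Fin (suc (N (toℕ r₁) (toℕ r₂))) → L² → L²) →
    (∀ r₁ r₂ s → IsΛ (toℕ r₁) (toℕ r₂) (toℕ s)
    (V (toℕ r₁) (toℕ s)) (V (toℕ r₂) (toℕ s)) (Λ r₁ r₂ s)) →
    let Λ̃ = λ r₁ r₂ s ψ → ofℝ (α r₁ r₂ s) *ₗ Λ r₁ r₂ s ψ in
    ∀ ψ → 𝓕 ψ ≋ ∑ᴹ[ r₁ ≤ n ] ∑ᴹ[ r₂ ≤ n ] ∑ᴹ[ s ≤ N (toℕ r₁) (toℕ r₂) ]
    ofℝ (k r₁ r₂ s) *ₗ Λ̃ r₁ r₂ s ψ)
theorem4 ℝ n _ = 𝓕-InEndG , Decomposition.𝓕≋∑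
  where open SubsetSums ℝ n
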